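{- For every integer $t$ there exists an integer $\tau$ (depending only on $t$) such that the following holds. Let $G\in\mathcal{C}_{tt}$, let $S$ be a minimal separator of $G$, and let $Y\subseteq S\setminus\operatorname{Hub}(G)$ be a stable set. Then $|Y|\leq\tau$.
   Context: Graphs are finite and simple; a path is an induced path and $P^*$ its interior. A hole is an induced cycle on at least four vertices; a theta is three internally vertex-disjoint paths between two vertices, each of length at least 2, with pairwise anticomplete interiors; a prism consists of three vertex-disjoint paths $a_i\text{ - }\dots\text{ - }b_i$, each of length at least 1, with $a_1a_2a_3$, $b_1b_2b_3$ triangles and no other edges between them; a wheel $(H,x)$ is a hole $H$ and a vertex $x$ with at least three neighbors in $H$, even if that number is even. $\mathcal{C}$: graphs with no induced $C_4$, theta, prism or even wheel; $\mathcal{C}_t$: those with no clique of size $t$; $\mathcal{C}_{tt}$: those in $\mathcal{C}_t$ with no induced generalized $t$-pyramid, where a generalized $k$-pyramid is a graph whose vertex set is the disjoint union of paths $P,Q,R_1,\dots,R_k$ such that $P\cup Q$ is a hole; $R_i$ has ends $a_i,b_i$; $a_i$ has exactly two neighbors $x_i,y_i$ in $P$, both in $P^*$ and adjacent; $b_i$ has exactly one neighbor $z_i$ in $Q$; $R_i\setminus\{a_i,b_i\}$ is anticomplete to $P\cup Q$; distinct $R_i$ are pairwise anticomplete; $P$ traverses $x_1,y_1,\dots,x_k,y_k$ in order; $Q$ traverses $z_1,\dots,z_k$ in order (some may coincide); $y_i\neq x_{i+1}$. A wheel $(H,x)$ is a twin wheel if $N(x)\cap H$ induces a path of length two, a short pyramid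 if $|N(x)\cap H|=3$ and $x$ has exactly two adjacent neighbors in $H$, proper otherwise; $\operatorname{Hub}(G)$ is the set of $x$ with $(H,x)$ a proper wheel for some hole $H$. A set $X\subseteq V(G)$ is a minimal separator if there exist $u,v$ in different components of $G\setminus X$ that lie in the same component of $G\setminus Y$ for every $Y\subsetneq X$. -}

module Defs where

open import Data.Nat using (ℕ; zero; suc; _+_; _≤_; _<_)
open import Data.Nat.Divisibility using (_∣_)
open import Data.Fin using (Fin; toℕ; fromℕ) renaming (zero to fzero; suc to fsuc)
open import Data.Fin.Subset using (Subset; _∈_; _∉_; _⊆_; _⊂_; ∣_∣)
open import Data.Bool using (Bool; true; false; if_then_else_)
open import Data.Product using (Σ; ∃; _×_; _,_)
open import Data.Sum using (_⊎_)
open import Data.Empty using (⊥)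
open import Relation.Nullary using (¬_)
open import Relation.Binary.PropositionalEquality using (_≡_; _≢_)

record Graph : Set where
  field
    n      : ℕ
    adj    : Fin n → Fin n → Bool
    sym    : ∀ u v → adj u v ≡ adj v u
    irrefl : ∀ v → adj v v ≡ false

_⇔_ : Set → Set → Set
A ⇔ B = (A → B) × (B → A)
infix 3 _⇔_

countB : ∀ {m} → (Fin m → Bool) → ℕ
countB {zero}  f = 0
countB {suc m} f = (if f fzero then 1 else 0) + countB (λ i → f (fsuc i))

module _ (G : Graph) where
  open Graph G

  V : Set
  V = Fin n

  E : V → V → Set
  E u v = adj u v ≡ true

  Consec : ∀ {m} → Fin m → Fin m → Set
  Consec i j = suc (toℕ i) ≡ toℕ j ⊎ suc (toℕ j) ≡ toℕ i

  CycNext : (m : ℕ) → Fin m → Fin m → Set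
  CycNext m i j = suc (toℕ i) ≡ toℕ j ⊎ (suc (toℕ i) ≡ m × toℕ j ≡ 0)

  CycConsec : (m : ℕ) → Fin m → Fin m → Set
  CycConsec m i j = CycNext m i j ⊎ CycNext m j i

  record Path : Set where
    field
      len : ℕ
      vtx : Fin (suc len) → V
      inj : ∀ i j → vtx i ≡ vtx j → i ≡ j
      ind : ∀ i j → E (vtx i) (vtx j) ⇔ Consec i j

  start : Path → V
  start p = Path.vtx p fzero

  end : Path → V
  end p = Path.vtx p (fromℕ (Path.len p))

  OnP : Path → V → Set
  OnP p v = ∃ λ i → Path.vtx p i ≡ v

  Inner : Path → V → Set
  Inner p v = ∃ λ i → (0 < toℕ i) × (toℕ i < Path.len p) × (Path.vtx p i ≡ v)

  record Hole : Set where
    field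
      len  : ℕ
      big  : 4 ≤ len
      vtx  : Fin len → V
      inj  : ∀ i j → vtx i ≡ vtx j → i ≡ j
      ind  : ∀ i j → E (vtx i) (vtx j) ⇔ CycConsec len i j

  OnH : Hole → V → Set
  OnH h v = ∃ λ i → Hole.vtx h i ≡ v

  nbrCount : Hole → V → ℕ
  nbrCount h x = countB (λ i → adj x (Hole.vtx h i))

  HasC4 : Set
  HasC4 = Σ Hole λ h → Hole.len h ≡ 4

  Disjoint : Path → Path → Set
  Disjoint p q = ∀ v → OnP p v → OnP q v → ⊥

  HasTheta : Set
  HasTheta = Σ V λ a → Σ V λ b → Σ Path λ P₁ → Σ Path λ P₂ → Σ Path λ P₃ →
      Good P₁ a b × Good P₂ a b × Good P₃ a b
    × Sep P₁ P₂ × Sep P₁ P₃ × Sep P₂ P₃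
    where
      Good : Path → V → V → Set
      Good p a b = (2 ≤ Path.len p) × (start p ≡ a) × (end p ≡ b)
      Sep : Path → Path → Set
      Sep p q = (∀ v → Inner p v → Inner q v → ⊥)
              × (∀ u v → Inner p u → Inner q v → ¬ E u v)

  HasPrism : Set
  HasPrism = Σ Path λ P₁ → Σ Path λ P₂ → Σ Path λ P₃ →
      (1 ≤ Path.len P₁) × (1 ≤ Path.len P₂) × (1 ≤ Path.len P₃)
    × Disjoint P₁ P₂ × Disjoint P₁ P₃ × Disjoint P₂ P₃
    × E (start P₁) (start P₂) × E (start P₁) (start P₃) × E (start P₂) (start P₃)
    × E (end P₁) (end P₂) × E (end P₁) (end P₃) × E (end P₂) (end P₃)
    × Only P₁ P₂ × Only P₁ P₃ × Only P₂ P₃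
    where
      Only : Path → Path → Set
      Only p q = ∀ u v → OnP p u → OnP q v → E u v →
        (u ≡ start p × v ≡ start q) ⊎ (u ≡ end p × v ≡ end q)

  IsWheel : Hole → V → Set
  IsWheel h x = ¬ OnH h x × (3 ≤ nbrCount h x)

  HasEvenWheel : Set
  HasEvenWheel = Σ Hole λ h → Σ V λ x → IsWheel h x × (2 ∣ nbrCount h x)

  IsTwinWheel : Hole → V → Set
  IsTwinWheel h x = IsWheel h x × (Σ (Fin (Hole.len h)) λ i → Σ (Fin (Hole.len h)) λ j → Σ (Fin (Hole.len h)) λ k →
      (i ≢ k)
    × (∀ l → E x (Hole.vtx h l) ⇔ (l ≡ i ⊎ l ≡ j ⊎ l ≡ k))
    × E (Hole.vtx h i) (Hole.vtx h j) × E (Hole.vtx h j) (Hole.vtx h k)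
    × ¬ E (Hole.vtx h i) (Hole.vtx h k))

  IsShortPyramid : Hole → V → Set
  IsShortPyramid h x = IsWheel h x × (nbrCount h x ≡ 3)
    × (Σ (Fin (Hole.len h)) λ i → Σ (Fin (Hole.len h)) λ j → Σ (Fin (Hole.len h)) λ k →
      (i ≢ j) × (i ≢ k) × (j ≢ k)
    × E x (Hole.vtx h i) × E x (Hole.vtx h j) × E x (Hole.vtx h k)
    × E (Hole.vtx h i) (Hole.vtx h j)
    × ¬ E (Hole.vtx h i) (Hole.vtx h k) × ¬ E (Hole.vtx h j) (Hole.vtx h k))

  IsProperWheel : Hole → V → Set
  IsProperWheel h x = IsWheel h x × ¬ IsTwinWheel h x × ¬ IsShortPyramid h x

  InHub : V → Set
  InHub x = Σ Hole λ h → IsProperWheel h x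

  HasClique : ℕ → Set
  HasClique t = Σ (Fin t → V) λ f → (∀ i j → f i ≡ f j → i ≡ j) × (∀ i j → i ≢ j → E (f i) (f j))

  HasGenPyramid : ℕ → Set
  HasGenPyramid k = Σ Path λ P → Σ Path λ Q → Σ (Fin k → Path) λ R →
      Σ (Fin k → ℕ) λ px → Σ (Fin k → Fin (suc (Path.len Q))) λ pz →
      Disjoint P Q × (∀ i → Disjoint (R i) P) × (∀ i → Disjoint (R i) Q)
    × (∀ i j → i ≢ j → Disjoint (R i) (R j))
    × (Σ Hole λ H → ∀ v → OnH H v ⇔ (OnP P v ⊎ OnP Q v))
      -- a_i has exactly two neighbours x_i = P[px i], y_i = P[px i + 1] in P, both in P*
    × (∀ i → 0 < px i × suc (px i) < Path.len P)
    × (∀ i (l : Fin (suc (Path.len P))) →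
         E (start (R i)) (Path.vtx P l) ⇔ (toℕ l ≡ px i ⊎ toℕ l ≡ suc (px i)))
    × (∀ i l → E (end (R i)) (Path.vtx Q l) ⇔ (l ≡ pz i))
    × (∀ i u v → Inner (R i) u → (OnP P v ⊎ OnP Q v) → ¬ E u v)
    × (∀ i j → i ≢ j → ∀ u v → OnP (R i) u → OnP (R j) v → ¬ E u v)
      -- P traverses x_1, y_1, ..., x_k, y_k in order, with y_i ≠ x_{i+1}
    × (∀ i j → toℕ i < toℕ j → suc (px i) < px j)
    × (∀ i j → toℕ i < toℕ j → toℕ (pz i) ≤ toℕ (pz j))

  InCtt : ℕ → Set
  InCtt t = ¬ HasC4 × ¬ HasTheta × ¬ HasPrism × ¬ HasEvenWheel
          × ¬ HasClique t × ¬ HasGenPyramid t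

  data Reach (X : Subset n) (u : V) : V → Set where
    here : u ∉ X → Reach X u u
    step : ∀ {v w} → Reach X u v → E v w → w ∉ X → Reach X u w

  IsMinimalSeparator : Subset n → Set
  IsMinimalSeparator X = Σ V λ u → Σ V λ v →
      u ∉ X × v ∉ X × ¬ Reach X u v
    × (∀ Y → Y ⊂ X → Reach Y u v)

  IsStable : Subset n → Set
  IsStable Y = ∀ u v → u ∈ Y → v ∈ Y → ¬ E u v

{-# OPTIONS --safe #-}
module Submission where

-- The two full components A and B of the separator both attach to all of Y. For three vertices of Y, each of them
-- contains a claw with these leaves, or a path on which one of the three has two nonadjacent neighbours, or a triangle
-- with a leg to each of them. If neither side has the triangle, there is a theta or a proper wheel centred in Y; if both
-- have it, there is a prism or such a wheel. By Ramsey's theorem one may assume that A never contains the triangle,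
-- and hence that B always does and contains neither of the other two.
-- Replace A and B by inclusion-minimal connected sets that attach to Y. If v ∈ A, then every component of A ∖ v misses
-- the neighbourhood of some y ∈ Y, so from v there is a path to this y away from that component. With these tails a
-- triangle or a hole of A would produce a forbidden configuration, so A is a tree, and similarly two neighbours of v in
-- one component of B ∖ v are adjacent, so B is the line graph of a tree. The branches from a root to the vertices of Y
-- therefore fork cleanly, and Ramsey's theorem yields one branch on each side on which many vertices of Y hang
-- independently and in monotone order: at distinct edges in B, and at single vertices in A (or else by two nonadjacent
-- neighbours, in which case the branch is rerouted through them). Together they form a generalized pyramid.

open import Defs
open import Data.Bool using (Bool; true; false; if_then_else_)
open import Data.Bool.Properties using () renaming (_≟_ to _≟ᵇ_)
open import Data.Empty using (⊥; ⊥-elim)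
open import Data.Fin using (Fin; toℕ; fromℕ; fromℕ<; inject≤) renaming (zero to fzero; suc to fsuc)
open import Data.Fin.Properties using (_≟_; toℕ-injective; toℕ-fromℕ; toℕ-fromℕ<; inject≤-injective)
open import Data.List using (List; []; _∷_; _++_; [_]; allFin; drop; initLast; length; lookup; map; reverse; take; _∷ʳ′_)
open import Data.List.Membership.Propositional.Properties using (∈-++⁻; ∈-++⁺ˡ; ∈-++⁺ʳ; ∈-∃++; ∈-allFin; ∈-lookup; ∈-map⁻)
open import Data.List.Properties using (++-assoc; ++-identityʳ; length-++; length-drop; length-map; length-reverse; length-take; reverse-++; take++drop≡id; unfold-reverse)
open import Data.List.Relation.Unary.Any using (here; there; index)
open import Data.List.Relation.Unary.Any.Properties using (lookup-index; reverse⁺; reverse⁻)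
open import Data.Nat using (ℕ; zero; suc; pred; _+_; _∸_; _≤_; _<_; z≤n; s≤s; _≤?_; _<?_) renaming (_≟_ to _≟ⁿ_)
open import Data.Nat.Properties using (suc-injective; 1+n≰n; +-assoc; +-cancelʳ-≤; +-cancelˡ-<; +-cancelˡ-≡; +-cancelˡ-≤; +-comm; +-identityʳ; +-mono-≤; +-monoʳ-≤; +-monoˡ-≤; +-suc; <-cmp; <-irrefl; <⇒≢; <⇒≤; m+1+n≢0; m+1+n≰m; m+[n∸m]≡n; m+n≤o⇒m≤o∸n; m∸n+n≡m; m≤m+n; m≤n+m; m≤n⇒m<n∨m≡n; m≤n⇒m⊓n≡m; n≤1+n; ≤-antisym; ≤-pred; ≤-refl; ≤-reflexive; ≤-trans; ≮⇒≥; ≰⇒>; ∸-monoˡ-≤)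
open import Data.Product using (Σ; ∃; _×_; _,_; proj₁; proj₂)
open import Data.Sum using (_⊎_; inj₁; inj₂; [_,_]′)
import Data.Sum as Sum
open import Data.Unit using (⊤; tt)
open import Function using (_∘_)
open import Relation.Binary.Definitions using (DecidableEquality; tri<; tri≈; tri>)
open import Relation.Binary.PropositionalEquality using (_≡_; _≢_; refl; sym; trans; cong; subst; subst₂)
open import Relation.Nullary using (¬_; Dec; yes; no; does)
open import Relation.Nullary.Decidable using (decidable-stable; _⊎-dec_)

-- A claw on one side and a triangle on the other form a pyramid, which the class allows. Hence in
-- this mixed case a single triple of Y gives no contradiction, and `t` vertices of Y have to be
-- lined up along two paths, one through each side. Two more vertices of Y serve as common ends that
-- close these paths to a hole. The order of the vertices is the delicate point: the same list must
-- be monotone along both paths. It is first fixed by the positions in A, and the path in B is then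
-- oriented to agree with it. Sides, components and minimal sets are predicates on vertices, and
-- nothing decides them. As the claim is an inequality between numbers, it suffices to refute its
-- negation, so facts about these predicates may be obtained under double negation, while paths are
-- explicit lists on which adjacency and membership are decided. The bound is a composition of
-- Ramsey numbers, nested in the reverse of the order in which the selections are made.

module Combinatorics where

  open import Data.List.Membership.Propositional using (_∈_)
  open import Data.List.Relation.Binary.Sublist.Propositional using (_⊆_; []; _∷_; _∷ʳ_; ⊆-refl; ⊆-trans; minimum)
  open import Data.List.Relation.Binary.Sublist.Propositional.Properties using (Any-resp-⊆; ++⁺ʳ)

  -- Classical reasoning under double negation

  _>>=_ : ∀ {a b} {X : Set a} {Y : Set b} → ¬ ¬ X → (X → ¬ ¬ Y) → ¬ ¬ Y
  (m >>= f) k = m (λ x → f x k)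

  return : ∀ {a} {X : Set a} → X → ¬ ¬ X
  return x k = k x

  em : ∀ {a} (P : Set a) → ¬ ¬ Dec P
  em P k = k (no (k ∘ yes))

  -- Finiteness lets the double negation pass the quantifier, so that a property can be decided for
  -- all vertices at once.
  ¬¬-Fin : ∀ {n} {P : Fin n → Set} → (∀ i → ¬ ¬ P i) → ¬ ¬ (∀ i → P i)
  ¬¬-Fin {zero}  f = return (λ ())
  ¬¬-Fin {suc n} {P} f = do
    p ← f fzero
    q ← ¬¬-Fin (f ∘ fsuc)
    return λ { fzero → p ; (fsuc i) → q i }

  -- Ramsey's theorem for relations of any arity on lists

  Rel : Set → ℕ → Set₁
  Rel X zero    = Set
  Rel X (suc k) = X → Rel X k

  -- Tuples are taken in list order only, so `R` may be asymmetric; in particular sortedness of a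
  -- list is an instance.
  Hom : ∀ k {X : Set} → Rel X k → List X → Set
  Hom zero    R xs       = R
  Hom (suc k) R []       = ⊤
  Hom (suc k) R (x ∷ xs) = Hom k (R x) xs × Hom (suc k) R xs

  DecRel : ∀ k {X : Set} → Rel X k → Set
  DecRel zero    R = Dec R
  DecRel (suc k) R = ∀ x → DecRel k (R x)

  Not : ∀ k {X : Set} → Rel X k → Rel X k
  Not zero    R = ¬ R
  Not (suc k) R = λ x → Not k (R x)

  Sub : ∀ k {X : Set} → Rel X k → ℕ → List X → Set
  Sub k R a xs = ∃ λ ys → ys ⊆ xs × a ≤ length ys × Hom k R ys

  hom-⊆ : ∀ k {X : Set} (R : Rel X k) {xs ys} → ys ⊆ xs → Hom k R xs → Hom k R ys
  hom-⊆ zero    R p h = h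
  hom-⊆ (suc k) R []         h       = tt
  hom-⊆ (suc k) R (y ∷ʳ p)   (_ , h) = hom-⊆ (suc k) R p h
  hom-⊆ (suc k) R (refl ∷ p) (g , h) = hom-⊆ k (R _) p g , hom-⊆ (suc k) R p h

  abstract
    -- In arity zero the whole list has one colour, and `a + b` covers either demand. The rest is
    -- the classical recursion for hypergraphs. Being abstract, the nested bounds are never
    -- unfolded.
    ram : ℕ → ℕ → ℕ → ℕ
    ram zero    a       b       = a + b
    ram (suc k) zero    b       = 0
    ram (suc k) (suc a) zero    = 0
    ram (suc k) (suc a) (suc b) = suc (ram k (ram (suc k) a (suc b)) (ram (suc k) (suc a) b))

  hom-prefix : ∀ k {X : Set} {R : Rel X k} (xs : List X) {ys} → Hom k R (xs ++ ys) → Hom k R xs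
  hom-prefix k {R = R} xs {ys} = hom-⊆ k R (++⁺ʳ ys ⊆-refl)

  Ramsey : ℕ → Set₁
  Ramsey k = ∀ {X : Set} (R : Rel X k) → DecRel k R → ∀ a b xs → ram k a b ≤ length xs →
             Sub k R a xs ⊎ Sub k (Not k R) b xs

  abstract
    -- The first element `x` turns `R` into the relation `R x` of smaller arity. On a list
    -- homogeneous for `R x`, a recursive call either succeeds outright or yields a list that `x`
    -- prolongs in the colour of `R x`.
    ramsey-suc : ∀ k → Ramsey k → Ramsey (suc k)
    ramsey-suc k ih R d zero    b       xs       l = inj₁ ([] , minimum xs , z≤n , tt)
    ramsey-suc k ih R d (suc a) zero    xs       l = inj₂ ([] , minimum xs , z≤n , tt)
    ramsey-suc k ih R d (suc a) (suc b) (x ∷ xs) (s≤s l)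
      with ih (R x) (d x) (ram (suc k) a (suc b)) (ram (suc k) (suc a) b) xs l
    ... | inj₁ (ys , p , m , h) with ramsey-suc k ih R d a (suc b) ys m
    ...   | inj₁ (zs , q , n , g) = inj₁ (x ∷ zs , refl ∷ ⊆-trans q p , s≤s n , hom-⊆ k (R x) q h , g)
    ...   | inj₂ (zs , q , n , g) = inj₂ (zs , x ∷ʳ ⊆-trans q p , n , g)
    ramsey-suc k ih R d (suc a) (suc b) (x ∷ xs) (s≤s l)
        | inj₂ (ys , p , m , h) with ramsey-suc k ih R d (suc a) b ys m
    ...   | inj₁ (zs , q , n , g) = inj₁ (zs , x ∷ʳ ⊆-trans q p , n , g)
    ...   | inj₂ (zs , q , n , g) =
      inj₂ (x ∷ zs , refl ∷ ⊆-trans q p , s≤s n , hom-⊆ k (Not k (R x)) q h , g)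

    ramsey : ∀ k → Ramsey k
    ramsey zero R (yes r) a b xs l = inj₁ (xs , ⊆-refl , ≤-trans (m≤m+n a b) l , r)
    ramsey zero R (no r)  a b xs l = inj₂ (xs , ⊆-refl , ≤-trans (m≤n+m b a) l , r)
    ramsey (suc k) = ramsey-suc k (ramsey k)

  module _ {X : Set} where

    hom₁ : {R : Rel X 1} {xs : List X} → Hom 1 R xs → ∀ {x} → x ∈ xs → R x
    hom₁ (r , _) (here refl) = r
    hom₁ (_ , h) (there i)   = hom₁ h i

    hom₂ : {R : Rel X 2} {xs : List X} → Hom 2 R xs → (∀ {x y} → R x y → R y x) →
           ∀ {x y} → x ∈ xs → y ∈ xs → x ≢ y → R x y
    hom₂ (g , h) s (here refl) (here refl) ne = ⊥-elim (ne refl)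
    hom₂ (g , h) s (here refl) (there j)   ne = hom₁ g j
    hom₂ (g , h) s (there i)   (here refl) ne = s (hom₁ g i)
    hom₂ (g , h) s (there i)   (there j)   ne = hom₂ h s i j ne

    hom₃ : {R : Rel X 3} {xs : List X} → Hom 3 R xs →
           (∀ {x y z} → R x y z → R y x z) → (∀ {x y z} → R x y z → R x z y) →
           ∀ {x y z} → x ∈ xs → y ∈ xs → z ∈ xs → x ≢ y → x ≢ z → y ≢ z → R x y z
    hom₃ (g , h) s t (here refl) (here refl) _           a b c = ⊥-elim (a refl)
    hom₃ (g , h) s t (here refl) (there j)   (here refl) a b c = ⊥-elim (b refl)
    hom₃ (g , h) s t (here refl) (there j)   (there k)   a b c = hom₂ g t j k c
    hom₃ (g , h) s t (there i)   (here refl) (here refl) a b c = ⊥-elim (c refl)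
    hom₃ (g , h) s t (there i)   (here refl) (there k)   a b c = s (hom₂ g t i k b)
    hom₃ (g , h) s t (there i)   (there j)   (here refl) a b c = t (s (hom₂ g t i j a))
    hom₃ (g , h) s t (there i)   (there j)   (there k)   a b c = hom₃ h s t i j k a b c

    hom-∷ʳ₁ : {R : Rel X 1} (xs : List X) {w : X} → Hom 1 R xs → R w → Hom 1 R (xs ++ [ w ])
    hom-∷ʳ₁ []       h       r = r , tt
    hom-∷ʳ₁ (x ∷ xs) (g , h) r = g , hom-∷ʳ₁ xs h r

    hom-∷ʳ₂ : {R : Rel X 2} (xs : List X) {w : X} → Hom 2 R xs → Hom 1 (λ x → R x w) xs →
              Hom 2 R (xs ++ [ w ])
    hom-∷ʳ₂ []       h       r       = tt , tt
    hom-∷ʳ₂ (x ∷ xs) (g , h) (r , s) = hom-∷ʳ₁ xs g r , hom-∷ʳ₂ xs h s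

    hom-reverse : {R : Rel X 2} (xs : List X) → Hom 2 R xs → Hom 2 (λ x y → R y x) (reverse xs)
    hom-reverse []       h = tt
    hom-reverse {R} (x ∷ xs) (g , h) rewrite unfold-reverse x xs =
      hom-∷ʳ₂ (reverse xs) (hom-reverse xs h) (rev₁ xs g)
      where
      rev₁ : {S : Rel X 1} (ys : List X) → Hom 1 S ys → Hom 1 S (reverse ys)
      rev₁ []       h       = tt
      rev₁ (y ∷ ys) (r , h) rewrite unfold-reverse y ys = hom-∷ʳ₁ (reverse ys) (rev₁ ys h) r

    hom-last₁ : {R : Rel X 1} (xs : List X) {w : X} → Hom 1 R (xs ++ [ w ]) → R w
    hom-last₁ []       (r , _) = r
    hom-last₁ (x ∷ xs) (_ , h) = hom-last₁ xs h

    hom-last₂ : {R : Rel X 2} (xs : List X) {w : X} → Hom 2 R (xs ++ [ w ]) → Hom 1 (λ x → R x w) xs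
    hom-last₂ []       h       = tt
    hom-last₂ (x ∷ xs) (g , h) = hom-last₁ xs g , hom-last₂ xs h

    hom-last₃ : {R : Rel X 3} (xs : List X) {w : X} → Hom 3 R (xs ++ [ w ]) → Hom 2 (λ x y → R x y w) xs
    hom-last₃ []       h       = tt
    hom-last₃ (x ∷ xs) (g , h) = hom-last₂ xs g , hom-last₃ xs h

    hom-map₁ : {R S : Rel X 1} → (∀ x → R x → S x) → ∀ xs → Hom 1 R xs → Hom 1 S xs
    hom-map₁ f []       h       = tt
    hom-map₁ f (x ∷ xs) (r , h) = f x r , hom-map₁ f xs h

    hom-map₂ : {R S : Rel X 2} → (∀ x y → R x y → S x y) → ∀ xs → Hom 2 R xs → Hom 2 S xs
    hom-map₂ f []       h       = tt
    hom-map₂ f (x ∷ xs) (r , h) = hom-map₁ (f x) xs r , hom-map₂ f xs h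

    hom-zip₁ : {R S : Rel X 1} → ∀ xs → Hom 1 R xs → Hom 1 S xs → Hom 1 (λ x → R x × S x) xs
    hom-zip₁ []       h       g       = tt
    hom-zip₁ (x ∷ xs) (r , h) (s , g) = (r , s) , hom-zip₁ xs h g

    hom-zip₂ : {R S : Rel X 2} → ∀ xs → Hom 2 R xs → Hom 2 S xs → Hom 2 (λ x y → R x y × S x y) xs
    hom-zip₂ []       h       g       = tt
    hom-zip₂ (x ∷ xs) (r , h) (s , g) = hom-zip₁ xs r s , hom-zip₂ xs h g

  -- Two binary colourings deal with `touch` in either direction, and a ternary one with the order
  -- of the forks. Each asks for one element more than `k` because a pivot is taken out.
  extractSize : ℕ → ℕ
  extractSize k = ram 2 (suc k) (ram 2 (suc k) (ram 3 (suc k) (suc k)))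

  -- Selections from a list and extraction of combs

  module _ {X : Set} where

    record Select (xs : List X) (k : ℕ) : Set where
      constructor select
      field
        {ys} : List X
        size : k ≤ length ys
        sub  : ys ⊆ xs

      from : ∀ {y} → y ∈ ys → y ∈ xs
      from = Any-resp-⊆ sub

      keep : ∀ j {R : Rel X j} → Hom j R xs → Hom j R ys
      keep j {R} = hom-⊆ j R sub

    select-trans : ∀ {xs k l} (s : Select xs k) → Select (Select.ys s) l → Select xs l
    select-trans s (select l p) = select l (⊆-trans p (Select.sub s))

    selectRam : ∀ k (R : Rel X k) → DecRel k R → ∀ a b xs → ram k a b ≤ length xs →
                (Σ (Select xs a) λ s → Hom k R (Select.ys s)) ⊎ (Σ (Select xs b) λ s → Hom k (Not k R) (Select.ys s))
    selectRam k R d a b xs l with ramsey k R d a b xs l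
    ... | inj₁ (ys , p , m , h) = inj₁ (select m p , h)
    ... | inj₂ (ys , p , m , h) = inj₂ (select m p , h)

    record Pivot (xs : List X) (k : ℕ) : Set where
      constructor pivot
      field
        {w} : X
        w∈  : w ∈ xs
        sel : Select xs k
      open Select sel public
      field
        w≢  : ∀ {y} → y ∈ ys → y ≢ w

    module _ {xs : List X} (u : Hom 2 _≢_ xs) {a : ℕ} where

      pivot-first : (s : Select xs (suc a)) → Σ (Pivot xs a) λ p → Select.ys s ≡ Pivot.w p ∷ Pivot.ys p
      pivot-first s@(select {w ∷ ys} (s≤s l) p) =
        pivot (Select.from s (here refl)) (select l (⊆-trans (w ∷ʳ ⊆-refl) p))
          (λ i e → hom₁ (proj₁ (Select.keep s 2 {_≢_} u)) i (sym e)) , refl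

      pivot-last : (s : Select xs (suc a)) → Σ (Pivot xs a) λ p → Select.ys s ≡ Pivot.ys p ++ [ Pivot.w p ]
      pivot-last s@(select {ys} l p) with initLast ys
      ... | ys′ ∷ʳ′ w =
        pivot (Select.from s (∈-++⁺ʳ ys′ (here refl)))
          (select (≤-pred (subst (_ ≤_) (trans (length-++ ys′) (+-comm (length ys′) 1)) l)) (⊆-trans (++⁺ʳ [ w ] ⊆-refl) p))
          (hom₁ (hom-last₂ ys′ (Select.keep s 2 {_≢_} u))) , refl

    module Extraction (touch : Rel X 2) (touch? : DecRel 2 touch) (c : X → X → ℕ) (c-sym : ∀ x y → c x y ≡ c y x)
             (c-ultra : ∀ {x y z k} → k ≤ c x y → k ≤ c y z → k ≤ c x z) where

      record Direct (xs : List X) (k : ℕ) : Set where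
        field
          piv  : Pivot xs k
        open Pivot piv public
        field
          hits : ∀ {y} → y ∈ ys → touch y w

      -- By `below`, two branches have parted from each other by the time either of them leaves the
      -- branch of the pivot; what remains of them beyond it therefore lies past their own fork.
      record Comb (xs : List X) (k : ℕ) : Set where
        field
          piv    : Pivot xs k
        open Pivot piv public
        field
          misses : ∀ {y z} → y ∈ w ∷ ys → z ∈ w ∷ ys → y ≢ z → ¬ touch y z
          below  : ∀ {y z} → y ∈ ys → z ∈ ys → y ≢ z → c y z ≤ c y w × c y z ≤ c z w

      below-sym : ∀ {w y z} → c y z ≤ c y w × c y z ≤ c z w → c z y ≤ c z w × c z y ≤ c y w
      below-sym {w} {y} {z} (p , q) = subst (_≤ c z w) (c-sym y z) q , subst (_≤ c y w) (c-sym y z) p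

      -- Were `c y z` larger than `c w z`, then both `c w y` and `c y z` would exceed `c w z`,
      -- against the ultrametric inequality.
      late : ∀ w y z → c w z < c w y → c y z ≤ c y w × c y z ≤ c z w
      late w y z l = ≤-trans bound (≤-trans (<⇒≤ l) (≤-reflexive (c-sym w y))) , ≤-trans bound (≤-reflexive (c-sym w z))
        where
        bound : c y z ≤ c w z
        bound with c y z ≤? c w z
        ... | yes p = p
        ... | no p  = ⊥-elim (1+n≰n (c-ultra l (≰⇒> p)))

      early : ∀ w y z → ¬ c y w < c y z → c y z ≤ c y w × c y z ≤ c z w
      early w y z n = ≮⇒≥ n , c-ultra (≤-reflexive (c-sym y z)) (≮⇒≥ n)

      -- With c measuring where branches part: if c w z < c w y for every triple w, y, z of the list in this order, then all
      -- later branches part from the first one separately; if this never happens, the same holds for the last one.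
      extract : ∀ k xs → Hom 2 _≢_ xs → extractSize k ≤ length xs → Direct xs k ⊎ Comb xs k
      extract k xs u l with selectRam 2 touch touch? (suc k) (ram 2 (suc k) (ram 3 (suc k) (suc k))) xs l
      ... | inj₁ (s , h) with pivot-last u s
      ...   | p , refl = inj₁ (record { piv = p ; hits = hom₁ (hom-last₂ (Pivot.ys p) h) })
      extract k xs u l | inj₂ (s , n)
        with selectRam 2 (λ x y → touch y x) (λ x y → touch? y x) (suc k) (ram 3 (suc k) (suc k)) (Select.ys s) (Select.size s)
      ... | inj₁ (s′ , h) with pivot-first u (select-trans s s′)
      ...   | p , refl = inj₁ (record { piv = p ; hits = hom₁ (proj₁ h) })
      extract k xs u l | inj₂ (s , n) | inj₂ (s′ , n′)
        with selectRam 3 (λ x y z → c x z < c x y) (λ x y z → c x z <? c x y) (suc k) (suc k) (Select.ys s′) (Select.size s′)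
      ... | inj₁ (s″ , h) with pivot-first u (select-trans s (select-trans s′ s″))
      ...   | p , refl = inj₂ (record
                { piv = p
                ; misses = λ i j ne → proj₁ (hom₂ (Select.keep s″ 2 miss) (λ (a , b) → b , a) i j ne)
                ; below = hom₂ (hom-map₂ (late (Pivot.w p)) (Pivot.ys p) (proj₁ h)) below-sym })
        where miss = hom-zip₂ (Select.ys s′) (Select.keep s′ 2 {Not 2 touch} n) n′
      extract k xs u l | inj₂ (s , n) | inj₂ (s′ , n′) | inj₂ (s″ , h) with pivot-last u (select-trans s (select-trans s′ s″))
      ...   | p , refl = inj₂ (record
                { piv = p
                ; misses = λ i j ne → proj₁ (hom₂ (Select.keep s″ 2 miss) (λ (a , b) → b , a) (swap i) (swap j) ne)
                ; below = hom₂ (hom-map₂ (early (Pivot.w p)) (Pivot.ys p) (hom-last₃ (Pivot.ys p) h)) below-sym })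
        where
        miss = hom-zip₂ (Select.ys s′) (Select.keep s′ 2 {Not 2 touch} n) n′
        swap : ∀ {y} → y ∈ Pivot.w p ∷ Pivot.ys p → y ∈ Pivot.ys p ++ [ Pivot.w p ]
        swap (here refl) = ∈-++⁺ʳ (Pivot.ys p) (here refl)
        swap (there i)   = ∈-++⁺ˡ i

  -- The `suc` provides a vertex from which a root is found, and `ram 1 2` discards the root. The
  -- sum serves both outcomes of `extract`: `k` direct hits suffice, whereas a comb is thinned by
  -- `ram 2 t k`, since `t` teeth leaving the pivot at one vertex would form a clique.
  sizeB : ℕ → ℕ → ℕ
  sizeB t k = suc (ram 1 2 (extractSize (k + ram 2 t k)))

  -- As in `sizeB`, but here a comb can be used whole, whereas direct hits are divided by
  -- `ram 1 k k` into those with a single neighbour on the branch of the pivot and those with two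
  -- nonadjacent ones.
  sizeA : ℕ → ℕ
  sizeA k = suc (ram 1 2 (extractSize (k + ram 1 k k)))

  -- The target is `t` vertices together with the two ends of the pyramid's path P. The number 3 is
  -- where distinct positions can no longer be pairwise within distance one.
  sortSize : ℕ → ℕ
  sortSize t = ram 2 (suc (suc t)) (ram 2 (suc (suc t)) 3)

  -- The first summand is for single feet in A, the second for intervals, of which five in order
  -- always contain two separated ones.
  monoSize : ℕ → ℕ
  monoSize t = sortSize t + ram 2 (sortSize t) 5

  coreSize : ℕ → ℕ
  coreSize t = sizeB t (sizeA (ram 2 (monoSize t) (monoSize t)))

  threshold : ℕ → ℕ
  threshold t = ram 3 (coreSize t) (coreSize t)

-- Common prefixes and forks of lists

module Prefix (X : Set) (_≟ₓ_ : DecidableEquality X) where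

  open import Data.List.Membership.Propositional using (_∈_)

  -- The length of the longest common prefix.
  cpl : List X → List X → ℕ
  cpl []      m       = 0
  cpl (x ∷ l) []      = 0
  cpl (x ∷ l) (y ∷ m) with x ≟ₓ y
  ... | yes _ = suc (cpl l m)
  ... | no _  = 0

  cpl-sym : ∀ l m → cpl l m ≡ cpl m l
  cpl-sym []      []      = refl
  cpl-sym []      (_ ∷ _) = refl
  cpl-sym (_ ∷ _) []      = refl
  cpl-sym (x ∷ l) (y ∷ m) with x ≟ₓ y | y ≟ₓ x
  ... | yes _ | yes _ = cong suc (cpl-sym l m)
  ... | no _  | no _  = refl
  ... | yes e | no n  = ⊥-elim (n (sym e))
  ... | no n  | yes e = ⊥-elim (n (sym e))

  cpl-ultra : ∀ l m o {k} → k ≤ cpl l m → k ≤ cpl m o → k ≤ cpl l o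
  cpl-ultra l       m       o       {zero}  p q = z≤n
  cpl-ultra (x ∷ l) (y ∷ m) (z ∷ o) {suc k} p q with x ≟ₓ y | y ≟ₓ z | x ≟ₓ z
  cpl-ultra (x ∷ l) (y ∷ m) (z ∷ o) {suc k} (s≤s p) (s≤s q) | yes _ | yes _ | yes _ = s≤s (cpl-ultra l m o p q)
  ... | yes refl | yes refl | no n  = ⊥-elim (n refl)

  Differ : List X → List X → Set
  Differ (x ∷ _) (y ∷ _) = x ≢ y
  Differ _       _       = ⊤

  -- The fork vertex `v` is the last common entry and is counted by `depth`; `Differ` demands
  -- nothing if one of the lists stops at `v`.
  record Fork (l m : List X) : Set where
    field
      pre    : List X
      v      : X
      s t    : List X
      eqˡ    : l ≡ pre ++ v ∷ s
      eqʳ    : m ≡ pre ++ v ∷ t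
      depth  : cpl l m ≡ suc (length pre)
      differ : Differ s t

  cpl-same : ∀ x l m → cpl (x ∷ l) (x ∷ m) ≡ suc (cpl l m)
  cpl-same x l m with x ≟ₓ x
  ... | yes _ = refl
  ... | no n  = ⊥-elim (n refl)

  cpl-diff : ∀ {x y} l m → x ≢ y → cpl (x ∷ l) (y ∷ m) ≡ 0
  cpl-diff {x} {y} l m n with x ≟ₓ y
  ... | yes e = ⊥-elim (n e)
  ... | no _  = refl

  fork : ∀ x l m → Fork (x ∷ l) (x ∷ m)
  fork x []      m       = record { pre = [] ; eqˡ = refl ; eqʳ = refl ; depth = cpl-same x [] m ; differ = tt }
  fork x (y ∷ l) []      = record { pre = [] ; eqˡ = refl ; eqʳ = refl ; depth = cpl-same x (y ∷ l) [] ; differ = tt }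
  fork x (y ∷ l) (z ∷ m) with y ≟ₓ z
  ... | no n     = record { pre = [] ; eqˡ = refl ; eqʳ = refl ; differ = n
                          ; depth = trans (cpl-same x (y ∷ l) (z ∷ m)) (cong suc (cpl-diff l m n)) }
  ... | yes refl = record { pre = x ∷ F.pre ; eqˡ = cong (x ∷_) F.eqˡ ; eqʳ = cong (x ∷_) F.eqʳ ; differ = F.differ
                          ; depth = trans (cpl-same x (y ∷ l) (y ∷ m)) (cong suc F.depth) }
    where module F = Fork (fork y l m)

  drop-length : ∀ (pre : List X) {v s} → drop (suc (length pre)) (pre ++ v ∷ s) ≡ s
  drop-length []        = refl
  drop-length (x ∷ pre) = drop-length pre

  drop-⊂ : ∀ {a b} (l : List X) {x} → a ≤ b → x ∈ drop b l → x ∈ drop a l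
  drop-⊂ {b = zero}      l       z≤n     i = i
  drop-⊂ {zero}  {suc b} (y ∷ l) z≤n     i = there (drop-⊂ {0} {b} l z≤n i)
  drop-⊂ {suc a} {suc b} (y ∷ l) (s≤s p) i = drop-⊂ l p i

-- Induced paths as lists of vertices

module InducedPaths (G : Graph) where

  open import Data.List.Membership.Propositional using (_∈_)
  open import Data.List.Membership.DecPropositional {A = Fin (Graph.n G)} _≟_ using (_∈?_) public
  open Graph G using (n; adj) renaming (sym to adj-sym; irrefl to adj-irrefl)

  Vtx : Set
  Vtx = Fin n

  infix 4 _~_ _~?_ _⟂_ _⟂*_ _⟂⟂_ _⊂_

  _~_ : Vtx → Vtx → Set
  u ~ v = adj u v ≡ true

  _~?_ : ∀ u v → Dec (u ~ v)
  u ~? v = adj u v ≟ᵇ true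

  _⟂_ : Vtx → Vtx → Set
  u ⟂ v = u ≢ v × ¬ u ~ v

  _⟂*_ : Vtx → List Vtx → Set
  u ⟂* l = ∀ {v} → v ∈ l → u ⟂ v

  _⟂⟂_ : List Vtx → List Vtx → Set
  l ⟂⟂ m = ∀ {u v} → u ∈ l → v ∈ m → u ⟂ v

  _⊂_ : List Vtx → (Vtx → Set) → Set
  l ⊂ P = ∀ {v} → v ∈ l → P v

  ~-sym : ∀ {u v} → u ~ v → v ~ u
  ~-sym {u} {v} e = trans (adj-sym v u) e

  ~-irrefl : ∀ {u} → ¬ u ~ u
  ~-irrefl {u} e with trans (sym e) (adj-irrefl u)
  ... | ()

  ~⇒≢ : ∀ {u v} → u ~ v → u ≢ v
  ~⇒≢ e refl = ~-irrefl e

  ⟂-sym : ∀ {u v} → u ⟂ v → v ⟂ u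
  ⟂-sym (d , e) = (λ q → d (sym q)) , (λ q → e (~-sym q))

  ⟂⇒ : ∀ {u v} {P : Set} → u ⟂ v → u ≢ v × (u ~ v → P)
  ⟂⇒ (d , e) = d , λ f → ⊥-elim (e f)

  ⟂⟂-sym : ∀ {l m} → l ⟂⟂ m → m ⟂⟂ l
  ⟂⟂-sym p i j = ⟂-sym (p j i)

  ⟂⟂-++ˡ : ∀ l {l′ m} → l ⟂⟂ m → l′ ⟂⟂ m → l ++ l′ ⟂⟂ m
  ⟂⟂-++ˡ l p q i j = [ (λ i → p i j) , (λ i → q i j) ]′ (∈-++⁻ l i)

  ⟂⟂-++ʳ : ∀ {l} m {m′} → l ⟂⟂ m → l ⟂⟂ m′ → l ⟂⟂ m ++ m′
  ⟂⟂-++ʳ m p q i j = [ p i , q i ]′ (∈-++⁻ m j)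

  ⟂⟂-∷ˡ : ∀ {u l m} → u ⟂* m → l ⟂⟂ m → u ∷ l ⟂⟂ m
  ⟂⟂-∷ˡ p q (here refl) j = p j
  ⟂⟂-∷ˡ p q (there i)   j = q i j

  ⟂⟂-∷ʳ : ∀ {u l m} → u ⟂* l → l ⟂⟂ m → l ⟂⟂ u ∷ m
  ⟂⟂-∷ʳ p q i (here refl) = ⟂-sym (p i)
  ⟂⟂-∷ʳ p q i (there j)   = q i j

  ⟂⟂-revˡ : ∀ {l m} → l ⟂⟂ m → reverse l ⟂⟂ m
  ⟂⟂-revˡ p i j = p (reverse⁻ i) j

  ⟂⟂-revʳ : ∀ {l m} → l ⟂⟂ m → l ⟂⟂ reverse m
  ⟂⟂-revʳ p i j = p i (reverse⁻ j)

  ⟂*-++ : ∀ {u} l {m} → u ⟂* l → u ⟂* m → u ⟂* l ++ m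
  ⟂*-++ l p q i = [ p , q ]′ (∈-++⁻ l i)

  ⟂*-∷ : ∀ {u v m} → u ⟂ v → u ⟂* m → u ⟂* v ∷ m
  ⟂*-∷ p q (here refl) = p
  ⟂*-∷ p q (there i)   = q i

  ⊂-++ : ∀ {P} l {m} → l ⊂ P → m ⊂ P → l ++ m ⊂ P
  ⊂-++ l p q i = [ p , q ]′ (∈-++⁻ l i)

  ⊂-∷ : ∀ {P u m} → P u → m ⊂ P → u ∷ m ⊂ P
  ⊂-∷ p q (here refl) = p
  ⊂-∷ p q (there i)   = q i

  Link : Vtx → List Vtx → Set
  Link u []      = ⊤
  Link u (v ∷ l) = u ~ v × u ⟂* l

  Ind : List Vtx → Set
  Ind []      = ⊤
  Ind (u ∷ l) = Link u l × Ind l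

  ind-++ʳ : ∀ l {m} → Ind (l ++ m) → Ind m
  ind-++ʳ []      p       = p
  ind-++ʳ (u ∷ l) (_ , p) = ind-++ʳ l p

  ind-++ˡ : ∀ l {m} → Ind (l ++ m) → Ind l
  ind-++ˡ []          p             = tt
  ind-++ˡ (u ∷ [])    p             = tt , tt
  ind-++ˡ (u ∷ v ∷ l) ((e , a) , p) = (e , a ∘ ∈-++⁺ˡ) , ind-++ˡ (v ∷ l) p

  glue : ∀ l {y r} → Ind (l ++ [ y ]) → Ind (y ∷ r) → l ⟂⟂ r → Ind (l ++ y ∷ r)
  glue []          p             q a = q
  glue (u ∷ [])    ((e , _) , p) q a = (e , a (here refl)) , q
  glue (u ∷ v ∷ l) ((e , b) , p) q a =
    (e , (λ i → [ (λ j → b (∈-++⁺ˡ j)) , (λ { (here refl) → b (∈-++⁺ʳ l (here refl)) ; (there j) → a (here refl) j }) ]′ (∈-++⁻ l i)))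
    , glue (v ∷ l) p q (λ i → a (there i))

  bridge : ∀ l {x y r} → Ind (l ++ [ x ]) → Ind (y ∷ r) → x ~ y → x ⟂* r → l ⟂⟂ y ∷ r → Ind (l ++ x ∷ y ∷ r)
  bridge l p q e a b = glue l p ((e , a) , q) b

  ind-reverse : ∀ l → Ind l → Ind (reverse l)
  ind-reverse []          p             = tt
  ind-reverse (u ∷ [])    p             = tt , tt
  ind-reverse (u ∷ v ∷ l) ((e , a) , p) =
    subst Ind eq (glue (reverse l) (subst Ind (unfold-reverse v l) (ind-reverse (v ∷ l) p)) ((~-sym e , λ ()) , tt , tt)
      λ { i (here refl) → ⟂-sym (a (reverse⁻ i)) })
    where
    eq : reverse l ++ v ∷ [ u ] ≡ reverse (u ∷ v ∷ l)
    eq rewrite unfold-reverse u (v ∷ l) | unfold-reverse v l = sym (++-assoc (reverse l) [ v ] [ u ])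

  reverse-mid : ∀ (l : List Vtx) x m → reverse (l ++ x ∷ m) ≡ reverse m ++ x ∷ reverse l
  reverse-mid l x m rewrite reverse-++ l (x ∷ m) | unfold-reverse x m = ++-assoc (reverse m) [ x ] (reverse l)

  reverse-ends : ∀ (x : Vtx) m y → reverse (x ∷ m ++ [ y ]) ≡ y ∷ reverse m ++ [ x ]
  reverse-ends x m y rewrite unfold-reverse x (m ++ [ y ]) | reverse-mid m y [] = refl

  ind-flip : ∀ {x} m {y} → Ind (x ∷ m ++ [ y ]) → Ind (y ∷ reverse m ++ [ x ])
  ind-flip {x} m {y} p = subst Ind (reverse-ends x m y) (ind-reverse _ p)

  ind-≢ : ∀ {x l} → Ind (x ∷ l) → ∀ {z} → z ∈ l → x ≢ z
  ind-≢ ((e , a) , p) (here refl) = ~⇒≢ e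
  ind-≢ ((e , a) , p) (there i)   = proj₁ (a i)

  ind-≢ʳ : ∀ l {y} → Ind (l ++ [ y ]) → ∀ {z} → z ∈ l → z ≢ y
  ind-≢ʳ (x ∷ l) (e , p) (here refl) refl = ind-≢ {_} {l ++ _} (e , p) (∈-++⁺ʳ l (here refl)) refl
  ind-≢ʳ (x ∷ l) (e , p) (there i)        = ind-≢ʳ l p i

  ind-apart : ∀ l {x m} → Ind (l ++ x ∷ m) → l ⟂⟂ m
  ind-apart (u ∷ [])    ((e , a) , p) (here refl) j = a j
  ind-apart (u ∷ v ∷ l) ((e , a) , p) (here refl) j = a (∈-++⁺ʳ l (there j))
  ind-apart (u ∷ l)     (_ , p)       (there i)   j = ind-apart l p i j

  ind-tail-⟂ : ∀ {x y m} → Ind (x ∷ y ∷ m) → x ⟂* m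
  ind-tail-⟂ ((_ , a) , _) = a

  record Cut (P : Vtx → Set) (l : List Vtx) : Set where
    constructor cut
    field
      {pre}  : List Vtx
      {at}   : Vtx
      {post} : List Vtx
      eq     : l ≡ pre ++ at ∷ post
      holds  : P at

  first : ∀ {P : Vtx → Set} → (∀ v → Dec (P v)) → ∀ l →
          l ⊂ (λ v → ¬ P v) ⊎ Σ (Cut P l) λ c → Cut.pre c ⊂ (λ v → ¬ P v)
  first P? [] = inj₁ λ ()
  first P? (x ∷ l) with P? x | first P? l
  ... | yes p | _                     = inj₂ (cut {pre = []} refl p , λ ())
  ... | no p  | inj₁ q                = inj₁ (⊂-∷ p q)
  ... | no p  | inj₂ (cut refl h , q) = inj₂ (cut {pre = x ∷ _} refl h , ⊂-∷ p q)

  last : ∀ {P : Vtx → Set} → (∀ v → Dec (P v)) → ∀ l →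
         l ⊂ (λ v → ¬ P v) ⊎ Σ (Cut P l) λ c → Cut.post c ⊂ (λ v → ¬ P v)
  last P? [] = inj₁ λ ()
  last P? (x ∷ l) with last P? l
  ... | inj₂ (cut refl h , q) = inj₂ (cut {pre = x ∷ _} refl h , q)
  ... | inj₁ q with P? x
  ...   | yes p = inj₂ (cut {pre = []} refl p , q)
  ...   | no p  = inj₁ (⊂-∷ p q)

  data Walk (P : Vtx → Set) (u : Vtx) : Vtx → Set where
    here : P u → Walk P u u
    step : ∀ {w v} → P u → u ~ w → Walk P w v → Walk P u v

  walk-map : ∀ {P Q : Vtx → Set} → (∀ {v} → P v → Q v) → ∀ {u v} → Walk P u v → Walk Q u v
  walk-map f (here p)     = here (f p)
  walk-map f (step p e w) = step (f p) e (walk-map f w)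

  walk-++ : ∀ {P u v w} → Walk P u v → Walk P v w → Walk P u w
  walk-++ (here p)     s = s
  walk-++ (step p e r) s = step p e (walk-++ r s)

  walk-src : ∀ {P u v} → Walk P u v → P u
  walk-src (here p)     = p
  walk-src (step p _ _) = p

  walk-snoc : ∀ {P u v w} → Walk P u v → v ~ w → P w → Walk P u w
  walk-snoc (here p)     e q = step p e (here q)
  walk-snoc (step p f r) e q = step p f (walk-snoc r e q)

  walk-tgt : ∀ {P u v} → Walk P u v → P v
  walk-tgt (here p)     = p
  walk-tgt (step _ _ r) = walk-tgt r

  walk-sym : ∀ {P u v} → Walk P u v → Walk P v u
  walk-sym (here p)     = here p
  walk-sym (step p e r) = walk-snoc (walk-sym r) (~-sym e) p

  -- Entries are dropped from the front as long as `y` has a neighbour further along. So `y` is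
  -- finally joined to its last neighbour, which makes the result induced.
  trim : ∀ y l {v} → Ind (l ++ [ v ]) → y ≢ v → (∀ {z} → z ∈ l → y ≢ z) →
         (∃ λ z → z ∈ l ++ [ v ] × y ~ z) →
         ∃ λ m → Ind (y ∷ m ++ [ v ]) × (∀ {z} → z ∈ m → z ∈ l)
  trim y []      p ne ns (z , here refl , e) = [] , ((e , λ ()) , p) , λ ()
  trim y (x ∷ l) {v} p ne ns (z , i , e) with first (y ~?_) (l ++ [ v ])
  ... | inj₂ (cut {at = z′} q h , _) =
        let m , r , f = trim y l (proj₂ p) ne (ns ∘ there) (z′ , subst (z′ ∈_) (sym q) (∈-++⁺ʳ _ (here refl)) , h)
        in m , r , there ∘ f
  ... | inj₁ none with i
  ...   | there j   = ⊥-elim (none j e)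
  ...   | here refl = x ∷ l , ((e , λ j → distinct (∈-++⁻ l j) , none j) , p) , λ j → j
    where
    distinct : ∀ {w} → w ∈ l ⊎ w ∈ [ v ] → y ≢ w
    distinct (inj₁ j)           = ns (there j)
    distinct (inj₂ (here refl)) = ne

  -- If the path obtained from the rest of the walk returns to `u`, it is cut at the return;
  -- otherwise `trim` puts `u` in front of it.
  walk⇒path : ∀ {P u v} → Walk P u v → u ≡ v ⊎ ∃ λ m → Ind (u ∷ m ++ [ v ]) × m ⊂ P
  walk⇒path (here p) = inj₁ refl
  walk⇒path {u = u} {v} (step {w} p e r) with u ≟ v | walk⇒path r
  ... | yes eq | _          = inj₁ eq
  ... | no ne  | inj₁ refl  = inj₂ ([] , ((e , λ ()) , tt , tt) , λ ())
  ... | no ne  | inj₂ (m , q , s) with u ∈? m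
  ...   | yes i with ∈-∃++ i
  ...     | m₁ , m₂ , refl = inj₂ (m₂ , ind-++ʳ (w ∷ m₁) (subst (λ l → Ind (w ∷ l)) (++-assoc m₁ (u ∷ m₂) [ v ]) q) ,
                                   λ j → s (∈-++⁺ʳ m₁ (there j)))
  walk⇒path {u = u} {v} (step {w} p e r) | no ne | inj₂ (m , q , s) | no i =
    let m′ , q′ , f = trim u (w ∷ m) q ne (λ { (here refl) → ~⇒≢ e ; (there j) refl → i j }) (w , here refl , e)
    in inj₂ (m′ , q′ , λ j → sub (f j))
    where
    sub : ∀ {z} → z ∈ w ∷ m → _
    sub (here refl) = walk-src r
    sub (there j)   = s j

  -- The endpoints, which need not satisfy P, are admitted explicitly, so that the interior of the path lies in P.
  path : ∀ {P : Vtx → Set} {u v} → u ≢ v → Walk (λ x → P x ⊎ (x ≡ u ⊎ x ≡ v)) u v →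
         ∃ λ m → Ind (u ∷ m ++ [ v ]) × m ⊂ P
  path {P} {u} {v} ne w with walk⇒path w
  ... | inj₁ eq          = ⊥-elim (ne eq)
  ... | inj₂ (m , q , s) = m , q , λ i → inner i (s i)
    where
    inner : ∀ {z} → z ∈ m → P z ⊎ (z ≡ u ⊎ z ≡ v) → P z
    inner i (inj₁ p)           = p
    inner i (inj₂ (inj₁ refl)) = ⊥-elim (ind-≢ q (∈-++⁺ˡ i) refl)
    inner i (inj₂ (inj₂ refl)) = ⊥-elim (ind-≢ʳ (u ∷ m) q (there i) refl)

  firstHit : ∀ {P H : Vtx → Set} → (∀ v → Dec (H v)) → ∀ {u v} → Walk P u v → H v →
             ∃ λ r → P r × H r × Walk (λ x → (P x × ¬ H x) ⊎ x ≡ r) u r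
  firstHit H? {u} (here p) h = u , p , h , here (inj₂ refl)
  firstHit H? {u} (step p e w) h with H? u
  ... | yes h′ = u , p , h′ , here (inj₂ refl)
  ... | no h′  = let r , q , k , s = firstHit H? w h in r , q , k , step (inj₁ (p , h′)) e s

  walk-∷ : ∀ {x y l} → x ~ y → (∀ {u v} → u ∈ y ∷ l → v ∈ y ∷ l → Walk (_∈ y ∷ l) u v) →
           ∀ {u v} → u ∈ x ∷ y ∷ l → v ∈ x ∷ y ∷ l → Walk (_∈ x ∷ y ∷ l) u v
  walk-∷ e up (here refl) (here refl) = here (here refl)
  walk-∷ e up (here refl) (there j)   = step (here refl) e (walk-map there (up (here refl) j))
  walk-∷ e up (there i)   (here refl) = walk-snoc (walk-map there (up i (here refl))) (~-sym e) (here refl)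
  walk-∷ e up (there i)   (there j)   = walk-map there (up i j)

  ind-walk : ∀ l → Ind l → ∀ {u v} → u ∈ l → v ∈ l → Walk (_∈ l) u v
  ind-walk (x ∷ [])    p             (here refl) (here refl) = here (here refl)
  ind-walk (x ∷ y ∷ l) ((e , _) , p) i           j           = walk-∷ e (ind-walk (y ∷ l) p) i j

-- From lists to the paths, holes, wheels and pyramids of the definitions

module Realisation (G : Graph) where

  open import Data.List.Membership.Propositional using (_∈_)
  open Combinatorics using (Hom)
  open InducedPaths G
  open Graph G using (n; adj)

  -- Positions are plain numbers, since unlike elements of `Fin` they can be shifted when lists are
  -- concatenated, cut or reversed.
  data At : List Vtx → ℕ → Vtx → Set where
    here  : ∀ {x l} → At (x ∷ l) 0 x
    there : ∀ {x l k v} → At l k v → At (x ∷ l) (suc k) v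

  at-lookup : ∀ l i → At l (toℕ i) (lookup l i)
  at-lookup (x ∷ l) fzero    = here
  at-lookup (x ∷ l) (fsuc i) = there (at-lookup l i)

  at-∈ : ∀ {l k v} → At l k v → v ∈ l
  at-∈ here      = here refl
  at-∈ (there a) = there (at-∈ a)

  ∈-at : ∀ {l v} → v ∈ l → ∃ λ k → At l k v
  ∈-at (here refl) = 0 , here
  ∈-at (there i)   = let k , a = ∈-at i in suc k , there a

  at-fun : ∀ {l k u v} → At l k u → At l k v → u ≡ v
  at-fun here      here      = refl
  at-fun (there a) (there b) = at-fun a b

  at-< : ∀ {l k v} → At l k v → k < length l
  at-< here      = s≤s z≤n
  at-< (there a) = s≤s (at-< a)

  at-exists : ∀ l {k} → k < length l → ∃ λ v → At l k v
  at-exists (x ∷ l) {zero}  _       = x , here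
  at-exists (x ∷ l) {suc k} (s≤s p) = let v , a = at-exists l p in v , there a

  at-++ˡ : ∀ {l m k v} → At l k v → At (l ++ m) k v
  at-++ˡ here      = here
  at-++ˡ (there a) = there (at-++ˡ a)

  at-++ʳ : ∀ l {m k v} → At m k v → At (l ++ m) (length l + k) v
  at-++ʳ []      a = a
  at-++ʳ (x ∷ l) a = there (at-++ʳ l a)

  at-++⁻ : ∀ l {m k v} → At (l ++ m) k v → At l k v ⊎ ∃ λ j → k ≡ length l + j × At m j v
  at-++⁻ []      a         = inj₂ (_ , refl , a)
  at-++⁻ (x ∷ l) here      = inj₁ here
  at-++⁻ (x ∷ l) (there a) with at-++⁻ l a
  ... | inj₁ b              = inj₁ (there b)
  ... | inj₂ (j , refl , b) = inj₂ (j , refl , b)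

  ind-at : ∀ {l} → Ind l → ∀ {i j u v} → At l i u → At l j v → i < j → u ≢ v × (u ~ v → suc i ≡ j)
  ind-at (q , p) here (there b) _ = ind-≢ (q , p) (at-∈ b) , λ e → cong suc (pos q b e)
    where
    pos : ∀ {x l k v} → Link x l → At l k v → x ~ v → 0 ≡ k
    pos q here      e = refl
    pos (_ , a) (there b) e = ⊥-elim (proj₂ (a (at-∈ b)) e)
  ind-at (_ , p) (there a) (there b) (s≤s l) =
    let d , f = ind-at p a b l in d , cong suc ∘ f

  ind-consec : ∀ {l} → Ind l → ∀ {i u v} → At l i u → At l (suc i) v → u ~ v
  ind-consec ((e , _) , p) here      (there here) = e
  ind-consec (_ , p)       (there a) (there b)    = ind-consec p a b

  lastOf : Vtx → List Vtx → Vtx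
  lastOf x []      = x
  lastOf x (y ∷ l) = lastOf y l

  lastOf-∷ʳ : ∀ x l y → lastOf x (l ++ [ y ]) ≡ y
  lastOf-∷ʳ x []      y = refl
  lastOf-∷ʳ x (z ∷ l) y = lastOf-∷ʳ z l y

  lastOf-at : ∀ x l → At (x ∷ l) (length l) (lastOf x l)
  lastOf-at x []      = here
  lastOf-at x (y ∷ l) = there (lastOf-at y l)

  module _ {l : List Vtx} (p : Ind l) where

    at-inj : ∀ {i j u v} → At l i u → At l j v → u ≡ v → i ≡ j
    at-inj {i} {j} a b refl with <-cmp i j
    ... | tri< x _ _ = ⊥-elim (proj₁ (ind-at p a b x) refl)
    ... | tri≈ _ x _ = x
    ... | tri> _ _ x = ⊥-elim (proj₁ (ind-at p b a x) refl)

    at-adj : ∀ {i j u v} → At l i u → At l j v → u ~ v → suc i ≡ j ⊎ suc j ≡ i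
    at-adj {i} {j} a b e with <-cmp i j
    ... | tri< x _ _ = inj₁ (proj₂ (ind-at p a b x) e)
    ... | tri≈ _ refl _ = ⊥-elim (~-irrefl (subst (_~ _) (at-fun a b) e))
    ... | tri> _ _ x = inj₂ (proj₂ (ind-at p b a x) (~-sym e))

    lookup-inj : ∀ i j → lookup l i ≡ lookup l j → i ≡ j
    lookup-inj i j e = toℕ-injective (at-inj (at-lookup l i) (at-lookup l j) e)

    lookup-adj : ∀ i j → lookup l i ~ lookup l j → Consec G i j
    lookup-adj i j = at-adj (at-lookup l i) (at-lookup l j)

    consec-adj : ∀ {i j u v} → At l i u → At l j v → suc i ≡ j ⊎ suc j ≡ i → u ~ v
    consec-adj a b (inj₁ refl) = ind-consec p a b
    consec-adj a b (inj₂ refl) = ~-sym (ind-consec p b a)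

  toPath : ∀ x l → Ind (x ∷ l) → Path G
  toPath x l p = record
    { len = length l
    ; vtx = lookup (x ∷ l)
    ; inj = lookup-inj p
    ; ind = λ i j → lookup-adj p i j , consec-adj p (at-lookup (x ∷ l) i) (at-lookup (x ∷ l) j)
    }

  end-toPath : ∀ x l {p : Ind (x ∷ l)} → end G (toPath x l p) ≡ lastOf x l
  end-toPath x l = at-fun (subst (λ k → At (x ∷ l) k (lookup (x ∷ l) (fromℕ (length l)))) (toℕ-fromℕ (length l))
                             (at-lookup (x ∷ l) (fromℕ (length l)))) (lastOf-at x l)

  onP-∈ : ∀ {x l} {p : Ind (x ∷ l)} {v} → OnP G (toPath x l p) v → v ∈ x ∷ l
  onP-∈ {x} {l} (i , refl) = ∈-lookup {xs = x ∷ l} i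

  ∈-onP : ∀ {x l} {p : Ind (x ∷ l)} {v} → v ∈ x ∷ l → OnP G (toPath x l p) v
  ∈-onP i = index i , sym (lookup-index i)

  inner-at : ∀ {x l} {p : Ind (x ∷ l)} {v} → Inner G (toPath x l p) v →
             v ∈ x ∷ l × v ≢ x × v ≢ lastOf x l
  inner-at {x} {l} {p} (i , lo , hi , refl) =
    ∈-lookup {xs = x ∷ l} i ,
    (λ e → <⇒≢ lo (sym (at-inj p (at-lookup (x ∷ l) i) here e))) ,
    (λ e → <⇒≢ hi (at-inj p (at-lookup (x ∷ l) i) (lastOf-at x l) e))

  inner-∈ : ∀ {x m y} {p : Ind (x ∷ m ++ [ y ])} {v} → Inner G (toPath x (m ++ [ y ]) p) v → v ∈ m
  inner-∈ {x} {m} {y} {p} h with inner-at {x} {m ++ [ y ]} {p} h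
  ... | here e , ne , _ = ⊥-elim (ne e)
  ... | there i , _ , ne with ∈-++⁻ m i
  ...   | inj₁ j           = j
  ...   | inj₂ (here refl) = ⊥-elim (ne (sym (lastOf-∷ʳ x m y)))

  theta : ∀ {a b} → ¬ a ~ b → ∀ m₁ m₂ m₃ →
          Ind (a ∷ m₁ ++ [ b ]) → Ind (a ∷ m₂ ++ [ b ]) → Ind (a ∷ m₃ ++ [ b ]) →
          m₁ ⟂⟂ m₂ → m₁ ⟂⟂ m₃ → m₂ ⟂⟂ m₃ → HasTheta G
  theta {a} {b} ne m₁ m₂ m₃ p₁ p₂ p₃ s₁₂ s₁₃ s₂₃ =
    a , b , toPath a _ p₁ , toPath a _ p₂ , toPath a _ p₃ ,
    good m₁ p₁ , good m₂ p₂ , good m₃ p₃ , sep m₁ m₂ p₁ p₂ s₁₂ , sep m₁ m₃ p₁ p₃ s₁₃ , sep m₂ m₃ p₂ p₃ s₂₃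
    where
    good : ∀ m (p : Ind (a ∷ m ++ [ b ])) →
           2 ≤ length (m ++ [ b ]) × a ≡ a × end G (toPath a (m ++ [ b ]) p) ≡ b
    good []      ((e , _) , _) = ⊥-elim (ne e)
    good (x ∷ m) p = s≤s (subst (1 ≤_) (sym (trans (length-++ m) (+-comm (length m) 1))) (s≤s z≤n)) , refl ,
                     trans (end-toPath a (x ∷ m ++ [ b ]) {p}) (lastOf-∷ʳ a (x ∷ m) b)
    sep : ∀ m m′ (p : Ind (a ∷ m ++ [ b ])) (p′ : Ind (a ∷ m′ ++ [ b ])) → m ⟂⟂ m′ →
          (∀ v → Inner G (toPath a _ p) v → Inner G (toPath a _ p′) v → ⊥) ×
          (∀ u v → Inner G (toPath a _ p) u → Inner G (toPath a _ p′) v → ¬ u ~ v)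
    sep m m′ p p′ s =
      (λ v i j → proj₁ (s (inner-∈ {m = m} {p = p} i) (inner-∈ {m = m′} {p = p′} j)) refl) ,
      (λ u v i j → proj₂ (s (inner-∈ {m = m} {p = p} i) (inner-∈ {m = m′} {p = p′} j)))

  Joined : (a b : Vtx) (l : List Vtx) (a′ b′ : Vtx) (l′ : List Vtx) → Set
  Joined a b l a′ b′ l′ =
    (∀ {u v} → u ∈ l → v ∈ l′ → u ≢ v × (u ~ v → (u ≡ a × v ≡ a′) ⊎ (u ≡ b × v ≡ b′))) ×
    a ~ a′ × b ~ b′

  prism : ∀ {a₁ b₁ a₂ b₂ a₃ b₃} m₁ m₂ m₃ →
          Ind (a₁ ∷ m₁ ++ [ b₁ ]) → Ind (a₂ ∷ m₂ ++ [ b₂ ]) → Ind (a₃ ∷ m₃ ++ [ b₃ ]) →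
          Joined a₁ b₁ (a₁ ∷ m₁ ++ [ b₁ ]) a₂ b₂ (a₂ ∷ m₂ ++ [ b₂ ]) →
          Joined a₁ b₁ (a₁ ∷ m₁ ++ [ b₁ ]) a₃ b₃ (a₃ ∷ m₃ ++ [ b₃ ]) →
          Joined a₂ b₂ (a₂ ∷ m₂ ++ [ b₂ ]) a₃ b₃ (a₃ ∷ m₃ ++ [ b₃ ]) → HasPrism G
  prism m₁ m₂ m₃ p₁ p₂ p₃ (j₁₂ , s₁₂ , e₁₂) (j₁₃ , s₁₃ , e₁₃) (j₂₃ , s₂₃ , e₂₃) =
    toPath _ _ p₁ , toPath _ _ p₂ , toPath _ _ p₃ , pos m₁ , pos m₂ , pos m₃ ,
    dis {p = p₁} {p₂} j₁₂ , dis {p = p₁} {p₃} j₁₃ , dis {p = p₂} {p₃} j₂₃ ,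
    s₁₂ , s₁₃ , s₂₃ , ends m₁ m₂ p₁ p₂ e₁₂ , ends m₁ m₃ p₁ p₃ e₁₃ , ends m₂ m₃ p₂ p₃ e₂₃ ,
    only m₁ m₂ p₁ p₂ j₁₂ , only m₁ m₃ p₁ p₃ j₁₃ , only m₂ m₃ p₂ p₃ j₂₃
    where
    pos : ∀ m {b} → 1 ≤ length (m ++ [ b ])
    pos []      = s≤s z≤n
    pos (x ∷ m) = s≤s z≤n
    dis : ∀ {a l a′ l′} {p : Ind (a ∷ l)} {p′ : Ind (a′ ∷ l′)} {Q : Vtx → Vtx → Set} →
          (∀ {u v} → u ∈ a ∷ l → v ∈ a′ ∷ l′ → u ≢ v × Q u v) →
          Disjoint G (toPath a l p) (toPath a′ l′ p′)
    dis {p = p} {p′} j v i k = proj₁ (j (onP-∈ {p = p} i) (onP-∈ {p = p′} k)) refl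
    endEq : ∀ {a} m {b} (p : Ind (a ∷ m ++ [ b ])) → end G (toPath a _ p) ≡ b
    endEq {a} m {b} p = trans (end-toPath a (m ++ [ b ]) {p}) (lastOf-∷ʳ a m b)
    ends : ∀ {a a′} m m′ {b b′} (p : Ind (a ∷ m ++ [ b ])) (p′ : Ind (a′ ∷ m′ ++ [ b′ ])) → b ~ b′ →
           end G (toPath a _ p) ~ end G (toPath a′ _ p′)
    ends m m′ p p′ e rewrite endEq m p | endEq m′ p′ = e
    only : ∀ {a a′} m m′ {b b′} (p : Ind (a ∷ m ++ [ b ])) (p′ : Ind (a′ ∷ m′ ++ [ b′ ])) →
           (∀ {u v} → u ∈ a ∷ m ++ [ b ] → v ∈ a′ ∷ m′ ++ [ b′ ] →
              u ≢ v × (u ~ v → (u ≡ a × v ≡ a′) ⊎ (u ≡ b × v ≡ b′))) →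
           ∀ u v → OnP G (toPath a _ p) u → OnP G (toPath a′ _ p′) v → u ~ v →
           (u ≡ a × v ≡ a′) ⊎ (u ≡ end G (toPath a _ p) × v ≡ end G (toPath a′ _ p′))
    only m m′ p p′ j u v i k e rewrite endEq m p | endEq m′ p′ =
      proj₂ (j (onP-∈ {p = p} i) (onP-∈ {p = p′} k)) e

  -- The hole is listed as x, then q, then y, then b backwards.
  module _ {x y : Vtx} (ne : ¬ x ~ y) (q b : List Vtx) (p : Ind (x ∷ q ++ [ y ])) (r : Ind (x ∷ b ++ [ y ]))
           (s : q ⟂⟂ b) where

    private
      m : List Vtx
      m = q ++ y ∷ reverse b

      L : List Vtx
      L = x ∷ m

      N : ℕ
      N = length q + suc (length b)

      r′ : Ind (y ∷ reverse b ++ [ x ])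
      r′ = ind-flip b r

      pm : Ind m
      pm = glue q (proj₂ p) (ind-++ˡ (y ∷ reverse b) r′) (⟂⟂-revʳ {l = q} s)

      length-m : length m ≡ N
      length-m = trans (length-++ q) (cong (λ k → length q + suc k) (length-reverse b))

      x-adj : ∀ {i v} → At m i v → x ≢ v × (x ~ v → i ≡ 0 ⊎ suc i ≡ N)
      x-adj a with at-++⁻ q a
      ... | inj₁ c = let d , f = ind-at p here (there (at-++ˡ c)) (s≤s z≤n) in d , λ e → inj₁ (sym (suc-injective (f e)))
      ... | inj₂ (_ , refl , here) = ind-≢ p (∈-++⁺ʳ q (here refl)) , λ e → ⊥-elim (ne e)
      ... | inj₂ (_ , refl , there {k = k} c) =
        let X = at-++ʳ (y ∷ reverse b) {m = [ x ]} {k = 0} here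
            d , f = ind-at r′ (at-++ˡ {m = [ x ]} (there c)) X (s≤s (≤-trans (at-< c) (m≤m+n _ 0)))
        in (λ z → d (sym z)) , λ e → inj₂ (fix (f (~-sym e)))
        where
        fix : suc (suc k) ≡ suc (length (reverse b) + 0) → suc (length q + suc k) ≡ N
        fix e rewrite sym (+-suc (length q) (suc k)) =
          cong (length q +_) (trans e (cong suc (trans (+-identityʳ _) (length-reverse b))))

      x-head : ∀ {v} → At m 0 v → x ~ v
      x-head a with at-++⁻ q a
      ... | inj₁ c             = ind-consec p here (there (at-++ˡ c))
      ... | inj₂ (zero , e , here) =
        ind-consec p here (there (subst (λ k → At (q ++ [ y ]) k y) (sym e) (at-++ʳ q here)))
      ... | inj₂ (suc j , e , _) = ⊥-elim (m+1+n≢0 (length q) (sym e))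

      x-last : ∀ {i v} → At m i v → suc i ≡ N → x ~ v
      x-last {i} {v} a e with at-++⁻ q a
      ... | inj₁ c              = ⊥-elim (m+1+n≰m (length q) (subst (_≤ length q) e (at-< c)))
      ... | inj₂ (j , refl , c) = ~-sym (ind-consec r′ (at-++ˡ {m = [ x ]} c) (subst (λ k → At (y ∷ reverse b ++ [ x ]) k x) (sym eq) X))
        where
        eq : suc j ≡ suc (length b)
        eq = +-cancelˡ-≡ (length q) _ _ (trans (+-suc (length q) j) e)
        X : At (y ∷ reverse b ++ [ x ]) (suc (length b)) x
        X = subst (λ k → At (y ∷ reverse b ++ [ x ]) (suc k) x) (trans (+-identityʳ _) (length-reverse b))
                  (at-++ʳ (y ∷ reverse b) {k = 0} here)

      cyc : ∀ {i j u v} → At L i u → At L j v → i < j → u ≢ v × (u ~ v → suc i ≡ j ⊎ (i ≡ 0 × suc j ≡ suc N))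
      cyc here (there c) _ = let d , f = x-adj c in d , λ e → [ (λ z → inj₁ (cong suc (sym z))) , (λ z → inj₂ (refl , cong suc z)) ]′ (f e)
      cyc (there a) (there c) (s≤s l) = let d , f = ind-at pm a c l in d , λ e → inj₁ (cong suc (f e))

      nonempty : ∀ l → Ind (x ∷ l ++ [ y ]) → 1 ≤ length l
      nonempty []      ((e , _) , _) = ⊥-elim (ne e)
      nonempty (_ ∷ _) _             = s≤s z≤n

      big : 4 ≤ suc (length m)
      big = s≤s (subst (3 ≤_) (sym length-m) (+-mono-≤ (nonempty q p) (s≤s (nonempty b r))))

      Adjᶜ : ℕ → ℕ → Set
      Adjᶜ i j = suc i ≡ j ⊎ (suc i ≡ suc (length m) × j ≡ 0)

      cyc⇒ : ∀ {i j u v} → At L i u → At L j v → u ~ v → Adjᶜ i j ⊎ Adjᶜ j i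
      cyc⇒ {i} {j} a c e with <-cmp i j
      ... | tri< l _ _ = [ (λ z → inj₁ (inj₁ z)) , (λ (z , w) → inj₂ (inj₂ (trans w (cong suc (sym length-m)) , z))) ]′ (proj₂ (cyc a c l) e)
      ... | tri≈ _ refl _ = ⊥-elim (~-irrefl (subst (_~ _) (at-fun a c) e))
      ... | tri> _ _ l = [ (λ z → inj₂ (inj₁ z)) , (λ (z , w) → inj₁ (inj₂ (trans w (cong suc (sym length-m)) , z))) ]′ (proj₂ (cyc c a l) (~-sym e))

      next : ∀ {i j u v} → At L i u → At L j v → Adjᶜ i j → u ~ v
      next here      (there c) (inj₁ refl)    = x-head c
      next (there a) (there c) (inj₁ refl)    = ind-consec pm a c
      next (there a) here      (inj₂ (z , _)) = ~-sym (x-last a (trans (suc-injective z) length-m))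
      next here      here      (inj₂ (z , _)) = ⊥-elim (<-irrefl (suc-injective z) (≤-trans (s≤s z≤n) (≤-pred big)))

      distinct : ∀ {i j u v} → At L i u → At L j v → u ≡ v → i ≡ j
      distinct {i} {j} a c refl with <-cmp i j
      ... | tri< l _ _ = ⊥-elim (proj₁ (cyc a c l) refl)
      ... | tri≈ _ z _ = z
      ... | tri> _ _ l = ⊥-elim (proj₁ (cyc c a l) refl)

    hole : Hole G
    hole = record
      { len = length L
      ; big = big
      ; vtx = lookup L
      ; inj = λ i j e → toℕ-injective (distinct (at-lookup L i) (at-lookup L j) e)
      ; ind = λ i j → cyc⇒ (at-lookup L i) (at-lookup L j) ,
                      [ next (at-lookup L i) (at-lookup L j) , (λ z → ~-sym (next (at-lookup L j) (at-lookup L i) z)) ]′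
      }

    onHole : ∀ {v} → OnH G hole v → v ∈ x ∷ b ++ [ y ] ⊎ v ∈ q
    onHole {v} (i , refl) with ∈-lookup {xs = L} i
    ... | here e  = inj₁ (here e)
    ... | there j with ∈-++⁻ q j
    ...   | inj₁ k         = inj₂ k
    ...   | inj₂ (here e)  = inj₁ (there (∈-++⁺ʳ b (here e)))
    ...   | inj₂ (there k) = inj₁ (there (∈-++⁺ˡ {xs = b} (reverse⁻ {xs = b} k)))

    toHole : ∀ {v} → v ∈ x ∷ b ++ [ y ] ⊎ v ∈ q → OnH G hole v
    toHole {v} h = index (mem h) , sym (lookup-index (mem h))
      where
      mem : v ∈ x ∷ b ++ [ y ] ⊎ v ∈ q → v ∈ L
      mem (inj₁ (here e))  = here e
      mem (inj₁ (there i)) with ∈-++⁻ b i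
      ... | inj₁ j        = there (∈-++⁺ʳ q (there (reverse⁺ j)))
      ... | inj₂ (here e) = there (∈-++⁺ʳ q (here e))
      mem (inj₂ i) = there (∈-++⁺ˡ i)

  countB-split : ∀ {m} (f : Fin m → Bool) i → f i ≡ true →
                 countB f ≡ suc (countB (λ j → if does (j ≟ i) then false else f j))
  countB-split {suc m} f fzero    e rewrite e = refl
  countB-split {suc m} f (fsuc i) e rewrite countB-split (f ∘ fsuc) i e = +-suc _ _

  -- Erasing an index at which `f` holds lowers the count by one, so distinct indices are counted
  -- separately.
  countB-≥ : ∀ {m} (f : Fin m → Bool) (is : List (Fin m)) → Hom 2 _≢_ is → Hom 1 (λ i → f i ≡ true) is →
             length is ≤ countB f
  countB-≥ f []       u h = z≤n
  countB-≥ f (i ∷ is) (d , u) (e , h) rewrite countB-split f i e = s≤s (countB-≥ _ is u (go is d h))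
    where
    go : ∀ js → Hom 1 (i ≢_) js → Hom 1 (λ j → f j ≡ true) js →
         Hom 1 (λ j → (if does (j ≟ i) then false else f j) ≡ true) js
    go []       _       _       = tt
    go (j ∷ js) (x , d) (y , h) = off , go js d h
      where
      off : (if does (j ≟ i) then false else f j) ≡ true
      off with j ≟ i
      ... | yes z = ⊥-elim (x (sym z))
      ... | no _  = y

  remove : ∀ {X : Set} {x : X} (xs : List X) → x ∈ xs →
           ∃ λ ys → suc (length ys) ≡ length xs × (∀ {y} → y ∈ xs → x ≢ y → y ∈ ys)
  remove (x ∷ xs) (here refl) = xs , refl , λ { (here e) ne → ⊥-elim (ne (sym e)) ; (there i) _ → i }
  remove (z ∷ xs) (there i)   =
    let ys , e , f = remove xs i
    in z ∷ ys , cong suc e , λ { (here e) _ → here e ; (there j) ne → there (f j ne) }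

  length-≤ : ∀ {X : Set} (xs ys : List X) → Hom 2 _≢_ xs → Hom 1 (_∈ ys) xs → length xs ≤ length ys
  length-≤ []       ys u       h       = z≤n
  length-≤ (x ∷ xs) ys (d , u) (i , h) with remove ys i
  ... | zs , e , f = subst (suc (length xs) ≤_) e (s≤s (length-≤ xs zs u (go xs d h)))
    where
    go : ∀ xs → Hom 1 (x ≢_) xs → Hom 1 (_∈ ys) xs → Hom 1 (_∈ zs) xs
    go []       _       _       = tt
    go (y ∷ xs) (n , d) (j , h) = f j n , go xs d h

  -- Three pairwise nonadjacent neighbours exclude twin wheels and short pyramids.
  hub : ∀ (h : Hole G) {y u v w} → ¬ OnH G h y → OnH G h u → OnH G h v → OnH G h w →
        y ~ u → y ~ v → y ~ w → u ⟂ v → u ⟂ w → v ⟂ w → InHub G y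
  hub h {y} off (a , refl) (b , refl) (c , refl) yu yv yw uv uw vw =
    h , wheel , noTwin , noShort
    where
    open Hole h using (vtx)
    ab = λ e → proj₁ uv (cong vtx e)
    ac = λ e → proj₁ uw (cong vtx e)
    bc = λ e → proj₁ vw (cong vtx e)
    f : Fin (Hole.len h) → Bool
    f i = adj y (vtx i)
    wheel : IsWheel G h y
    wheel = off , countB-≥ f (a ∷ b ∷ c ∷ []) ((ab , ac , tt) , (bc , tt) , tt , tt) (yu , yv , yw , tt)
    noTwin : ¬ IsTwinWheel G h y
    noTwin (_ , i , j , k , _ , all , eij , ejk , _) = sort (proj₁ (all a) yu) (proj₁ (all b) yv) (proj₁ (all c) yw)
      where
      sort : a ≡ i ⊎ a ≡ j ⊎ a ≡ k → b ≡ i ⊎ b ≡ j ⊎ b ≡ k → c ≡ i ⊎ c ≡ j ⊎ c ≡ k → ⊥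
      sort (inj₁ refl)        (inj₁ refl)        _                  = ab refl
      sort (inj₁ refl)        (inj₂ (inj₁ refl)) _                  = proj₂ uv eij
      sort (inj₁ refl)        (inj₂ (inj₂ refl)) (inj₁ refl)        = ac refl
      sort (inj₁ refl)        (inj₂ (inj₂ refl)) (inj₂ (inj₁ refl)) = proj₂ uw eij
      sort (inj₁ refl)        (inj₂ (inj₂ refl)) (inj₂ (inj₂ refl)) = bc refl
      sort (inj₂ (inj₁ refl)) (inj₁ refl)        _                  = proj₂ uv (~-sym eij)
      sort (inj₂ (inj₁ refl)) (inj₂ (inj₁ refl)) _                  = ab refl
      sort (inj₂ (inj₁ refl)) (inj₂ (inj₂ refl)) _                  = proj₂ uv ejk
      sort (inj₂ (inj₂ refl)) (inj₁ refl)        (inj₁ refl)        = bc refl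
      sort (inj₂ (inj₂ refl)) (inj₁ refl)        (inj₂ (inj₁ refl)) = proj₂ vw eij
      sort (inj₂ (inj₂ refl)) (inj₁ refl)        (inj₂ (inj₂ refl)) = ac refl
      sort (inj₂ (inj₂ refl)) (inj₂ (inj₁ refl)) _                  = proj₂ uv (~-sym ejk)
      sort (inj₂ (inj₂ refl)) (inj₂ (inj₂ refl)) _                  = ab refl
    noShort : ¬ IsShortPyramid G h y
    noShort (_ , three , i , j , _ , i≢j , _ , _ , yi , yj , _ , eij , _) = go (i ≟ a) (i ≟ b) (i ≟ c) (j ≟ a) (j ≟ b) (j ≟ c)
      where
      four : ∀ d → y ~ vtx d → d ≢ a → d ≢ b → d ≢ c → ⊥
      four d yd da db dc = <-irrefl refl (≤-trans
        (countB-≥ f (d ∷ a ∷ b ∷ c ∷ []) ((da , db , dc , tt) , (ab , ac , tt) , (bc , tt) , tt , tt) (yd , yu , yv , yw , tt))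
        (≤-reflexive three))
      go : Dec (i ≡ a) → Dec (i ≡ b) → Dec (i ≡ c) → Dec (j ≡ a) → Dec (j ≡ b) → Dec (j ≡ c) → ⊥
      go (no p) (no q) (no r) _ _ _ = four i yi p q r
      go _ _ _ (no p) (no q) (no r) = four j yj p q r
      go (yes refl) _ _ (yes refl) _ _ = i≢j refl
      go (yes refl) _ _ _ (yes refl) _ = proj₂ uv eij
      go (yes refl) _ _ _ _ (yes refl) = proj₂ uw eij
      go _ (yes refl) _ (yes refl) _ _ = proj₂ uv (~-sym eij)
      go _ (yes refl) _ _ (yes refl) _ = i≢j refl
      go _ (yes refl) _ _ _ (yes refl) = proj₂ vw eij
      go _ _ (yes refl) (yes refl) _ _ = proj₂ uw (~-sym eij)
      go _ _ (yes refl) _ (yes refl) _ = proj₂ vw (~-sym eij)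
      go _ _ (yes refl) _ _ (yes refl) = i≢j refl

  -- Twin wheels and short pyramids have just three neighbours on the hole, so four distinct ones
  -- make the wheel proper even when some of them are adjacent.
  hub₄ : ∀ (h : Hole G) {y u v w x} → ¬ OnH G h y → OnH G h u → OnH G h v → OnH G h w → OnH G h x →
         y ~ u → y ~ v → y ~ w → y ~ x → Hom 2 _≢_ (u ∷ v ∷ w ∷ x ∷ []) → InHub G y
  hub₄ h {y} off (a , refl) (b , refl) (c , refl) (d , refl) yu yv yw yx ((ab , ac , ad , _) , (bc , bd , _) , (cd , _) , _) =
    h , wheel , noTwin , noShort
    where
    open Hole h using (vtx)
    f : Fin (Hole.len h) → Bool
    f i = adj y (vtx i)
    is : List (Fin (Hole.len h))
    is = a ∷ b ∷ c ∷ d ∷ []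
    distinct : Hom 2 _≢_ is
    distinct = (ab ∘ cong vtx , ac ∘ cong vtx , ad ∘ cong vtx , tt) , (bc ∘ cong vtx , bd ∘ cong vtx , tt) ,
               (cd ∘ cong vtx , tt) , tt , tt
    four : 4 ≤ nbrCount G h y
    four = countB-≥ f is distinct (yu , yv , yw , yx , tt)
    wheel : IsWheel G h y
    wheel = off , ≤-trans (s≤s (s≤s (s≤s z≤n))) four
    noShort : ¬ IsShortPyramid G h y
    noShort (_ , three , _) = <-irrefl refl (≤-trans four (≤-reflexive three))
    noTwin : ¬ IsTwinWheel G h y
    noTwin (_ , i , j , k , _ , all , _) = <-irrefl refl (length-≤ is (i ∷ j ∷ k ∷ []) distinct
      (mem (proj₁ (all a) yu) , mem (proj₁ (all b) yv) , mem (proj₁ (all c) yw) , mem (proj₁ (all d) yx) , tt))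
      where
      mem : ∀ {l} → l ≡ i ⊎ l ≡ j ⊎ l ≡ k → l ∈ i ∷ j ∷ k ∷ []
      mem (inj₁ e)        = here e
      mem (inj₂ (inj₁ e)) = there (here e)
      mem (inj₂ (inj₂ e)) = there (there (here e))

  -- The path R i of the definition is h i, T i; the ends of P are y₁ and yₙ, and Q is q.
  record PyramidData (t : ℕ) : Set where
    field
      {y₁ yₙ} : Vtx
      far     : ¬ y₁ ~ yₙ
      q b     : List Vtx
      indQ    : Ind (y₁ ∷ q ++ [ yₙ ])
      indP    : Ind (y₁ ∷ b ++ [ yₙ ])
      apart   : q ⟂⟂ b
      h       : Fin t → Vtx
      T       : Fin t → List Vtx
      indR    : ∀ i → Ind (h i ∷ T i)
      px pz   : Fin t → ℕ
      px-lo   : ∀ i → 0 < px i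
      px-hi   : ∀ i → px i < length b
      px-adj  : ∀ i {l v} → At (y₁ ∷ b ++ [ yₙ ]) l v → l ≡ px i ⊎ l ≡ suc (px i) → h i ~ v
      px-only : ∀ i {l v} → At (y₁ ∷ b ++ [ yₙ ]) l v → h i ~ v → l ≡ px i ⊎ l ≡ suc (px i)
      P-apart : ∀ i {u v} → u ∈ h i ∷ T i → v ∈ y₁ ∷ b ++ [ yₙ ] → u ≢ v × (u ~ v → u ≡ h i)
      pz-hi   : ∀ i → pz i < length q
      pz-adj  : ∀ i {v} → At q (pz i) v → lastOf (h i) (T i) ~ v
      pz-only : ∀ i {l v} → At q l v → lastOf (h i) (T i) ~ v → l ≡ pz i
      Q-apart : ∀ i {u v} → u ∈ h i ∷ T i → v ∈ q → u ≢ v × (u ~ v → u ≡ lastOf (h i) (T i))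
      R-apart : ∀ i j → i ≢ j → h i ∷ T i ⟂⟂ h j ∷ T j
      px-mono : ∀ i j → toℕ i < toℕ j → suc (px i) < px j
      pz-mono : ∀ i j → toℕ i < toℕ j → pz i ≤ pz j

  genPyramid : ∀ {t} → PyramidData t → HasGenPyramid G t
  genPyramid {t} D = go (PyramidData.q D) refl
    where
    open PyramidData D using (y₁; yₙ; far; b; h; T; indR; px; pz; px-lo; px-hi; px-adj; px-only; P-apart; R-apart; px-mono; pz-mono; indP)
    go : ∀ q → PyramidData.q D ≡ q → HasGenPyramid G t
    -- The path Q needs a vertex; if `q` were empty, the ends of P would be adjacent.
    go []      e with subst (λ q → Ind (y₁ ∷ q ++ [ yₙ ])) e (PyramidData.indQ D)
    ... | ((a , _) , _) = ⊥-elim (far a)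
    go (x ∷ l) refl =
      P , Q , R , px , z , dPQ , dRP , dRQ , dRR ,
      (hole far q b indQ indP apart , λ v → on⇒ , on⇐) ,
      -- P has `suc (length b)` edges, so `px i < length b` keeps both neighbours in its interior.
      (λ i → px-lo i , subst (suc (px i) <_) (sym (trans (length-++ b) (+-comm (length b) 1))) (s≤s (px-hi i))) ,
      (λ i l′ → px-only i (at-lookup (y₁ ∷ b ++ [ yₙ ]) l′) , px-adj i (at-lookup (y₁ ∷ b ++ [ yₙ ]) l′)) ,
      (λ i l′ → only i l′ , adjz i l′) ,
      inn ,
      (λ i j ne u v m k → proj₂ (R-apart i j ne (onP-∈ {p = indR i} m) (onP-∈ {p = indR j} k))) ,
      px-mono ,
      λ i j l → subst₂ _≤_ (sym (toℕ-fromℕ< (pz-hi i))) (sym (toℕ-fromℕ< (pz-hi j))) (pz-mono i j l)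
      where
      open PyramidData D using (q; indQ; apart; pz-hi; pz-adj; pz-only; Q-apart)
      ind-q : Ind q
      ind-q = ind-++ˡ q (proj₂ indQ)
      P Q : Path G
      P = toPath y₁ (b ++ [ yₙ ]) indP
      Q = toPath x l ind-q
      R : Fin t → Path G
      R i = toPath (h i) (T i) (indR i)
      z : Fin t → Fin (length q)
      z i = fromℕ< (pz-hi i)
      P≢Q : ∀ {v} → v ∈ y₁ ∷ b ++ [ yₙ ] → v ∈ q → ⊥
      P≢Q (here refl) k = ind-≢ indQ (∈-++⁺ˡ k) refl
      P≢Q (there m)   k with ∈-++⁻ b m
      ... | inj₁ m′          = proj₁ (apart k m′) refl
      ... | inj₂ (here refl) = ind-≢ʳ q (proj₂ indQ) k refl
      dPQ : Disjoint G P Q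
      dPQ v m k = P≢Q (onP-∈ {p = indP} m) (onP-∈ {p = ind-q} k)
      dRP : ∀ i → Disjoint G (R i) P
      dRP i v m k = proj₁ (P-apart i (onP-∈ {p = indR i} m) (onP-∈ {p = indP} k)) refl
      dRQ : ∀ i → Disjoint G (R i) Q
      dRQ i v m k = proj₁ (Q-apart i (onP-∈ {p = indR i} m) (onP-∈ {p = ind-q} k)) refl
      dRR : ∀ i j → i ≢ j → Disjoint G (R i) (R j)
      dRR i j ne v m k = proj₁ (R-apart i j ne (onP-∈ {p = indR i} m) (onP-∈ {p = indR j} k)) refl
      on⇒ : ∀ {v} → OnH G (hole far q b indQ indP apart) v → OnP G P v ⊎ OnP G Q v
      on⇒ o = [ (λ m → inj₁ (∈-onP {p = indP} m)) , (λ m → inj₂ (∈-onP {p = ind-q} m)) ]′ (onHole far q b indQ indP apart o)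
      on⇐ : ∀ {v} → OnP G P v ⊎ OnP G Q v → OnH G (hole far q b indQ indP apart) v
      on⇐ o = toHole far q b indQ indP apart
                ([ (λ m → inj₁ (onP-∈ {p = indP} m)) , (λ m → inj₂ (onP-∈ {p = ind-q} m)) ]′ o)
      only : ∀ i l′ → end G (R i) ~ lookup q l′ → l′ ≡ z i
      only i l′ e = toℕ-injective (trans
        (pz-only i (at-lookup q l′) (subst (_~ lookup q l′) (end-toPath (h i) (T i) {indR i}) e)) (sym (toℕ-fromℕ< (pz-hi i))))
      adjz : ∀ i l′ → l′ ≡ z i → end G (R i) ~ lookup q l′
      adjz i l′ refl = subst (_~ lookup q l′) (sym (end-toPath (h i) (T i) {indR i}))
        (pz-adj i (subst (λ k → At q k (lookup q l′)) (toℕ-fromℕ< (pz-hi i)) (at-lookup q l′)))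
      inn : ∀ i u v → Inner G (R i) u → OnP G P v ⊎ OnP G Q v → ¬ u ~ v
      inn i u v m k e with inner-at {p = indR i} m
      ... | mem , ne , ne′ = [ (λ k → ne (proj₂ (P-apart i mem (onP-∈ {p = indP} k)) e)) ,
                               (λ k → ne′ (proj₂ (Q-apart i mem (onP-∈ {p = ind-q} k)) e)) ]′ k

-- Configurations of three vertices on one side

module Separated (G : Graph) (noTheta : ¬ HasTheta G) (noPrism : ¬ HasPrism G)
  (Y : Fin (Graph.n G) → Set) (stable : ∀ u v → Y u → Y v → ¬ E G u v) (noHub : ∀ y → Y y → ¬ InHub G y) where

  open import Data.List.Membership.Propositional using (_∈_)
  open Combinatorics
  open Prefix (Fin (Graph.n G)) _≟_
  open InducedPaths G
  open Realisation G

  far : ∀ {u v} → Y u → Y v → u ≢ v → u ⟂ v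
  far p q d = d , stable _ _ p q

  -- The set `Z` of attached vertices shrinks with every selection, while all of `Y` stays outside
  -- `D` throughout.
  record Side (Z D : Vtx → Set) : Set where
    field
      conn : ∀ {u v} → D u → D v → Walk D u v
      att  : ∀ {y} → Z y → ∃ λ d → D d × y ~ d
      off  : ∀ {y} → Y y → ¬ D y

  record Claw (D : Vtx → Set) (a b c : Vtx) : Set where
    field
      {x}        : Vtx
      inD        : D x
      k₁ k₂ k₃   : List Vtx
      s₁         : k₁ ⊂ D
      s₂         : k₂ ⊂ D
      s₃         : k₃ ⊂ D
      i₁         : Ind (a ∷ k₁ ++ [ x ])
      i₂         : Ind (b ∷ k₂ ++ [ x ])
      i₃         : Ind (c ∷ k₃ ++ [ x ])
      p₁₂        : a ∷ k₁ ⟂⟂ b ∷ k₂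
      p₁₃        : a ∷ k₁ ⟂⟂ c ∷ k₃
      p₂₃        : b ∷ k₂ ⟂⟂ c ∷ k₃

  -- Two views of the same situation are kept. The paths through `k₂` and `k₃` lead from `b` and `c`
  -- to `a` and become parts of a theta ending at `a`; the path `p` from `b` to `c` becomes part of
  -- a hole on which `a` sees `f` and `g`.
  record Mid (D : Vtx → Set) (a b c : Vtx) : Set where
    field
      k₂ k₃ p    : List Vtx
      {f g}      : Vtx
      s₂         : k₂ ⊂ D
      s₃         : k₃ ⊂ D
      s          : p ⊂ D
      i₂         : Ind (b ∷ k₂ ++ [ a ])
      i₃         : Ind (c ∷ k₃ ++ [ a ])
      p₂₃        : b ∷ k₂ ⟂⟂ c ∷ k₃
      i          : Ind (b ∷ p ++ [ c ])
      f∈         : f ∈ p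
      g∈         : g ∈ p
      af         : a ~ f
      ag         : a ~ g
      fg         : f ⟂ g

  Touch : Vtx → List Vtx → Vtx → List Vtx → Set
  Touch a k b l =
    (∀ {u v} → u ∈ a ∷ k → v ∈ b ∷ l → u ≢ v × (u ~ v → u ≡ lastOf a k × v ≡ lastOf b l)) × lastOf a k ~ lastOf b l

  -- A leg may be trivial, so that one of a, b, c itself lies in the triangle.
  record Tri (D : Vtx → Set) (a b c : Vtx) : Set where
    field
      k₁ k₂ k₃   : List Vtx
      s₁         : k₁ ⊂ D
      s₂         : k₂ ⊂ D
      s₃         : k₃ ⊂ D
      i₁         : Ind (a ∷ k₁)
      i₂         : Ind (b ∷ k₂)
      i₃         : Ind (c ∷ k₃)
      t₁₂        : Touch a k₁ b k₂
      t₁₃        : Touch a k₁ c k₃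
      t₂₃        : Touch b k₂ c k₃

  touch-sym : ∀ {a k b l} → Touch a k b l → Touch b l a k
  touch-sym (t , e) = (λ i j → let d , f = t j i in d ∘ sym , λ z → let p , q = f (~-sym z) in q , p) , ~-sym e

  Star : (Vtx → Set) → Vtx → Vtx → Vtx → Set
  Star D a b c = Claw D a b c ⊎ Mid D a b c ⊎ Mid D b a c ⊎ Mid D c a b

  module _ {D : Vtx → Set} where

    claw₁₂ : ∀ {a b c} → Claw D a b c → Claw D b a c
    claw₁₂ C = record { Claw C ; k₁ = Claw.k₂ C ; k₂ = Claw.k₁ C ; s₁ = Claw.s₂ C ; s₂ = Claw.s₁ C ; i₁ = Claw.i₂ C ; i₂ = Claw.i₁ C
                      ; p₁₂ = ⟂⟂-sym (Claw.p₁₂ C) ; p₁₃ = Claw.p₂₃ C ; p₂₃ = Claw.p₁₃ C }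

    claw₂₃ : ∀ {a b c} → Claw D a b c → Claw D a c b
    claw₂₃ C = record { Claw C ; k₂ = Claw.k₃ C ; k₃ = Claw.k₂ C ; s₂ = Claw.s₃ C ; s₃ = Claw.s₂ C ; i₂ = Claw.i₃ C ; i₃ = Claw.i₂ C
                      ; p₁₂ = Claw.p₁₃ C ; p₁₃ = Claw.p₁₂ C ; p₂₃ = ⟂⟂-sym (Claw.p₂₃ C) }

    tri₁₂ : ∀ {a b c} → Tri D a b c → Tri D b a c
    tri₁₂ C = record { k₁ = Tri.k₂ C ; k₂ = Tri.k₁ C ; k₃ = Tri.k₃ C ; s₁ = Tri.s₂ C ; s₂ = Tri.s₁ C ; s₃ = Tri.s₃ C
                     ; i₁ = Tri.i₂ C ; i₂ = Tri.i₁ C ; i₃ = Tri.i₃ C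
                     ; t₁₂ = touch-sym (Tri.t₁₂ C) ; t₁₃ = Tri.t₂₃ C ; t₂₃ = Tri.t₁₃ C }

    tri₂₃ : ∀ {a b c} → Tri D a b c → Tri D a c b
    tri₂₃ C = record { k₁ = Tri.k₁ C ; k₂ = Tri.k₃ C ; k₃ = Tri.k₂ C ; s₁ = Tri.s₁ C ; s₂ = Tri.s₃ C ; s₃ = Tri.s₂ C
                     ; i₁ = Tri.i₁ C ; i₂ = Tri.i₃ C ; i₃ = Tri.i₂ C
                     ; t₁₂ = Tri.t₁₃ C ; t₁₃ = Tri.t₁₂ C ; t₂₃ = touch-sym (Tri.t₂₃ C) }

    mid₂₃ : ∀ {a b c} → Mid D a b c → Mid D a c b
    mid₂₃ C = record { k₂ = Mid.k₃ C ; k₃ = Mid.k₂ C ; p = reverse (Mid.p C) ; s₂ = Mid.s₃ C ; s₃ = Mid.s₂ C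
                     ; s = λ m → Mid.s C (reverse⁻ {xs = Mid.p C} m)
                     ; i₂ = Mid.i₃ C ; i₃ = Mid.i₂ C ; p₂₃ = ⟂⟂-sym (Mid.p₂₃ C) ; i = ind-flip (Mid.p C) (Mid.i C)
                     ; f∈ = reverse⁺ (Mid.f∈ C) ; g∈ = reverse⁺ (Mid.g∈ C) ; af = Mid.af C ; ag = Mid.ag C ; fg = Mid.fg C }

    star₁₂ : ∀ {a b c} → Star D a b c → Star D b a c
    star₁₂ (inj₁ C)               = inj₁ (claw₁₂ C)
    star₁₂ (inj₂ (inj₁ C))        = inj₂ (inj₂ (inj₁ C))
    star₁₂ (inj₂ (inj₂ (inj₁ C))) = inj₂ (inj₁ C)
    star₁₂ (inj₂ (inj₂ (inj₂ C))) = inj₂ (inj₂ (inj₂ (mid₂₃ C)))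

    star₂₃ : ∀ {a b c} → Star D a b c → Star D a c b
    star₂₃ (inj₁ C)               = inj₁ (claw₂₃ C)
    star₂₃ (inj₂ (inj₁ C))        = inj₂ (inj₁ (mid₂₃ C))
    star₂₃ (inj₂ (inj₂ (inj₁ C))) = inj₂ (inj₂ (inj₂ C))
    star₂₃ (inj₂ (inj₂ (inj₂ C))) = inj₂ (inj₂ (inj₁ C))

  lastOf-∈ : ∀ x l → lastOf x l ∈ x ∷ l
  lastOf-∈ x []      = here refl
  lastOf-∈ x (y ∷ l) = there (lastOf-∈ y l)

  ind-penult : ∀ x l {y} → Ind (x ∷ l ++ [ y ]) → lastOf x l ~ y
  ind-penult x []      ((e , _) , _) = e
  ind-penult x (z ∷ l) (_ , p)       = ind-penult z l p

  ind-∷ʳ : ∀ y l {z} → Ind (y ∷ l) → lastOf y l ~ z → (∀ {u} → u ∈ y ∷ l → u ≢ z × (u ~ z → u ≡ lastOf y l)) →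
           Ind (y ∷ l ++ [ z ])
  ind-∷ʳ y []      p e h = (e , λ ()) , tt , tt
  ind-∷ʳ y (x ∷ l) ((a , b) , p) e h = (a , ⟂*-++ l b λ { (here refl) → proj₁ (h (here refl)) , λ f →
    ind-≢ ((a , b) , p) (lastOf-∈ x l) (proj₂ (h (here refl)) f) }) , ind-∷ʳ x l p e (h ∘ there)

  ind-touch : ∀ b k {c l} → Ind (b ∷ k) → Ind (c ∷ l) → Touch b k c l → Ind (b ∷ (k ++ reverse l) ++ [ c ])
  ind-touch b []      {c} {l} p q (t , e) =
    ind-flip l (ind-∷ʳ c l q (~-sym e) λ i → let d , f = t (here refl) i in d ∘ sym , λ z → proj₂ (f (~-sym z)))
  ind-touch b (x ∷ k) {c} {l} ((a , g) , p) q (t , e) =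
    (a , λ i → go (∈-++⁻ (k ++ reverse l) i)) , ind-touch x k p q ((λ i → t (there i)) , e)
    where
    away : ∀ {v} → v ∈ c ∷ l → b ⟂ v
    away i = let d , f = t (here refl) i in d , λ z → ind-≢ ((a , g) , p) (lastOf-∈ x k) (proj₁ (f z))
    go : ∀ {v} → v ∈ k ++ reverse l ⊎ v ∈ [ c ] → b ⟂ v
    go (inj₂ (here refl)) = away (here refl)
    go (inj₁ i)           = [ g , (λ j → away (there (reverse⁻ j))) ]′ (∈-++⁻ k i)

  join : ∀ k {c y} k′ {c′} → Ind (y ∷ k ++ [ c ]) → Ind (y ∷ k′ ++ [ c′ ]) → c ∷ k ⟂⟂ k′ ++ [ c′ ] →
         Ind (c ∷ (reverse k ++ y ∷ k′) ++ [ c′ ])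
  join k {c} {y} k′ {c′} p q a =
    subst (λ l → Ind (c ∷ l)) (sym (++-assoc (reverse k) (y ∷ k′) [ c′ ]))
      (glue (c ∷ reverse k) (ind-flip k p) q λ { (here refl) → a (here refl) ; (there i) → a (there (reverse⁻ i)) })

  cross : ∀ {a b k₁ k₂ l₁ l₂} → a ∷ k₁ ⟂⟂ b ∷ k₂ → a ∷ l₁ ⟂⟂ b ∷ l₂ → k₁ ⟂⟂ l₂ → l₁ ⟂⟂ k₂ →
          reverse k₁ ++ a ∷ l₁ ⟂⟂ reverse k₂ ++ b ∷ l₂
  cross {k₁ = k₁} {k₂} p q r s =
    ⟂⟂-++ˡ (reverse k₁)
      (⟂⟂-++ʳ (reverse k₂) (λ i j → p (there (reverse⁻ i)) (there (reverse⁻ j)))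
        (⟂⟂-∷ʳ (λ i → ⟂-sym (p (there (reverse⁻ i)) (here refl))) (λ i j → r (reverse⁻ i) j)))
      (⟂⟂-++ʳ (reverse k₂) (λ { (here refl) j → p (here refl) (there (reverse⁻ j)) ; (there i) j → s i (reverse⁻ j) }) q)

  -- Incompatible configurations on the two sides

  module Clash {A B : Vtx → Set} (sep : ∀ {u v} → A u → B v → u ⟂ v)
    (offA : ∀ {y} → Y y → ¬ A y) (offB : ∀ {y} → Y y → ¬ B y) where

    sep-lists : ∀ {l m} → l ⊂ A → m ⊂ B → l ⟂⟂ m
    sep-lists p q i j = sep (p i) (q j)

    -- The two centres are the ends of a theta whose three paths change sides at `a`, `b` and `c`.
    claw-claw : ∀ {a b c} → Claw A a b c → Claw B a b c → ⊥
    claw-claw C C′ = noTheta (theta (proj₂ (sep C.inD C′.inD)) _ _ _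
      (arm C.k₁ C′.k₁ C.i₁ C′.i₁ C.s₁ C′.s₁) (arm C.k₂ C′.k₂ C.i₂ C′.i₂ C.s₂ C′.s₂) (arm C.k₃ C′.k₃ C.i₃ C′.i₃ C.s₃ C′.s₃)
      (cross C.p₁₂ C′.p₁₂ (sep-lists C.s₁ C′.s₂) (⟂⟂-sym (sep-lists C.s₂ C′.s₁)))
      (cross C.p₁₃ C′.p₁₃ (sep-lists C.s₁ C′.s₃) (⟂⟂-sym (sep-lists C.s₃ C′.s₁)))
      (cross C.p₂₃ C′.p₂₃ (sep-lists C.s₂ C′.s₃) (⟂⟂-sym (sep-lists C.s₃ C′.s₂))))
      where
      module C = Claw C
      module C′ = Claw C′
      arm : ∀ k k′ {y} → Ind (y ∷ k ++ [ C.x ]) → Ind (y ∷ k′ ++ [ C′.x ]) → k ⊂ A → k′ ⊂ B →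
            Ind (C.x ∷ (reverse k ++ y ∷ k′) ++ [ C′.x ])
      arm k k′ p q s s′ = join k k′ p q (sep-lists (⊂-∷ C.inD s) (⊂-++ k′ s′ λ { (here refl) → C′.inD }))

    -- If `a` is adjacent to the centre of the claw, it sees this centre and two nonadjacent
    -- vertices of the other side on a hole through `b` and `c`, so it is a hub. Otherwise the
    -- centre and `a` are the ends of a theta: one path is a leg of the claw, the other two pass
    -- through `b` and `c`.
    claw-mid : ∀ {a b c} → Y a → Y b → Y c → Claw A a b c → Mid B a b c → ⊥
    claw-mid {a} {b} {c} ya yb yc C M with C.x ~? a
      where module C = Claw C
    ... | yes e = noHub a ya (hub (hole (stable _ _ yb yc) q M.p ind-q M.i (sep-lists q⊂A M.s)) off
        (to (inj₂ (∈-++⁺ʳ C.k₂ (here refl)))) (to (inj₁ (there (∈-++⁺ˡ M.f∈)))) (to (inj₁ (there (∈-++⁺ˡ M.g∈))))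
        (~-sym e) M.af M.ag (sep C.inD (M.s M.f∈)) (sep C.inD (M.s M.g∈)) M.fg)
      where
      module C = Claw C
      module M = Mid M
      q : List Vtx
      q = C.k₂ ++ C.x ∷ reverse C.k₃
      q⊂A : q ⊂ A
      q⊂A = ⊂-++ C.k₂ C.s₂ (⊂-∷ C.inD λ i → C.s₃ (reverse⁻ i))
      ind-q : Ind (b ∷ q ++ [ c ])
      ind-q = subst (λ l → Ind (b ∷ l)) (sym (++-assoc C.k₂ (C.x ∷ reverse C.k₃) [ c ]))
        (glue (b ∷ C.k₂) C.i₂ (ind-flip C.k₃ C.i₃)
          (⟂⟂-++ʳ (reverse C.k₃) (λ i j → C.p₂₃ i (there (reverse⁻ j))) λ { i (here refl) → C.p₂₃ i (here refl) }))
      to = toHole (stable _ _ yb yc) q M.p ind-q M.i (sep-lists q⊂A M.s)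
      off : ¬ OnH G (hole (stable _ _ yb yc) q M.p ind-q M.i (sep-lists q⊂A M.s)) a
      off o with onHole (stable _ _ yb yc) q M.p ind-q M.i (sep-lists q⊂A M.s) o
      ... | inj₂ i = offA ya (q⊂A i)
      ... | inj₁ (here refl) = proj₁ (C.p₁₂ (here refl) (here refl)) refl
      ... | inj₁ (there i) with ∈-++⁻ M.p i
      ...   | inj₁ j = offB ya (M.s j)
      ...   | inj₂ (here refl) = proj₁ (C.p₁₃ (here refl) (here refl)) refl
    ... | no ne = noTheta (theta ne _ _ _ (ind-flip C.k₁ C.i₁) (arm C.k₂ M.k₂ C.i₂ M.i₂ M.s₂ C.s₂ C.p₁₂) (arm C.k₃ M.k₃ C.i₃ M.i₃ M.s₃ C.s₃ C.p₁₃)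
        (far₁ C.p₁₂ M.s₂) (far₁ C.p₁₃ M.s₃)
        (cross C.p₂₃ M.p₂₃ (sep-lists C.s₂ M.s₃) (⟂⟂-sym (sep-lists C.s₃ M.s₂))))
      where
      module C = Claw C
      module M = Mid M
      xa : C.x ⟂ a
      xa = (λ { refl → offA ya C.inD }) , ne
      arm : ∀ {y} k k′ → Ind (y ∷ k ++ [ C.x ]) → Ind (y ∷ k′ ++ [ a ]) → k′ ⊂ B → k ⊂ A → a ∷ C.k₁ ⟂⟂ y ∷ k →
            Ind (C.x ∷ (reverse k ++ y ∷ k′) ++ [ a ])
      arm k k′ p q s s₀ t = join k k′ p q (⟂⟂-++ʳ k′ (sep-lists (⊂-∷ C.inD s₀) s)
        λ { (here refl) (here refl) → xa ; (there i) (here refl) → ⟂-sym (t (here refl) (there i)) })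
      far₁ : ∀ {y k k′} → a ∷ C.k₁ ⟂⟂ y ∷ k → k′ ⊂ B → reverse C.k₁ ⟂⟂ reverse k ++ y ∷ k′
      far₁ {k = k} t s i j with ∈-++⁻ (reverse k) j
      ... | inj₁ j′          = t (there (reverse⁻ i)) (there (reverse⁻ j′))
      ... | inj₂ (here refl) = t (there (reverse⁻ i)) (here refl)
      ... | inj₂ (there j′)  = sep (C.s₁ (reverse⁻ i)) (s j′)

    -- The two paths between `b` and `c` form a hole. On it `a` sees two nonadjacent vertices of one
    -- side and a vertex of the other, so `a` is a hub.
    mid-same : ∀ {a b c} → Y a → Y b → Y c → a ≢ b → a ≢ c → Mid A a b c → Mid B a b c → ⊥
    mid-same {a} {b} {c} ya yb yc ab ac M N =
      noHub a ya (hub (hole nbc M.p N.p M.i N.i apart) off (to (inj₁ (there (∈-++⁺ˡ N.f∈)))) (to (inj₂ M.f∈)) (to (inj₂ M.g∈))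
        N.af M.af M.ag (⟂-sym (sep (M.s M.f∈) (N.s N.f∈))) (⟂-sym (sep (M.s M.g∈) (N.s N.f∈))) M.fg)
      where
      module M = Mid M
      module N = Mid N
      nbc = stable _ _ yb yc
      apart = sep-lists M.s N.s
      to = toHole nbc M.p N.p M.i N.i apart
      off : ¬ OnH G (hole nbc M.p N.p M.i N.i apart) a
      off o with onHole nbc M.p N.p M.i N.i apart o
      ... | inj₂ i = offA ya (M.s i)
      ... | inj₁ (here refl) = ab refl
      ... | inj₁ (there i) with ∈-++⁻ N.p i
      ...   | inj₁ j = offB ya (N.s j)
      ...   | inj₂ (here refl) = ac refl

    -- Here `a` and `b` are the ends of a theta: one path in each side, and a third through both
    -- sides that crosses at `c`.
    mid-mid : ∀ {a b c} → Y a → Y b → a ≢ b → Mid A a b c → Mid B b a c → ⊥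
    mid-mid {a} {b} {c} ya yb ab M N =
      noTheta (theta (stable _ _ yb ya) M.k₂ (reverse N.k₂) (reverse N.k₃ ++ c ∷ M.k₃)
        M.i₂ (ind-flip N.k₂ N.i₂)
        (join N.k₃ M.k₃ N.i₃ M.i₃ (⟂⟂-++ʳ M.k₃
          (⟂⟂-∷ˡ (λ j → M.p₂₃ (here refl) (there j)) (⟂⟂-sym (sep-lists M.s₃ N.s₃)))
          λ { (here refl) (here refl) → far yb ya (ab ∘ sym) ; (there i) (here refl) → ⟂-sym (N.p₂₃ (here refl) (there i)) }))
        (⟂⟂-revʳ {M.k₂} (sep-lists M.s₂ N.s₂))
        (⟂⟂-++ʳ (reverse N.k₃) (⟂⟂-revʳ {M.k₂} (sep-lists M.s₂ N.s₃)) λ i j → M.p₂₃ (there i) j)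
        (⟂⟂-revˡ {N.k₂} (⟂⟂-++ʳ (reverse N.k₃) (λ i j → N.p₂₃ (there i) (there (reverse⁻ j)))
          (⟂⟂-∷ʳ (λ i → ⟂-sym (N.p₂₃ (there i) (here refl))) (⟂⟂-sym (sep-lists M.s₃ N.s₂))))))
      where
      module M = Mid M
      module N = Mid N

    -- The two legs at `a` form a rail of a prism, which needs at least one edge; it fails to have
    -- one just when both legs are trivial.
    ends : ∀ a k k′ → (k ≡ [] × k′ ≡ []) ⊎ ∃ λ m → reverse k ++ a ∷ k′ ≡ lastOf a k ∷ m ++ [ lastOf a k′ ]
    ends a k k′ with initLast k | initLast k′
    ... | []       | []        = inj₁ (refl , refl)
    ... | []       | l ∷ʳ′ x   = inj₂ (l , cong (λ z → a ∷ l ++ [ z ]) (sym (lastOf-∷ʳ a l x)))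
    ... | l ∷ʳ′ x  | []        = inj₂ (reverse l ,
          trans (cong (_++ [ a ]) (reverse-++ l [ x ])) (cong (λ z → z ∷ reverse l ++ [ a ]) (sym (lastOf-∷ʳ a l x))))
    ... | l ∷ʳ′ x  | l′ ∷ʳ′ x′ = inj₂ (reverse l ++ a ∷ l′ ,
          trans (cong (_++ a ∷ l′ ++ [ x′ ]) (reverse-++ l [ x ]))
          (trans (cong (x ∷_) (sym (++-assoc (reverse l) (a ∷ l′) [ x′ ])))
          (subst₂ (λ y z → x ∷ (reverse l ++ a ∷ l′) ++ [ x′ ] ≡ y ∷ (reverse l ++ a ∷ l′) ++ [ z ])
            (sym (lastOf-∷ʳ a l x)) (sym (lastOf-∷ʳ a l′ x′)) refl)))

    -- With both legs trivial, `a` sees the two ends of an edge in each side. All four lie on the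
    -- hole formed by the legs of `b` and `c`. No three of them are pairwise nonadjacent, so the
    -- count of four is used.
    tri-trivial : ∀ {a b c} → Y a → Y b → Y c → a ≢ b → a ≢ c → (T : Tri A a b c) (T′ : Tri B a b c) →
                  Tri.k₁ T ≡ [] → Tri.k₁ T′ ≡ [] → ⊥
    tri-trivial {a} {b} {c} ya yb yc ab ac T T′ e e′ =
      noHub a ya (hub₄ (hole nbc p p′ ip ip′ apart) off (to (inj₂ t₂)) (to (inj₂ t₃)) (to (inj₁ (there (∈-++⁺ˡ t₂′)))) (to (inj₁ (there (∈-++⁺ˡ t₃′))))
        (adj T e (proj₂ T.t₁₂)) (adj T e (proj₂ T.t₁₃)) (adj T′ e′ (proj₂ T′.t₁₂)) (adj T′ e′ (proj₂ T′.t₁₃))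
        ((~⇒≢ (proj₂ T.t₂₃) , proj₁ (apart t₂ t₂′) , proj₁ (apart t₂ t₃′) , tt) ,
         (proj₁ (apart t₃ t₂′) , proj₁ (apart t₃ t₃′) , tt) , (~⇒≢ (proj₂ T′.t₂₃) , tt) , tt , tt))
      where
      module T = Tri T
      module T′ = Tri T′
      nbc = stable _ _ yb yc
      p p′ : List Vtx
      p  = T.k₂ ++ reverse T.k₃
      p′ = T′.k₂ ++ reverse T′.k₃
      ip  = ind-touch b T.k₂ T.i₂ T.i₃ T.t₂₃
      ip′ = ind-touch b T′.k₂ T′.i₂ T′.i₃ T′.t₂₃
      p⊂A : p ⊂ A
      p⊂A = ⊂-++ T.k₂ T.s₂ λ i → T.s₃ (reverse⁻ i)
      p⊂B : p′ ⊂ B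
      p⊂B = ⊂-++ T′.k₂ T′.s₂ λ i → T′.s₃ (reverse⁻ i)
      apart = sep-lists p⊂A p⊂B
      to = toHole nbc p p′ ip ip′ apart
      adj : ∀ {D} (S : Tri D a b c) {u} → Tri.k₁ S ≡ [] → lastOf a (Tri.k₁ S) ~ u → a ~ u
      adj S {u} e z = subst (λ k → lastOf a k ~ u) e z
      inner : ∀ {y} k {l} → Y y → a ~ lastOf y k → (k ⊂ λ v → v ∈ l) → lastOf y k ∈ l
      inner []      yy z f = ⊥-elim (stable _ _ ya yy z)
      inner (x ∷ k) yy z f = f (lastOf-∈ x k)
      t₂ = inner T.k₂ {p} yb (adj T e (proj₂ T.t₁₂)) ∈-++⁺ˡ
      t₃ = inner T.k₃ {p} yc (adj T e (proj₂ T.t₁₃)) λ i → ∈-++⁺ʳ T.k₂ (reverse⁺ i)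
      t₂′ = inner T′.k₂ {p′} yb (adj T′ e′ (proj₂ T′.t₁₂)) ∈-++⁺ˡ
      t₃′ = inner T′.k₃ {p′} yc (adj T′ e′ (proj₂ T′.t₁₃)) λ i → ∈-++⁺ʳ T′.k₂ (reverse⁺ i)
      off : ¬ OnH G (hole nbc p p′ ip ip′ apart) a
      off o with onHole nbc p p′ ip ip′ apart o
      ... | inj₂ i = offA ya (p⊂A i)
      ... | inj₁ (here refl) = ab refl
      ... | inj₁ (there i) with ∈-++⁻ p′ i
      ...   | inj₁ j = offB ya (p⊂B j)
      ...   | inj₂ (here refl) = ac refl

    rail : ∀ a k k′ → Ind (a ∷ k) → Ind (a ∷ k′) → k ⊂ A → k′ ⊂ B → Ind (reverse k ++ a ∷ k′)
    rail a k k′ p q s s′ = glue (reverse k) (subst Ind (unfold-reverse a k) (ind-reverse (a ∷ k) p)) q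
      (⟂⟂-revˡ (sep-lists s s′))

    rails : ∀ {a b k k′ l l′} → k ⊂ A → l ⊂ A → k′ ⊂ B → l′ ⊂ B → Touch a k b l → Touch a k′ b l′ →
            Joined (lastOf a k) (lastOf a k′) (reverse k ++ a ∷ k′) (lastOf b l) (lastOf b l′) (reverse l ++ b ∷ l′)
    rails {a} {b} {k} {k′} {l} {l′} sk sl sk′ sl′ (t , e) (t′ , e′) = (λ i j → go (split k i) (split l j)) , e , e′
      where
      split : ∀ {y u} m {m′} → u ∈ reverse m ++ y ∷ m′ → u ∈ y ∷ m ⊎ u ∈ m′
      split m i with ∈-++⁻ (reverse m) i
      ... | inj₁ j           = inj₁ (there (reverse⁻ j))
      ... | inj₂ (here refl) = inj₁ (here refl)
      ... | inj₂ (there j)   = inj₂ j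
      go : ∀ {u v} → u ∈ a ∷ k ⊎ u ∈ k′ → v ∈ b ∷ l ⊎ v ∈ l′ →
           u ≢ v × (u ~ v → (u ≡ lastOf a k × v ≡ lastOf b l) ⊎ (u ≡ lastOf a k′ × v ≡ lastOf b l′))
      go (inj₁ i)           (inj₁ j)           = let d , f = t i j in d , inj₁ ∘ f
      go (inj₂ i)           (inj₂ j)           = let d , f = t′ (there i) (there j) in d , inj₂ ∘ f
      go (inj₁ (here refl)) (inj₂ j)           = let d , f = t′ (here refl) (there j) in d , inj₂ ∘ f
      go (inj₁ (there i))   (inj₂ j)           = ⟂⇒ (sep (sk i) (sl′ j))
      go (inj₂ i)           (inj₁ (here refl)) = let d , f = t′ (there i) (here refl) in d , inj₂ ∘ f
      go (inj₂ i)           (inj₁ (there j))   = ⟂⇒ (⟂-sym (sep (sl j) (sk′ i)))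

    tri-tri : ∀ {a b c} → Y a → Y b → Y c → a ≢ b → a ≢ c → b ≢ c → Tri A a b c → Tri B a b c → ⊥
    tri-tri {a} {b} {c} ya yb yc ab ac bc T T′
      with ends a (Tri.k₁ T) (Tri.k₁ T′) | ends b (Tri.k₂ T) (Tri.k₂ T′) | ends c (Tri.k₃ T) (Tri.k₃ T′)
    ... | inj₁ (e , e′) | _ | _ = tri-trivial ya yb yc ab ac T T′ e e′
    ... | _ | inj₁ (e , e′) | _ = tri-trivial yb ya yc (ab ∘ sym) bc (tri₁₂ T) (tri₁₂ T′) e e′
    ... | _ | _ | inj₁ (e , e′) = tri-trivial yc ya yb (ac ∘ sym) (bc ∘ sym) (tri₁₂ (tri₂₃ T)) (tri₁₂ (tri₂₃ T′)) e e′
    ... | inj₂ (m₁ , e₁) | inj₂ (m₂ , e₂) | inj₂ (m₃ , e₃) = noPrism (prism m₁ m₂ m₃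
        (subst Ind e₁ (rail a T.k₁ T′.k₁ T.i₁ T′.i₁ T.s₁ T′.s₁))
        (subst Ind e₂ (rail b T.k₂ T′.k₂ T.i₂ T′.i₂ T.s₂ T′.s₂))
        (subst Ind e₃ (rail c T.k₃ T′.k₃ T.i₃ T′.i₃ T.s₃ T′.s₃))
        (subst₂ (λ l l′ → Joined _ _ l _ _ l′) e₁ e₂ (rails T.s₁ T.s₂ T′.s₁ T′.s₂ T.t₁₂ T′.t₁₂))
        (subst₂ (λ l l′ → Joined _ _ l _ _ l′) e₁ e₃ (rails T.s₁ T.s₃ T′.s₁ T′.s₃ T.t₁₃ T′.t₁₃))
        (subst₂ (λ l l′ → Joined _ _ l _ _ l′) e₂ e₃ (rails T.s₂ T.s₃ T′.s₂ T′.s₃ T.t₂₃ T′.t₂₃)))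
      where
      module T = Tri T
      module T′ = Tri T′

  module _ {A B : Vtx → Set} (sep : ∀ {u v} → A u → B v → u ⟂ v)
    (offA : ∀ {y} → Y y → ¬ A y) (offB : ∀ {y} → Y y → ¬ B y)
    {a b c : Vtx} (ya : Y a) (yb : Y b) (yc : Y c) (ab : a ≢ b) (ac : a ≢ c) (bc : b ≢ c) where

    private
      module AB = Clash sep offA offB
      module BA = Clash (λ p q → ⟂-sym (sep q p)) offB offA

    star-star : Star A a b c → Star B a b c → ⊥
    star-star (inj₁ C)               (inj₁ D)               = AB.claw-claw C D
    star-star (inj₁ C)               (inj₂ (inj₁ D))        = AB.claw-mid ya yb yc C D
    star-star (inj₁ C)               (inj₂ (inj₂ (inj₁ D))) = AB.claw-mid yb ya yc (claw₁₂ C) D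
    star-star (inj₁ C)               (inj₂ (inj₂ (inj₂ D))) = AB.claw-mid yc ya yb (claw₁₂ (claw₂₃ C)) D
    star-star (inj₂ (inj₁ C))        (inj₁ D)               = BA.claw-mid ya yb yc D C
    star-star (inj₂ (inj₂ (inj₁ C))) (inj₁ D)               = BA.claw-mid yb ya yc (claw₁₂ D) C
    star-star (inj₂ (inj₂ (inj₂ C))) (inj₁ D)               = BA.claw-mid yc ya yb (claw₁₂ (claw₂₃ D)) C
    star-star (inj₂ (inj₁ C))        (inj₂ (inj₁ D))        = AB.mid-same ya yb yc ab ac C D
    star-star (inj₂ (inj₂ (inj₁ C))) (inj₂ (inj₂ (inj₁ D))) = AB.mid-same yb ya yc (ab ∘ sym) bc C D
    star-star (inj₂ (inj₂ (inj₂ C))) (inj₂ (inj₂ (inj₂ D))) = AB.mid-same yc ya yb (ac ∘ sym) (bc ∘ sym) C D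
    star-star (inj₂ (inj₁ C))        (inj₂ (inj₂ (inj₁ D))) = AB.mid-mid ya yb ab C D
    star-star (inj₂ (inj₁ C))        (inj₂ (inj₂ (inj₂ D))) = AB.mid-mid ya yc ac (mid₂₃ C) D
    star-star (inj₂ (inj₂ (inj₁ C))) (inj₂ (inj₁ D))        = AB.mid-mid yb ya (ab ∘ sym) C D
    star-star (inj₂ (inj₂ (inj₁ C))) (inj₂ (inj₂ (inj₂ D))) = AB.mid-mid yb yc bc (mid₂₃ C) (mid₂₃ D)
    star-star (inj₂ (inj₂ (inj₂ C))) (inj₂ (inj₁ D))        = AB.mid-mid yc ya (ac ∘ sym) C (mid₂₃ D)
    star-star (inj₂ (inj₂ (inj₂ C))) (inj₂ (inj₂ (inj₁ D))) = AB.mid-mid yc yb (bc ∘ sym) (mid₂₃ C) (mid₂₃ D)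

  -- Every side contains a claw, a middle vertex or a triangle

  infix 4 _≁_

  _≁_ : Vtx → List Vtx → Set
  y ≁ l = ∀ {v} → v ∈ l → ¬ y ~ v

  -- Only the outermost neighbours matter. In `spread` the entry `x` between them forces them to be
  -- nonadjacent on an induced path, whatever `y` sees in between.
  data Meet (y : Vtx) : List Vtx → Set where
    uniq   : ∀ l₀ z l₁ → y ~ z → y ≁ l₀ → y ≁ l₁ → Meet y (l₀ ++ z ∷ l₁)
    pair   : ∀ l₀ z z′ l₁ → y ~ z → y ~ z′ → y ≁ l₀ → y ≁ l₁ → Meet y (l₀ ++ z ∷ z′ ∷ l₁)
    spread : ∀ l₀ z x m z′ l₁ → y ~ z → y ~ z′ → y ≁ l₀ → y ≁ l₁ → Meet y (l₀ ++ z ∷ x ∷ m ++ z′ ∷ l₁)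

  classify : ∀ y p → y ≁ p ⊎ Meet y p
  classify y p with first (y ~?_) p
  ... | inj₁ none = inj₁ none
  ... | inj₂ (cut {pre = l₀} {z} {l} refl e , n₀) with last (y ~?_) l
  ...   | inj₁ n₁ = inj₂ (uniq l₀ z l e n₀ n₁)
  ...   | inj₂ (cut {pre = []}    {z′} {l₁} refl e′ , n₁) = inj₂ (pair l₀ z z′ l₁ e e′ n₀ n₁)
  ...   | inj₂ (cut {pre = x ∷ m} {z′} {l₁} refl e′ , n₁) = inj₂ (spread l₀ z x m z′ l₁ e e′ n₀ n₁)

  halves : ∀ {a z b} l₀ {l₁} → Ind (a ∷ (l₀ ++ z ∷ l₁) ++ [ b ]) →
           Ind (a ∷ l₀ ++ [ z ]) × Ind (z ∷ l₁ ++ [ b ]) × a ∷ l₀ ⟂⟂ l₁ ++ [ b ]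
  halves {a} {z} {b} l₀ {l₁} p = ind-++ˡ (a ∷ l₀ ++ [ z ]) (subst Ind (sym (++-assoc (a ∷ l₀) [ z ] (l₁ ++ [ b ]))) q) ,
    ind-++ʳ (a ∷ l₀) q , ind-apart (a ∷ l₀) q
    where
    q : Ind ((a ∷ l₀) ++ z ∷ l₁ ++ [ b ])
    q = subst Ind (++-assoc (a ∷ l₀) (z ∷ l₁) [ b ]) p

  spoke : ∀ {a z r} l → Ind (a ∷ l ++ [ z ]) → z ~ r → (∀ {u} → u ∈ a ∷ l → u ⟂ r) → Ind (a ∷ (l ++ [ z ]) ++ [ r ])
  spoke {a} {z} {r} l p e n = subst Ind (sym (++-assoc (a ∷ l) [ z ] [ r ]))
    (glue (a ∷ l) p ((e , λ ()) , tt , tt) λ { i (here refl) → n i })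

  Outcome : (Vtx → Set) → Vtx → Vtx → Vtx → Set
  Outcome D a b c = Tri D a b c ⊎ Star D a b c

  outcome₁₂ : ∀ {D a b c} → Outcome D a b c → Outcome D b a c
  outcome₁₂ = Sum.map tri₁₂ star₁₂

  outcome₂₃ : ∀ {D a b c} → Outcome D a b c → Outcome D a c b
  outcome₂₃ = Sum.map tri₂₃ star₂₃

  module _ {Z D : Vtx → Set} (side : Side Z D) where
    open Side side

    D≢Y : ∀ {u v} → D u → Y v → u ≢ v
    D≢Y d y refl = off y d

    through : ∀ {a b} → Y a → Y b → Z a → Z b → a ≢ b → ∃ λ p → p ⊂ D × Ind (a ∷ p ++ [ b ])
    through ya yb za zb ab with att za | att zb
    ... | d , dd , e | d′ , dd′ , e′
      with path ab (step (inj₂ (inj₁ refl)) e (walk-snoc (walk-map inj₁ (conn dd dd′)) (~-sym e′) (inj₂ (inj₂ refl))))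
    ...   | p , i , s = p , s , i

    module Attach {a b y : Vtx} {K : List Vtx} (K⊂D : K ⊂ D) (indK : Ind (y ∷ K))
      (Ka : ∀ {u} → u ∈ y ∷ K → u ⟂ a) (Kb : ∀ {u} → u ∈ y ∷ K → u ⟂ b) where

      private
        r : Vtx
        r = lastOf y K

        r∈ : r ∈ y ∷ K
        r∈ = lastOf-∈ y K

        Apart : List Vtx → Set
        Apart p = ∀ {u v} → u ∈ y ∷ K → v ∈ p → u ≢ v × (u ~ v → u ≡ r)

        none : ∀ {p l} → Apart p → (l ⊂ λ v → v ∈ p) → r ≁ l → l ⟂⟂ y ∷ K
        none A s n j i = let d , f = A i (s j) in d ∘ sym , λ z → n j (subst (_~ _) (f (~-sym z)) (~-sym z))

        ∷-left : ∀ {l} → l ⟂⟂ y ∷ K → a ∷ l ⟂⟂ y ∷ K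
        ∷-left = ⟂⟂-∷ˡ (λ i → ⟂-sym (Ka i))

        ∷-right : ∀ {l} → l ⟂⟂ y ∷ K → b ∷ reverse l ⟂⟂ y ∷ K
        ∷-right p = ⟂⟂-∷ˡ (λ i → ⟂-sym (Kb i)) (⟂⟂-revˡ p)

      -- For nontrivial `K` its last vertex `r` lies in `D` and is the centre of a claw. For trivial
      -- `K` it is `y` itself, outside `D`, and one obtains a `Mid` around `y` instead.
      spread-outcome : ∀ l₀ z x m z′ l₁ → r ~ z → r ~ z′ → r ≁ l₀ → r ≁ l₁ → let p = l₀ ++ z ∷ x ∷ m ++ z′ ∷ l₁ in
                       p ⊂ D → Ind (a ∷ p ++ [ b ]) → Apart p → Claw D a b y ⊎ Mid D y a b
      spread-outcome l₀ z x m z′ l₁ e e′ n₀ n₁ s ip A = go K refl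
        where
        p = l₀ ++ z ∷ x ∷ m ++ z′ ∷ l₁
        h = halves l₀ ip
        h′ = halves (x ∷ m) (proj₁ (proj₂ h))
        z∈ : z ∈ p
        z∈ = ∈-++⁺ʳ l₀ (here refl)
        z′∈m : z′ ∈ m ++ z′ ∷ l₁
        z′∈m = ∈-++⁺ʳ m (here refl)
        z′∈ : z′ ∈ p
        z′∈ = ∈-++⁺ʳ l₀ (there (there z′∈m))
        l₁∈m : ∀ {v} → v ∈ l₁ → v ∈ m ++ z′ ∷ l₁
        l₁∈m j = ∈-++⁺ʳ m (there j)
        l₁∈ : ∀ {v} → v ∈ l₁ → v ∈ p
        l₁∈ j = ∈-++⁺ʳ l₀ (there (there (l₁∈m j)))
        zz′ : z ⟂ z′
        zz′ = proj₂ (proj₁ (proj₁ (proj₂ h))) (∈-++⁺ˡ z′∈m)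
        N₀ = ∷-left (none A ∈-++⁺ˡ n₀)
        N₁ = ∷-right (none A l₁∈ n₁)
        k₁ k₂ : List Vtx
        k₁ = l₀ ++ [ z ]
        k₂ = reverse l₁ ++ [ z′ ]
        s₁ : k₁ ⊂ D
        s₁ = ⊂-++ l₀ (s ∘ ∈-++⁺ˡ) λ { (here refl) → s z∈ }
        s₂ : k₂ ⊂ D
        s₂ = ⊂-++ (reverse l₁) (λ i → s (l₁∈ (reverse⁻ i))) λ { (here refl) → s z′∈ }
        i₁ : Ind (a ∷ k₁ ++ [ r ])
        i₁ = spoke l₀ (proj₁ h) (~-sym e) λ i → N₀ i r∈
        i₂ : Ind (b ∷ k₂ ++ [ r ])
        i₂ = spoke (reverse l₁) (ind-flip l₁ (proj₁ (proj₂ h′))) (~-sym e′) λ i → N₁ i r∈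
        A₀ : a ∷ l₀ ⟂⟂ b ∷ k₂
        A₀ i (here refl) = proj₂ (proj₂ h) i (∈-++⁺ʳ (x ∷ m ++ z′ ∷ l₁) (here refl))
        A₀ i (there j) with ∈-++⁻ (reverse l₁) j
        ... | inj₁ j′          = proj₂ (proj₂ h) i (there (∈-++⁺ˡ (l₁∈m (reverse⁻ j′))))
        ... | inj₂ (here refl) = proj₂ (proj₂ h) i (there (∈-++⁺ˡ z′∈m))
        Az : z ⟂* b ∷ k₂
        Az (here refl) = proj₂ (proj₂ h′) (here refl) (∈-++⁺ʳ l₁ (here refl))
        Az (there j) with ∈-++⁻ (reverse l₁) j
        ... | inj₁ j′          = proj₂ (proj₂ h′) (here refl) (∈-++⁺ˡ {xs = l₁} (reverse⁻ {xs = l₁} j′))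
        ... | inj₂ (here refl) = zz′
        p₁₂ : a ∷ k₁ ⟂⟂ b ∷ k₂
        p₁₂ = ⟂⟂-++ˡ (a ∷ l₀) A₀ λ { (here refl) → Az }
        go : ∀ K′ → K ≡ K′ → Claw D a b y ⊎ Mid D y a b
        go K′ eq with initLast K′
        go _ refl | [] = inj₂ (record { k₂ = k₁ ; k₃ = k₂ ; p = p ; s₂ = s₁ ; s₃ = s₂ ; s = s ; i₂ = i₁ ; i₃ = i₂ ; p₂₃ = p₁₂
                                      ; i = ip ; f∈ = z∈ ; g∈ = z′∈ ; af = e ; ag = e′ ; fg = zz′ })
        go _ refl | K₀ ∷ʳ′ x′ = inj₁ (record { inD = subst D (sym r≡) (K⊂D (∈-++⁺ʳ K₀ (here refl)))
                                      ; k₁ = k₁ ; k₂ = k₂ ; k₃ = K₀ ; s₁ = s₁ ; s₂ = s₂ ; s₃ = K⊂D ∘ ∈-++⁺ˡ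
                                      ; i₁ = i₁ ; i₂ = i₂ ; i₃ = subst (λ w → Ind (y ∷ K₀ ++ [ w ])) (sym r≡) indK ; p₁₂ = p₁₂
                                      ; p₁₃ = ⟂⟂-++ˡ (a ∷ l₀) (λ i j → N₀ i (∈-++⁺ˡ j)) (λ { (here refl) → low z∈ })
                                      ; p₂₃ = ⟂⟂-++ˡ (b ∷ reverse l₁) (λ i j → N₁ i (∈-++⁺ˡ j)) (λ { (here refl) → low z′∈ }) })
          where
          r≡ : r ≡ x′
          r≡ = lastOf-∷ʳ y K₀ x′
          low : ∀ {v} → v ∈ p → v ⟂* y ∷ K₀
          low j i = let d , f = A (∈-++⁺ˡ i) j in d ∘ sym , λ w → ind-≢ʳ (y ∷ K₀) indK i (trans (f (~-sym w)) r≡)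

      attach-uniq : ∀ l₀ z l₁ → r ~ z → r ≁ l₀ → r ≁ l₁ → let p = l₀ ++ z ∷ l₁ in
                    p ⊂ D → Ind (a ∷ p ++ [ b ]) → Apart p → Claw D a b y
      attach-uniq l₀ z l₁ e n₀ n₁ s ip A =
        record
          { inD = s z∈ ; k₁ = l₀ ; k₂ = reverse l₁ ; k₃ = K
          ; s₁ = s ∘ ∈-++⁺ˡ ; s₂ = λ i → s (l₁∈ (reverse⁻ i)) ; s₃ = K⊂D
          ; i₁ = proj₁ h ; i₂ = ind-flip l₁ (proj₁ (proj₂ h))
          ; i₃ = ind-∷ʳ y K indK e λ i → A i z∈
          ; p₁₂ = λ { i (here refl) → proj₂ (proj₂ h) i (∈-++⁺ʳ l₁ (here refl))
                    ; i (there j) → proj₂ (proj₂ h) i (∈-++⁺ˡ {xs = l₁} (reverse⁻ {xs = l₁} j)) }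
          ; p₁₃ = ∷-left (none A ∈-++⁺ˡ n₀) ; p₂₃ = ∷-right (none A l₁∈ n₁) }
        where
        h = halves l₀ ip
        z∈ : z ∈ l₀ ++ z ∷ l₁
        z∈ = ∈-++⁺ʳ l₀ (here refl)
        l₁∈ : ∀ {v} → v ∈ l₁ → v ∈ l₀ ++ z ∷ l₁
        l₁∈ j = ∈-++⁺ʳ l₀ (there j)
      attach-pair : ∀ l₀ z z′ l₁ → r ~ z → r ~ z′ → r ≁ l₀ → r ≁ l₁ → let p = l₀ ++ z ∷ z′ ∷ l₁ in
                    p ⊂ D → Ind (a ∷ p ++ [ b ]) → Apart p → Tri D a b y
      attach-pair l₀ z z′ l₁ e e′ n₀ n₁ s ip A =
        record
          { k₁ = l₀ ++ [ z ] ; k₂ = reverse l₁ ++ [ z′ ] ; k₃ = K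
          ; s₁ = ⊂-++ l₀ (s ∘ ∈-++⁺ˡ) (λ { (here refl) → s z∈ })
          ; s₂ = ⊂-++ (reverse l₁) (λ i → s (l₁∈ (reverse⁻ i))) (λ { (here refl) → s z′∈ }) ; s₃ = K⊂D
          ; i₁ = proj₁ h ; i₂ = i₂ ; i₃ = indK
          ; t₁₂ = t₁₂ ; t₁₃ = t₁₃ ; t₂₃ = t₂₃ }
        where
        h = halves l₀ ip
        iz : Ind (z ∷ z′ ∷ l₁ ++ [ b ])
        iz = proj₁ (proj₂ h)
        i₂ : Ind (b ∷ reverse l₁ ++ [ z′ ])
        i₂ = ind-flip l₁ (proj₂ iz)
        z∈ : z ∈ l₀ ++ z ∷ z′ ∷ l₁
        z∈ = ∈-++⁺ʳ l₀ (here refl)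
        z′∈ : z′ ∈ l₀ ++ z ∷ z′ ∷ l₁
        z′∈ = ∈-++⁺ʳ l₀ (there (here refl))
        l₁∈ : ∀ {v} → v ∈ l₁ → v ∈ l₀ ++ z ∷ z′ ∷ l₁
        l₁∈ j = ∈-++⁺ʳ l₀ (there (there j))
        flip∈ : ∀ {v} → v ∈ b ∷ reverse l₁ ++ [ z′ ] → v ∈ l₁ ++ [ b ] ⊎ v ≡ z′
        flip∈ (here refl) = inj₁ (∈-++⁺ʳ l₁ (here refl))
        flip∈ (there j) with ∈-++⁻ (reverse l₁) j
        ... | inj₁ k          = inj₁ (∈-++⁺ˡ {xs = l₁} (reverse⁻ {xs = l₁} k))
        ... | inj₂ (here refl) = inj₂ refl
        t₁₂ : Touch a (l₀ ++ [ z ]) b (reverse l₁ ++ [ z′ ])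
        t₁₂ rewrite lastOf-∷ʳ a l₀ z | lastOf-∷ʳ b (reverse l₁) z′ = (λ i j → go (∈-++⁻ (a ∷ l₀) i) (flip∈ j)) , proj₁ (proj₁ iz)
          where
          go : ∀ {u v} → u ∈ a ∷ l₀ ⊎ u ∈ [ z ] → v ∈ l₁ ++ [ b ] ⊎ v ≡ z′ → u ≢ v × (u ~ v → u ≡ z × v ≡ z′)
          go (inj₁ i)           (inj₁ j)    = ⟂⇒ (proj₂ (proj₂ h) i (there j))
          go (inj₁ i)           (inj₂ refl) = ⟂⇒ (proj₂ (proj₂ h) i (here refl))
          go (inj₂ (here refl)) (inj₁ j)    = ⟂⇒ (proj₂ (proj₁ iz) j)
          go (inj₂ (here refl)) (inj₂ refl) = ~⇒≢ (proj₁ (proj₁ iz)) , λ _ → refl , refl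
        top : ∀ {u v} → u ∈ y ∷ K → v ∈ l₀ ++ z ∷ z′ ∷ l₁ → v ≢ u × (v ~ u → v ≡ v × u ≡ r)
        top i j = let d , f = A i j in d ∘ sym , λ w → refl , f (~-sym w)
        t₁₃ : Touch a (l₀ ++ [ z ]) y K
        t₁₃ rewrite lastOf-∷ʳ a l₀ z = (λ i j → go (∈-++⁻ (a ∷ l₀) i) j) , ~-sym e
          where
          go : ∀ {u v} → u ∈ a ∷ l₀ ⊎ u ∈ [ z ] → v ∈ y ∷ K → u ≢ v × (u ~ v → u ≡ z × v ≡ r)
          go (inj₁ i)           j = ⟂⇒ (∷-left (none A ∈-++⁺ˡ n₀) i j)
          go (inj₂ (here refl)) j = top j z∈
        t₂₃ : Touch b (reverse l₁ ++ [ z′ ]) y K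
        t₂₃ rewrite lastOf-∷ʳ b (reverse l₁) z′ = (λ i j → go (∈-++⁻ (b ∷ reverse l₁) i) j) , ~-sym e′
          where
          go : ∀ {u v} → u ∈ b ∷ reverse l₁ ⊎ u ∈ [ z′ ] → v ∈ y ∷ K → u ≢ v × (u ~ v → u ≡ z′ × v ≡ r)
          go (inj₁ i)           j = ⟂⇒ (∷-right (none A l₁∈ n₁) i j)
          go (inj₂ (here refl)) j = top j z′∈

      attach : ∀ {p} → Meet r p → p ⊂ D → Ind (a ∷ p ++ [ b ]) → Apart p → Outcome D a b y
      attach (uniq l₀ z l₁ e n₀ n₁)       s ip A = inj₂ (inj₁ (attach-uniq l₀ z l₁ e n₀ n₁ s ip A))
      attach (pair l₀ z z′ l₁ e e′ n₀ n₁) s ip A = inj₁ (attach-pair l₀ z z′ l₁ e e′ n₀ n₁ s ip A)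
      attach (spread l₀ z x m z′ l₁ e e′ n₀ n₁) s ip A with spread-outcome l₀ z x m z′ l₁ e e′ n₀ n₁ s ip A
      ... | inj₁ C = inj₂ (inj₁ C)
      ... | inj₂ M = inj₂ (inj₂ (inj₂ (inj₂ M)))

    onPath : ∀ {a b y p} → y ⟂ a → y ⟂ b → Y y → p ⊂ D → Ind (a ∷ p ++ [ b ]) → Meet y p → Outcome D a b y
    onPath ya yb yy s ip M = Attach.attach (λ ()) (tt , tt) (λ { (here refl) → ya }) (λ { (here refl) → yb }) M s ip
      λ { (here refl) j → (λ { refl → off yy (s j) }) , λ _ → refl }

    module _ {a b c : Vtx} (ya : Y a) (yb : Y b) (yc : Y c) (ab : a ≢ b) (ac : a ≢ c) (bc : b ≢ c) where

      private
        meets : ∀ y {p g} → g ∈ p → y ~ g → Meet y p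
        meets y {p} i e with classify y p
        ... | inj₁ n = ⊥-elim (n i e)
        ... | inj₂ M = M

        head∈ : ∀ {g : Vtx} {l} m {h m′} → g ∷ l ≡ m ++ h ∷ m′ → g ∈ m ++ [ h ]
        head∈ []      refl = here refl
        head∈ (x ∷ m) refl = here refl

      -- K leads from c to p, and a has a neighbour on K: replace the path from a to b by one from c to b.
      reroute : ∀ {p K₀ r K₁ g K₂ z₀} → p ⊂ D → Ind (p ++ [ b ]) → K₀ ++ [ r ] ⊂ D → Ind (c ∷ K₀ ++ [ r ]) →
                c ∷ K₀ ⟂⟂ p → ¬ r ∈ p → z₀ ∈ p → r ~ z₀ → K₀ ++ [ r ] ≡ K₁ ++ g ∷ K₂ → b ≁ K₁ → a ~ g →
                Outcome D c b a
      reroute {p} {K₀} {r} {K₁} {g} {K₂} s ip sK iK K⟂p r∉p z₀∈ f₀ eq nK₁ e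
        with first (b ~?_) (g ∷ K₂) | last (r ~?_) p
      ... | _         | inj₁ no-r = ⊥-elim (no-r z₀∈ f₀)
      ... | inj₁ none | inj₂ (cut {pre = l₀} {z} {l₁} refl f , n₁) =
        onPath (far ya yc ac) (far ya yb ab) ya s′ ip′ (meets a (∈-++⁺ˡ (subst (g ∈_) (sym eq) (∈-++⁺ʳ K₁ (here refl)))) e)
        where
        q : List Vtx
        q = (K₀ ++ [ r ]) ++ z ∷ l₁
        s′ : q ⊂ D
        s′ = ⊂-++ (K₀ ++ [ r ]) sK λ i → s (∈-++⁺ʳ l₀ i)
        b≁K : b ≁ K₁ ++ g ∷ K₂
        b≁K i = [ nK₁ , none ]′ (∈-++⁻ K₁ i)
        b⟂ : ∀ {v} → v ∈ c ∷ K₀ ++ [ r ] → v ⟂ b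
        b⟂ (here refl) = far yc yb (bc ∘ sym)
        b⟂ (there i)   = D≢Y (sK i) yb , λ w → b≁K (subst (_ ∈_) eq i) (~-sym w)
        tail : Ind (z ∷ l₁ ++ [ b ])
        tail = ind-++ʳ l₀ (subst Ind (++-assoc l₀ (z ∷ l₁) [ b ]) ip)
        reassoc : K₀ ++ r ∷ z ∷ l₁ ++ [ b ] ≡ q ++ [ b ]
        reassoc = sym (trans (++-assoc (K₀ ++ [ r ]) (z ∷ l₁) [ b ]) (++-assoc K₀ [ r ] (z ∷ l₁ ++ [ b ])))
        ip′ : Ind (c ∷ q ++ [ b ])
        ip′ = subst (λ l → Ind (c ∷ l)) reassoc
          (bridge (c ∷ K₀) iK tail f
            (⟂*-++ l₁ (λ i → (λ { refl → r∉p (∈-++⁺ʳ l₀ (there i)) }) , n₁ i) λ { (here refl) → b⟂ (there (∈-++⁺ʳ K₀ (here refl))) })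
            (⟂⟂-++ʳ (z ∷ l₁) (λ i j → K⟂p i (∈-++⁺ʳ l₀ j))
              λ { (here refl) (here refl) → b⟂ (here refl) ; (there i) (here refl) → b⟂ (there (∈-++⁺ˡ i)) }))
      -- Here `b` has a neighbour `h` on `K`, not before `g`. The new path stops at `h` and still
      -- contains the neighbour `g` of `a`.
      ... | inj₂ (cut {pre = M₁} {h} {M₂} eq′ f , n) | _ =
        onPath (far ya yc ac) (far ya yb ab) ya s′ ip′ (meets a (subst (g ∈_) reassoc (∈-++⁺ʳ K₁ (head∈ M₁ eq′))) e)
        where
        q : List Vtx
        q = (K₁ ++ M₁) ++ [ h ]
        reassoc : K₁ ++ M₁ ++ [ h ] ≡ q
        reassoc = sym (++-assoc K₁ M₁ [ h ])
        whole : K₀ ++ [ r ] ≡ q ++ M₂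
        whole = trans eq (trans (cong (K₁ ++_) eq′) (sym (trans (++-assoc (K₁ ++ M₁) [ h ] M₂) (++-assoc K₁ M₁ (h ∷ M₂)))))
        s′ : q ⊂ D
        s′ i = sK (subst (_ ∈_) (sym whole) (∈-++⁺ˡ i))
        b⟂ : ∀ {v} → v ∈ c ∷ K₁ ++ M₁ → v ⟂ b
        b⟂ (here refl) = far yc yb (bc ∘ sym)
        b⟂ (there i)   = D≢Y (s′ (∈-++⁺ˡ i)) yb , λ w → [ nK₁ , n ]′ (∈-++⁻ K₁ i) (~-sym w)
        ip′ : Ind (c ∷ q ++ [ b ])
        ip′ = spoke (K₁ ++ M₁) (ind-++ˡ (c ∷ q) (subst (λ l → Ind (c ∷ l)) whole iK)) (~-sym f) b⟂

    -- A path from `c` is stopped at its first contact with a path between `a` and `b`. If neither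
    -- `a` nor `b` has a neighbour on it, it is a leg attached to that path. Otherwise the roles are
    -- exchanged: the one with the earliest such neighbour is attached directly to a path between
    -- `c` and the third vertex.
    connect3 : ∀ {a b c} → Y a → Y b → Y c → Z a → Z b → Z c → a ≢ b → a ≢ c → b ≢ c → Outcome D a b c
    connect3 {a} {b} {c} ya yb yc za zb zc ab ac bc = go p s ip
      where
      p₀ = through ya yb za zb ab
      p = proj₁ p₀
      s = proj₁ (proj₂ p₀)
      ip = proj₂ (proj₂ p₀)
      d = proj₁ (att zc)
      -- The walk from `c` is aimed at the first vertex of `p`, which has no neighbour on `p` if it
      -- is alone there; hence the first alternative.
      Hit : List Vtx → Vtx → Set
      Hit p v = v ∈ p ⊎ ∃ λ z → z ∈ p × v ~ z
      nbr? : ∀ p v → Dec (∃ λ z → z ∈ p × v ~ z)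
      nbr? p v with first (v ~?_) p
      ... | inj₁ n = no λ { (z , i , e) → n i e }
      ... | inj₂ (cut {pre = l} refl e , _) = yes (_ , ∈-++⁺ʳ l (here refl) , e)
      Hit? : ∀ p v → Dec (Hit p v)
      Hit? p v = (v ∈? p) ⊎-dec nbr? p v
      go : ∀ p → p ⊂ D → Ind (a ∷ p ++ [ b ]) → Outcome D a b c
      go [] s ((e , _) , _) = ⊥-elim (stable _ _ ya yb e)
      go (p₁ ∷ p′) s ip with classify c (p₁ ∷ p′)
      ... | inj₂ M = onPath (far yc ya (ac ∘ sym)) (far yc yb (bc ∘ sym)) yc s ip M
      ... | inj₁ none with firstHit (Hit? (p₁ ∷ p′)) (conn (proj₁ (proj₂ (att zc))) (s (here refl))) (inj₁ (here refl))
      ...   | r , dr , hit , w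
        with path (λ e → D≢Y dr yc (sym e)) (step (inj₂ (inj₁ refl)) (proj₂ (proj₂ (att zc))) (walk-map (Sum.map₂ inj₂) w))
      ...     | K₀ , iK , low = side₃ (first P? (K₀ ++ [ r ]))
        where
        q : List Vtx
        q = p₁ ∷ p′
        P : Vtx → Set
        P v = a ~ v ⊎ b ~ v
        P? : ∀ v → Dec (P v)
        P? v = (a ~? v) ⊎-dec (b ~? v)
        sK : K₀ ++ [ r ] ⊂ D
        sK = ⊂-++ K₀ (proj₁ ∘ low) λ { (here refl) → dr }
        r∉ : ¬ r ∈ q
        r∉ i with initLast K₀
        ... | []        = none i (proj₁ (proj₁ iK))
        ... | K ∷ʳ′ x   = proj₂ (low (∈-++⁺ʳ K (here refl)))
              (inj₂ (r , i , subst (_~ r) (lastOf-∷ʳ c K x) (ind-penult c (K ++ [ x ]) iK)))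
        nb : ∃ λ z → z ∈ q × r ~ z
        nb = [ (λ i → ⊥-elim (r∉ i)) , (λ h → h) ]′ hit
        K⟂q : c ∷ K₀ ⟂⟂ q
        K⟂q (here refl) j = (λ e → D≢Y (s j) yc (sym e)) , none j
        K⟂q (there i)   j = (λ { refl → proj₂ (low i) (inj₁ j) }) , λ e → proj₂ (low i) (inj₂ (_ , j , e))
        side₃ : (K₀ ++ [ r ] ⊂ λ v → ¬ P v) ⊎ Σ (Cut P (K₀ ++ [ r ])) (λ k → Cut.pre k ⊂ λ v → ¬ P v) → Outcome D a b c
        side₃ (inj₂ (cut eq (inj₁ e) , n)) = outcome₁₂ (outcome₂₃ (outcome₁₂
          (reroute ya yb yc ab ac bc s (proj₂ ip) sK iK K⟂q r∉ (proj₁ (proj₂ nb)) (proj₂ (proj₂ nb)) eq (λ i → n i ∘ inj₂) e)))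
        side₃ (inj₂ (cut eq (inj₂ e) , n)) = outcome₂₃ (outcome₁₂
          (reroute yb ya yc (ab ∘ sym) bc ac (λ i → s (reverse⁻ {xs = q} i)) (proj₂ (ind-flip q ip)) sK iK (⟂⟂-revʳ K⟂q)
            (λ i → r∉ (reverse⁻ i)) (reverse⁺ (proj₁ (proj₂ nb))) (proj₂ (proj₂ nb)) eq (λ i → n i ∘ inj₁) e))
        side₃ (inj₁ n) = Attach.attach sK iK (K⟂ ya ac inj₁) (K⟂ yb bc inj₂)
          (subst (λ w → Meet w q) (sym r≡) (meets₀ (proj₁ (proj₂ nb)) (proj₂ (proj₂ nb)))) s ip A
          where
          r≡ : lastOf c (K₀ ++ [ r ]) ≡ r
          r≡ = lastOf-∷ʳ c K₀ r
          meets₀ : ∀ {z} → z ∈ q → r ~ z → Meet r q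
          meets₀ i e = [ (λ n → ⊥-elim (n i e)) , (λ M → M) ]′ (classify r q)
          K⟂ : ∀ {y} → Y y → y ≢ c → (∀ {v} → y ~ v → P v) → ∀ {u} → u ∈ c ∷ K₀ ++ [ r ] → u ⟂ y
          K⟂ yy ne f (here refl) = far yc yy (ne ∘ sym)
          K⟂ yy ne f (there i)   = D≢Y (sK i) yy , λ e → n i (f (~-sym e))
          A : ∀ {u v} → u ∈ c ∷ K₀ ++ [ r ] → v ∈ q → u ≢ v × (u ~ v → u ≡ lastOf c (K₀ ++ [ r ]))
          A i j with ∈-++⁻ (c ∷ K₀) i
          ... | inj₁ i′          = let d , f = K⟂q i′ j in d , λ e → ⊥-elim (f e)
          ... | inj₂ (here refl) = (λ { refl → r∉ j }) , λ _ → sym r≡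

  -- Minimal sides and their tails

  Minimal : (Z D : Vtx → Set) → Set₁
  Minimal Z D = ∀ D′ → (∀ v → D′ v → D v) → Side Z D′ → ∀ v → D v → ¬ D′ v → ⊥

  -- Existence of a smaller side is decided classically. Each passage to one removes a vertex from
  -- the list of candidates, which bounds the number of passages.
  minimise : ∀ {Z D} → Side Z D → ¬ ¬ ∃ λ D′ → (∀ v → D′ v → D v) × Side Z D′ × Minimal Z D′
  minimise {Z} {D} S = go (allFin _) _ ≤-refl D (λ _ d → d) S λ _ → ∈-allFin _
    where
    go : ∀ xs m → length xs ≤ m → ∀ E → (∀ v → E v → D v) → Side Z E → (∀ {v} → E v → v ∈ xs) →
         ¬ ¬ ∃ λ D′ → (∀ v → D′ v → D v) × Side Z D′ × Minimal Z D′
    go xs m l E f S c = do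
      yes (E′ , g , S′ , v , e , ne) ← em (∃ λ E′ → (∀ v → E′ v → E v) × Side Z E′ × ∃ λ v → E v × ¬ E′ v)
        where no h → return (E , f , S , λ D′ g S′ v e ne → h (D′ , g , S′ , v , e , ne))
      smaller xs m l (c e) E′ (λ v → f v ∘ g v) S′ λ e′ → c (g _ e′) , λ { refl → ne e′ }
      where
      smaller : ∀ xs m → length xs ≤ m → ∀ {v} → v ∈ xs → ∀ E → (∀ v → E v → D v) → Side Z E →
                (∀ {u} → E u → u ∈ xs × v ≢ u) → ¬ ¬ ∃ λ D′ → (∀ v → D′ v → D v) × Side Z D′ × Minimal Z D′
      smaller (x ∷ xs) (suc m) (s≤s l) i E f S c with remove (x ∷ xs) i
      ... | ys , e , r = go ys m (≤-trans (≤-reflexive (cong pred e)) l) E f S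
                            λ e′ → let j , ne = c e′ in r j ne

  walk-inside : ∀ {P : Vtx → Set} {u v} → Walk P u v → Walk (Walk P u) u v
  walk-inside w = go (here (walk-src w)) w
    where
    go : ∀ {P : Vtx → Set} {u a v} → Walk P u a → Walk P a v → Walk (Walk P u) a v
    go r (here p)     = here r
    go r (step p e w) = step r e (go (walk-snoc r e (walk-src w)) w)

  module Tails {Z D : Vtx → Set} (side : Side Z D) (min : Minimal Z D) (Z⊂Y : ∀ {v} → Z v → Y v) where
    open Side side

    Comp : Vtx → Vtx → Vtx → Set
    Comp v u = Walk (λ z → D z × z ≢ v) u

    comp-closed : ∀ {v u c x} → Comp v u c → D x → x ≢ v → ¬ Comp v u x → c ⟂ x
    comp-closed C d ne n = (λ { refl → n C }) , λ e → n (walk-snoc C e (d , ne))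

    -- `Comp v u` is the component of `u` in `D` minus `v`. A tail continues any configuration that
    -- reaches `v` from this component to a vertex of `Z`, and its vertices other than `v` have no
    -- contact with the component.
    record Tail (v u : Vtx) : Set where
      field
        {y} : Vtx
        zy  : Z y
        k   : List Vtx
        low : k ⊂ λ x → D x × x ≢ v × ¬ Comp v u x
        ind : Ind (y ∷ k ++ [ v ])
        sep : ∀ {x} → Comp v u x → ¬ y ~ x

    -- Otherwise the component would itself be a side, smaller than `D` because it lacks `v`.
    unattached : ∀ {v u} → D v → D u → u ≢ v → ¬ ¬ ∃ λ y → Z y × (∀ {x} → Comp v u x → ¬ y ~ x)
    unattached {v} {u} dv du ne none = ¬¬-Fin attached λ a → min (Comp v u) (λ _ → proj₁ ∘ walk-tgt) (smaller a) v dv λ C → proj₂ (walk-tgt C) refl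
      where
      attached : ∀ y → ¬ ¬ (Z y → ∃ λ d → Comp v u d × y ~ d)
      attached y = do
        no h ← em (∃ λ d → Comp v u d × y ~ d)
          where yes p → return λ _ → p
        return λ zy → ⊥-elim (none (y , zy , λ C e → h (_ , C , e)))
      smaller : (∀ y → Z y → ∃ λ d → Comp v u d × y ~ d) → Side Z (Comp v u)
      smaller a = record { conn = λ C C′ → walk-++ (walk-sym (walk-inside C)) (walk-inside C′)
                         ; att = a _ ; off = λ yy C → off yy (proj₁ (walk-tgt C)) }

    -- Minimality of D makes every component of D minus v miss the neighbourhood of some y.
    tail : ∀ {v u} → D v → D u → u ≢ v → ¬ ¬ Tail v u
    tail {v} {u} dv du ne = do
      y , zy , sp ← unattached dv du ne
      return (build y zy sp)
      where
      build : ∀ y → Z y → (∀ {x} → Comp v u x → ¬ y ~ x) → Tail v u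
      build y zy sp with att zy
      ... | d , dd , e with firstHit (λ x → x ≟ v) (conn dd dv) refl
      ...   | .v , _ , refl , w
        with path (λ z → D≢Y side dv (Z⊂Y zy) (sym z)) (step (inj₂ (inj₁ refl)) e (walk-map (Sum.map₂ inj₂) w))
      ...     | k , i , s = record { zy = zy ; k = k ; ind = i ; sep = sp
                                   ; low = λ j → proj₁ (s j) , proj₂ (s j) , outside k i s j }
        where
        -- The interior of the path is connected and avoids `v`. If it met the component, its first
        -- vertex, a neighbour of `y`, would belong to the component too.
        outside : ∀ k → Ind (y ∷ k ++ [ v ]) → k ⊂ (λ x → D x × x ≢ v) → ∀ {x} → x ∈ k → ¬ Comp v u x
        outside (h ∷ k) i s j C = sp (walk-++ C (walk-map s (ind-walk (h ∷ k) (ind-++ˡ (h ∷ k) (proj₂ i)) j (here refl)))) (proj₁ (proj₁ i))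

    tail-away : ∀ {v u c} (T : Tail v u) → Comp v u c → c ⟂* Tail.y T ∷ Tail.k T
    tail-away T C (here refl) = D≢Y side (proj₁ (walk-tgt C)) (Z⊂Y (Tail.zy T)) , λ e → Tail.sep T C (~-sym e)
    tail-away T C (there i)   = let d , ne , n = Tail.low T i in comp-closed C d ne n

    module _ {v u w u′ : Vtx} (T : Tail v u) (T′ : Tail w u′) (vw : Comp v u w) (wv : Comp w u′ v) where
      private
        module T = Tail T
        module T′ = Tail T′

        inside : ∀ {x} → x ∈ T.k ++ [ v ] → Comp w u′ x
        inside i = walk-++ wv (walk-sym (walk-map ok (ind-walk (T.k ++ [ v ]) (proj₂ T.ind) i (∈-++⁺ʳ T.k (here refl)))))
          where
          ok : ∀ {z} → z ∈ T.k ++ [ v ] → D z × z ≢ w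
          ok j with ∈-++⁻ T.k j
          ... | inj₁ j′          = let d , _ , n = T.low j′ in d , λ { refl → n vw }
          ... | inj₂ (here refl) = walk-tgt wv

        head-inside : ∀ k → Ind (T.y ∷ k ++ [ v ]) → (∀ {x} → x ∈ k ++ [ v ] → Comp w u′ x) → T.y ≢ T′.y
        head-inside []      ((e , _) , _) f refl = T′.sep (f (here refl)) e
        head-inside (_ ∷ _) ((e , _) , _) f refl = T′.sep (f (here refl)) e

      -- The tail at `v` lies, together with `v`, in the component that `T′` avoids. Thus `T.y` has
      -- a neighbour in this component, whereas `T′.y` has none.
      tails-≢ : T.y ≢ T′.y
      tails-≢ = head-inside T.k T.ind inside

      tails-apart′ : T.k ++ [ v ] ⟂⟂ T′.y ∷ T′.k
      tails-apart′ i j = tail-away T′ (inside i) j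

    tails-apart : ∀ {v u w u′} (T : Tail v u) (T′ : Tail w u′) → Comp v u w → Comp w u′ v →
                  Tail.y T ∷ Tail.k T ⟂⟂ Tail.y T′ ∷ Tail.k T′
    tails-apart T T′ vw wv (here refl) (here refl) = far (Z⊂Y (Tail.zy T)) (Z⊂Y (Tail.zy T′)) (tails-≢ T T′ vw wv)
    tails-apart T T′ vw wv (there i)   j           = tails-apart′ T T′ vw wv (∈-++⁺ˡ i) j
    tails-apart T T′ vw wv (here refl) (there j)   = ⟂-sym (tails-apart′ T′ T wv vw (∈-++⁺ˡ j) (here refl))

    comp-~ : ∀ {x u} → D x → D u → x ~ u → ∀ {w} → x ≢ w → u ≢ w → Comp w x u
    comp-~ dx du e nx nu = step (dx , nx) e (here (du , nu))

    tail⊂ : ∀ {v u} (T : Tail v u) → Tail.k T ⊂ D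
    tail⊂ T i = proj₁ (Tail.low T i)

    -- If `u` and `w` were not adjacent, there would be a claw with centre `x`. Its legs are the
    -- tail at `x`, which avoids the component of `u` and `w`, and the tails at `u` and at `w`,
    -- which avoid the components containing `x`.
    block : (∀ {a b c} → Z a → Z b → Z c → a ≢ b → a ≢ c → b ≢ c → ¬ Claw D a b c) →
            ∀ {x u w} → D x → D u → D w → x ~ u → x ~ w → u ≢ w → Comp x u w → u ~ w
    block noClaw {x} {u} {w} dx du dw xu xw uw C = decidable-stable (u ~? w) do
        yes e ← em (u ~ w)
          where no ne → do
                  Tx ← tail dx du (~⇒≢ (~-sym xu))
                  Tu ← tail du dx (~⇒≢ xu)
                  Tw ← tail dw dx (~⇒≢ xw)
                  ⊥-elim (clawed ne Tx Tu Tw)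
        return e
      where
      clawed : ¬ u ~ w → Tail x u → Tail u x → Tail w x → ⊥
      clawed ne Tx Tu Tw = noClaw (zy Tx) (zy Tu) (zy Tw)
        (tails-≢ Tx Tu xu₁ ux₁) (tails-≢ Tx Tw xw₁ wx₁) (tails-≢ Tu Tw uw₁ wu₁)
        (record
          { inD = dx ; k₁ = k Tx ; k₂ = k Tu ++ [ u ] ; k₃ = k Tw ++ [ w ]
          ; s₁ = tail⊂ Tx ; s₂ = ⊂-++ (k Tu) (tail⊂ Tu) (λ { (here refl) → du }) ; s₃ = ⊂-++ (k Tw) (tail⊂ Tw) (λ { (here refl) → dw })
          ; i₁ = ind Tx ; i₂ = spoke (k Tu) (ind Tu) (~-sym xu) (λ i → ⟂-sym (tail-away Tu ux₁ i))
          ; i₃ = spoke (k Tw) (ind Tw) (~-sym xw) (λ i → ⟂-sym (tail-away Tw wx₁ i))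
          ; p₁₂ = ⟂⟂-++ʳ (y Tu ∷ k Tu) (tails-apart Tx Tu xu₁ ux₁) (λ { i (here refl) → ⟂-sym (tail-away Tx xu₁ i) })
          ; p₁₃ = ⟂⟂-++ʳ (y Tw ∷ k Tw) (tails-apart Tx Tw xw₁ wx₁) (λ { i (here refl) → ⟂-sym (tail-away Tx xw₁ i) })
          ; p₂₃ = ⟂⟂-++ʳ (y Tw ∷ k Tw)
              (⟂⟂-++ˡ (y Tu ∷ k Tu) (tails-apart Tu Tw uw₁ wu₁) (λ { (here refl) → tail-away Tw wu₁ }))
              (λ { i (here refl) → ⟂⟂-++ˡ (y Tu ∷ k Tu) {m = [ w ]} (λ { j (here refl) → ⟂-sym (tail-away Tu uw₁ j) })
                   (λ { (here refl) (here refl) → uw , ne }) i (here refl) })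
          })
        where
        open Tail
        xu₁ : Comp x u u
        xu₁ = here (du , ~⇒≢ (~-sym xu))
        ux₁ : Comp u x x
        ux₁ = here (dx , ~⇒≢ xu)
        xw₁ : Comp x u w
        xw₁ = C
        wx₁ : Comp w x x
        wx₁ = here (dx , ~⇒≢ xw)
        uw₁ : Comp u x w
        uw₁ = comp-~ dx dw xw (~⇒≢ xu) (uw ∘ sym)
        wu₁ : Comp w x u
        wu₁ = comp-~ dx du xu (~⇒≢ xw) uw

    module _ (noTri : ∀ {a b c} → Z a → Z b → Z c → a ≢ b → a ≢ c → b ≢ c → ¬ Tri D a b c) where

      touch-tails : ∀ {v u w u′} (T : Tail v u) (T′ : Tail w u′) → Comp v u w → Comp w u′ v → v ~ w →
                    Touch (Tail.y T) (Tail.k T ++ [ v ]) (Tail.y T′) (Tail.k T′ ++ [ w ])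
      touch-tails {v} {u} {w} T T′ vw wv e
        rewrite lastOf-∷ʳ (Tail.y T) (Tail.k T) v | lastOf-∷ʳ (Tail.y T′) (Tail.k T′) w =
        (λ i j → go (∈-++⁻ (Tail.y T ∷ Tail.k T) i) (∈-++⁻ (Tail.y T′ ∷ Tail.k T′) j)) , e
        where
        go : ∀ {a b} → a ∈ Tail.y T ∷ Tail.k T ⊎ a ∈ [ v ] → b ∈ Tail.y T′ ∷ Tail.k T′ ⊎ b ∈ [ w ] → a ≢ b × (a ~ b → a ≡ v × b ≡ w)
        go (inj₁ i)           (inj₁ j)           = ⟂⇒ (tails-apart T T′ vw wv i j)
        go (inj₁ i)           (inj₂ (here refl)) = ⟂⇒ (⟂-sym (tail-away T vw i))
        go (inj₂ (here refl)) (inj₁ j)           = ⟂⇒ (tail-away T′ wv j)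
        go (inj₂ (here refl)) (inj₂ (here refl)) = ~⇒≢ e , λ _ → refl , refl

      -- Tails at the three corners, each avoiding the component of the other two, would be the legs
      -- of a `Tri`.
      triangle-free : ∀ {u v w} → D u → D v → D w → u ~ v → u ~ w → v ~ w → ⊥
      triangle-free {u} {v} {w} du dv dw uv uw vw = (do
          Tu ← tail du dv (~⇒≢ (~-sym uv))
          Tv ← tail dv du (~⇒≢ uv)
          Tw ← tail dw du (~⇒≢ uw)
          return (go Tu Tv Tw)) λ b → b
        where
        go : Tail u v → Tail v u → Tail w u → ⊥
        go Tu Tv Tw = noTri (zy Tu) (zy Tv) (zy Tw) (tails-≢ Tu Tv uv₁ vu₁) (tails-≢ Tu Tw uw₁ wu₁) (tails-≢ Tv Tw vw₁ wv₁)
          (record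
            { k₁ = k Tu ++ [ u ] ; k₂ = k Tv ++ [ v ] ; k₃ = k Tw ++ [ w ]
            ; s₁ = ⊂-++ (k Tu) (tail⊂ Tu) (λ { (here refl) → du }) ; s₂ = ⊂-++ (k Tv) (tail⊂ Tv) (λ { (here refl) → dv })
            ; s₃ = ⊂-++ (k Tw) (tail⊂ Tw) (λ { (here refl) → dw })
            ; i₁ = ind Tu ; i₂ = ind Tv ; i₃ = ind Tw
            ; t₁₂ = touch-tails Tu Tv uv₁ vu₁ uv ; t₁₃ = touch-tails Tu Tw uw₁ wu₁ uw ; t₂₃ = touch-tails Tv Tw vw₁ wv₁ vw })
          where
          open Tail
          uv₁ : Comp u v v
          uv₁ = here (dv , ~⇒≢ (~-sym uv))
          vu₁ : Comp v u u
          vu₁ = here (du , ~⇒≢ uv)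
          uw₁ : Comp u v w
          uw₁ = comp-~ dv dw vw (~⇒≢ (~-sym uv)) (~⇒≢ (~-sym uw))
          wu₁ : Comp w u u
          wu₁ = here (du , ~⇒≢ uw)
          vw₁ : Comp v u w
          vw₁ = comp-~ du dw uw (~⇒≢ uv) (~⇒≢ (~-sym vw))
          wv₁ : Comp w u v
          wv₁ = comp-~ du dv uv (~⇒≢ uw) (~⇒≢ vw)

      module _ {E : Vtx → Set} (sideE : Side Z E) (DE : ∀ {u v} → D u → E v → u ⟂ v) where

        -- Two paths of the theta form the hole; the third follows the tails of u and w and is closed through E.
        hole-free : ∀ {x u w} m → D x → D u → D w → x ~ u → x ~ w → (m ⊂ λ z → D z × x ⟂ z) → Ind (u ∷ m ++ [ w ]) → ¬ u ~ w → ⊥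
        hole-free {x} {u} {w} m dx du dw xu xw s i ne = (do
            Tu ← tail du dx (~⇒≢ xu)
            Tw ← tail dw dx (~⇒≢ xw)
            return (go Tu Tw)) λ b → b
          where
          open Tail
          uw : u ≢ w
          uw = ind-≢ i (∈-++⁺ʳ m (here refl))
          uw₁ : Comp u x w
          uw₁ = comp-~ dx dw xw (~⇒≢ xu) (uw ∘ sym)
          wu₁ : Comp w x u
          wu₁ = comp-~ dx du xu (~⇒≢ xw) uw
          m⊂u : ∀ {z} → z ∈ m → Comp u x z
          m⊂u j = walk-++ uw₁ (walk-map ok (ind-walk (m ++ [ w ]) (proj₂ i) (∈-++⁺ʳ m (here refl)) (∈-++⁺ˡ j)))
            where
            ok : ∀ {z} → z ∈ m ++ [ w ] → D z × z ≢ u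
            ok k = [ (λ k → proj₁ (s k)) , (λ { (here refl) → dw }) ]′ (∈-++⁻ m k) , λ e → ind-≢ i k (sym e)
          m⊂w : ∀ {z} → z ∈ m → Comp w x z
          m⊂w j = walk-++ wu₁ (walk-map ok (ind-walk (u ∷ m) (ind-++ˡ (u ∷ m) i) (here refl) (there j)))
            where
            ok : ∀ {z} → z ∈ u ∷ m → D z × z ≢ w
            ok k = ⊂-∷ {P = D} du (λ k → proj₁ (s k)) k , ind-≢ʳ (u ∷ m) i k
          go : Tail u x → Tail w x → ⊥
          go Tu Tw = noTheta (theta ne [ x ] m m₃ ix i i₃
              (λ { (here refl) j → proj₂ (s j) })
              (λ { (here refl) → away (here (dx , ~⇒≢ xu)) (here (dx , ~⇒≢ xw)) })
              (λ j → away (m⊂u j) (m⊂w j)))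
            where
            thr = through sideE (Z⊂Y (zy Tu)) (Z⊂Y (zy Tw)) (zy Tu) (zy Tw) (tails-≢ Tu Tw uw₁ wu₁)
            b = proj₁ thr
            b⊂E : b ⊂ E
            b⊂E = proj₁ (proj₂ thr)
            ib : Ind (y Tu ∷ b ++ [ y Tw ])
            ib = proj₂ (proj₂ thr)
            m₃ : List Vtx
            m₃ = reverse (k Tu) ++ y Tu ∷ (b ++ y Tw ∷ k Tw)
            ix : Ind (u ∷ x ∷ [ w ])
            ix = (~-sym xu , λ { (here refl) → uw , ne }) , (xw , λ ()) , tt , tt
            A = tails-apart Tu Tw uw₁ wu₁
            i₃ : Ind (u ∷ m₃ ++ [ w ])
            i₃ = join (k Tu) (b ++ y Tw ∷ k Tw) (ind Tu)
              (subst (λ l → Ind (y Tu ∷ l)) (sym (++-assoc b (y Tw ∷ k Tw) [ w ]))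
                (glue (y Tu ∷ b) ib (ind Tw) (⟂⟂-++ʳ (k Tw)
                  (λ { (here refl) j → A (here refl) (there j) ; (there j) l → ⟂-sym (DE (tail⊂ Tw l) (b⊂E j)) })
                  (λ { (here refl) (here refl) → ⟂-sym (tail-away Tu uw₁ (here refl)) ; (there j) (here refl) → ⟂-sym (DE dw (b⊂E j)) }))))
              (⟂⟂-++ʳ (b ++ y Tw ∷ k Tw) (⟂⟂-++ʳ b
                (λ { (here refl) j → DE du (b⊂E j) ; (there j) l → DE (tail⊂ Tu j) (b⊂E l) })
                (λ { (here refl) j → tail-away Tw wu₁ j ; (there j) l → A (there j) l }))
                (λ { (here refl) (here refl) → uw , ne ; (there j) (here refl) → ⟂-sym (tail-away Tu uw₁ (there j)) }))
            away : ∀ {z} → Comp u x z → Comp w x z → z ⟂* m₃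
            away cu cw = ⟂*-++ (reverse (k Tu)) (λ j → tail-away Tu cu (there (reverse⁻ j)))
              (⟂*-∷ (tail-away Tu cu (here refl)) (⟂*-++ b (λ j → DE (proj₁ (walk-tgt cu)) (b⊂E j)) (tail-away Tw cw)))

        -- Follow a path from `u` to `w` that avoids `x` up to its first neighbour `w′` of `x`: with
        -- `x` this closes a triangle or a hole.
        forest : ∀ {x u w} → D x → D u → D w → x ~ u → x ~ w → u ≢ w → ¬ Comp x u w
        forest {x} {u} {w} dx du dw xu xw uw C with walk⇒path C
        ... | inj₁ e = uw e
        ... | inj₂ (m , i , s) with first (x ~?_) (m ++ [ w ])
        ...   | inj₁ n = n (∈-++⁺ʳ m (here refl)) xw
        ...   | inj₂ (cut {pre = m₁} {w′} {m₂} eq xw′ , n) = go (u ~? w′)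
          where
          dall : ∀ {z} → z ∈ m ++ [ w ] → D z × x ≢ z
          dall j = [ (λ j → proj₁ (s j) , λ e → proj₂ (s j) (sym e)) , (λ { (here refl) → dw , ~⇒≢ xw }) ]′ (∈-++⁻ m j)
          dw′ : D w′
          dw′ = proj₁ (dall (subst (w′ ∈_) (sym eq) (∈-++⁺ʳ m₁ (here refl))))
          i′ : Ind (u ∷ m₁ ++ [ w′ ])
          i′ = ind-++ˡ (u ∷ m₁ ++ [ w′ ]) (subst (λ l → Ind (u ∷ l)) (trans eq (sym (++-assoc m₁ [ w′ ] m₂))) i)
          go : Dec (u ~ w′) → ⊥
          go (yes e) = triangle-free dx du dw′ xu xw′ e
          go (no ne) = hole-free m₁ dx du dw′ xu xw′ (λ j → let d , q = dall (subst (_ ∈_) (sym eq) (∈-++⁺ˡ j)) in d , q , n j) i′ ne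

    approach : ∀ {v u c} → Comp v u c → Walk D c v → ∃ λ a → Comp v u a × a ~ v
    approach C (here _) = ⊥-elim (proj₂ (walk-tgt C) refl)
    approach {v} C (step {w} _ e r) with w ≟ v
    ... | yes refl = _ , C , e
    ... | no ne    = approach (walk-snoc C e (walk-src r , ne)) r

    -- A single neighbour `d₀` of `y₀` means that all branches from `y₀` begin alike, so any two of
    -- them have a fork.
    record Root : Set where
      field
        {y₀ d₀} : Vtx
        zy₀     : Z y₀
        dd₀     : D d₀
        adj₀    : y₀ ~ d₀
        only    : ∀ {d} → D d → y₀ ~ d → d ≡ d₀

    -- If the component of D minus v is chosen maximal, then v is not a cut vertex, and the tail of v is a single edge.
    root : ∀ {z} → Z z → ¬ ¬ Root
    root {z} zz with att zz
    ... | v , dv , e = do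
        yes (u , du , ne) ← em (∃ λ u → D u × u ≢ v)
          where no h → return (record { zy₀ = zz ; dd₀ = dv ; adj₀ = e ; only = λ {d} dd _ → decidable-stable (d ≟ v) λ ne → h (d , dd , ne) })
        go (allFin _) _ ≤-refl dv du ne λ _ → ∈-allFin _
      where
      Rest : Vtx → Vtx → Vtx → Set
      Rest v u x = D x × x ≢ v × ¬ Comp v u x
      go : ∀ xs m → length xs ≤ m → ∀ {v u} → D v → D u → u ≢ v → (∀ {x} → Rest v u x → x ∈ xs) → ¬ ¬ Root
      -- The vertex `x` takes the place of `v`. The component of `v` in `D` minus `x` contains `v`
      -- and the whole old component, so fewer vertices remain outside.
      shrink : ∀ xs m → length xs ≤ m → ∀ {v u x} → D v → D u → u ≢ v → Rest v u x → x ∈ xs → (∀ {x} → Rest v u x → x ∈ xs) → ¬ ¬ Root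
      go xs m l {v} {u} dv du ne c = do
        no h ← em (∃ (Rest v u))
          where yes (x , r) → shrink xs m l dv du ne r (c r) c
        T ← tail dv du ne
        return (found h T)
        where
        found : ¬ ∃ (Rest v u) → Tail v u → Root
        found h T = record { zy₀ = Tail.zy T ; dd₀ = dv
                           ; adj₀ = subst (Tail.y T ~_) (only (proj₁ (proj₂ a)) (proj₂ (proj₂ a))) (proj₂ (proj₂ a)) ; only = only }
          where
          a = att (Tail.zy T)
          only : ∀ {d} → D d → Tail.y T ~ d → d ≡ v
          only {d} dd e = decidable-stable (d ≟ v) λ ne → h (d , dd , ne , λ C → Tail.sep T C e)
      shrink (x₀ ∷ xs) (suc m) (s≤s l) {v} {u} {x} dv du ne r@(dx , xv , xC) i c with remove (x₀ ∷ xs) i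
      ... | ys , e , f = go ys m (≤-trans (≤-reflexive (cong pred e)) l) dx dv (xv ∘ sym)
          λ { (dz , zx , zC) → f (c (dz , (λ { refl → zC (here (dv , xv ∘ sym)) }) , λ C → zC (around C))) (zx ∘ sym) }
        where
        avoid : ∀ {a} → Comp v u a → D a × a ≢ x
        avoid C = proj₁ (walk-tgt C) , λ { refl → xC C }
        around : ∀ {z} → Comp v u z → Comp x v z
        around C with approach (here (du , ne)) (conn du dv)
        ... | a , Ca , e = step (dv , xv ∘ sym) (~-sym e) (walk-++ (walk-sym (walk-map avoid (walk-inside Ca))) (walk-map avoid (walk-inside C)))

  -- Legs hanging from a path

  hd : List Vtx → Vtx → Vtx
  hd []      y = y
  hd (x ∷ _) y = x

  hd-∈ : ∀ k {y} → hd k y ∈ k ++ [ y ]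
  hd-∈ []      = here refl
  hd-∈ (_ ∷ _) = here refl

  hd-≡ : ∀ {l s u r y} → l ≡ s → s ≡ u ∷ r → u ≡ hd l y
  hd-≡ refl refl = refl

  -- The first vertex of the leg k, y sees exactly the vertices with index p, …, p + wd on Π. Legs in the tree A have
  -- wd = 0, legs in the block graph B have wd = 1.
  record Hang (wd : ℕ) (D : Vtx → Set) (Π : List Vtx) (y : Vtx) (p : ℕ) (k : List Vtx) : Set where
    field
      k⊂     : k ⊂ D
      indk   : Ind (k ++ [ y ])
      fits   : p + wd < length Π
      joined : ∀ {m x} → At Π m x → p ≤ m → m ≤ p + wd → hd k y ~ x
      only   : ∀ {m u x} → At Π m x → u ∈ k ++ [ y ] → u ~ x → u ≡ hd k y × p ≤ m × m ≤ p + wd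
      off    : ∀ {u} → u ∈ k ++ [ y ] → ¬ u ∈ Π

  record Spine (wd : ℕ) (D : Vtx → Set) (ys : List Vtx) : Set where
    field
      Π     : List Vtx
      Π⊂    : Π ⊂ D
      indΠ  : Ind Π
      k     : Vtx → List Vtx
      pos   : Vtx → ℕ
      hang  : ∀ {y} → y ∈ ys → Hang wd D Π y (pos y) (k y)
      apart : ∀ {y z} → y ∈ ys → z ∈ ys → y ≢ z → k y ++ [ y ] ⟂⟂ k z ++ [ z ]

  -- This is for B, where the pairs x_i, y_i of the pyramid have to be disjoint; in A the vertices
  -- z_i may coincide.
  Apart : ∀ {wd D ys} → Spine wd D ys → Set
  Apart {ys = ys} S = ∀ {y z} → y ∈ ys → z ∈ ys → y ≢ z → Spine.pos S y ≢ Spine.pos S z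

  record Spread (Π : List Vtx) (y : Vtx) (lo hi : ℕ) : Set where
    field
      gap    : suc (suc lo) ≤ hi
      fits   : hi < length Π
      at-lo  : ∀ {x} → At Π lo x → y ~ x
      at-hi  : ∀ {x} → At Π hi x → y ~ x
      within : ∀ {m x} → At Π m x → y ~ x → lo ≤ m × m ≤ hi

  -- The form that A takes when many vertices have two nonadjacent neighbours on one branch. By
  -- `order`, two intervals share at most two consecutive positions.
  record Interval (D : Vtx → Set) (ys : List Vtx) : Set where
    field
      Π      : List Vtx
      Π⊂     : Π ⊂ D
      indΠ   : Ind Π
      lo hi  : Vtx → ℕ
      spreads : ∀ {y} → y ∈ ys → Spread Π y (lo y) (hi y)
      order  : ∀ {y z} → y ∈ ys → z ∈ ys → y ≢ z → lo y ≤ lo z → hi y ≤ suc (lo z)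

  -- Membership in a list is decidable, so choices made for its entries extend to a total function
  -- with the default `d`.
  choose : ∀ {X : Set} (xs : List Vtx) (d : X) {Q : Vtx → X → Set} → (∀ y → y ∈ xs → ∃ (Q y)) →
           Σ (Vtx → X) λ f → ∀ y → y ∈ xs → Q y (f y)
  choose {X} xs d {Q} g = f , ok
    where
    f : Vtx → X
    f y with y ∈? xs
    ... | yes i = proj₁ (g y i)
    ... | no _  = d
    ok : ∀ y → y ∈ xs → Q y (f y)
    ok y i with y ∈? xs
    ... | yes j = proj₂ (g y j)
    ... | no n  = ⊥-elim (n i)

  at-length : ∀ (l : List Vtx) {x m} → At (l ++ x ∷ m) (length l) x
  at-length []      = here
  at-length (y ∷ l) = there (at-length l)

  at-mid : ∀ (l : List Vtx) {x m k v} → At (l ++ x ∷ m) k v → v ∈ l ⊎ (v ≡ x × k ≡ length l) ⊎ ∃ λ j → At m j v × k ≡ suc (length l + j)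
  at-mid l a with at-++⁻ l a
  ... | inj₁ b                  = inj₁ (at-∈ b)
  ... | inj₂ (_ , e , here)     = inj₂ (inj₁ (refl , trans e (+-identityʳ _)))
  ... | inj₂ (_ , e , there b)  = inj₂ (inj₂ (_ , b , trans e (+-suc _ _)))

  length-mid : ∀ (l : List Vtx) {x m} → length (l ++ x ∷ m) ≡ suc (length l + length m)
  length-mid l {m = m} = trans (length-++ l) (+-suc (length l) (length m))

  module _ {Z D : Vtx → Set} (side : Side Z D) where

    private
      bare : ∀ {Π y} → Y y → Π ⊂ D → ∀ {u} → u ∈ [ y ] → ¬ u ∈ Π
      bare yy s (here refl) i = Side.off side yy (s i)

    -- Each kind of contact is paired with the configuration it creates. As A has no `Tri` and B
    -- neither `Claw` nor `Mid`, only single feet and spreads remain in A, and only edges in B.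
    verdict : ∀ {a b y p} → y ⟂ a → y ⟂ b → Y y → p ⊂ D → Ind (a ∷ p ++ [ b ]) → Meet y p →
              (∃ λ m → Hang 0 D p y m [] × Claw D a b y) ⊎
              (∃ λ m → Hang 1 D p y m [] × Tri D a b y) ⊎
              (∃ λ lo → ∃ λ hi → Spread p y lo hi × (Claw D a b y ⊎ Mid D y a b))
    verdict {a} {b} {y} ya yb yy s ip (uniq l₀ z l₁ e n₀ n₁) = inj₁ (length l₀ , record
        { k⊂ = λ () ; indk = tt , tt
        ; fits = subst (length l₀ + 0 <_) (sym (length-mid l₀)) (s≤s (+-monoʳ-≤ (length l₀) z≤n))
        ; joined = λ A lo hi → subst (y ~_) (at-fun (at-length l₀) (subst (λ k → At _ k _) (≤-antisym (subst (_ ≤_) (+-identityʳ _) hi) lo) A)) e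
        ; only = λ { A (here refl) f → refl , only A f }
        ; off = bare yy s } , Attach.attach-uniq side (λ ()) (tt , tt) (λ { (here refl) → ya }) (λ { (here refl) → yb }) l₀ z l₁ e n₀ n₁ s ip
                                 λ { (here refl) j → (λ { refl → Side.off side yy (s j) }) , λ _ → refl })
      where
      only : ∀ {m x} → At (l₀ ++ z ∷ l₁) m x → y ~ x → length l₀ ≤ m × m ≤ length l₀ + 0
      only A f with at-mid l₀ A
      ... | inj₁ i                  = ⊥-elim (n₀ i f)
      ... | inj₂ (inj₁ (_ , refl))  = ≤-refl , m≤m+n _ 0
      ... | inj₂ (inj₂ (_ , B , _)) = ⊥-elim (n₁ (at-∈ B) f)
    verdict {a} {b} {y} ya yb yy s ip (pair l₀ z z′ l₁ e e′ n₀ n₁) = inj₂ (inj₁ (length l₀ , record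
        { k⊂ = λ () ; indk = tt , tt
        ; fits = subst (length l₀ + 1 <_) (sym (length-mid l₀)) (s≤s (+-monoʳ-≤ (length l₀) (s≤s z≤n)))
        ; joined = joined
        ; only = λ { A (here refl) f → refl , only A f }
        ; off = bare yy s } , Attach.attach-pair side (λ ()) (tt , tt) (λ { (here refl) → ya }) (λ { (here refl) → yb }) l₀ z z′ l₁ e e′ n₀ n₁ s ip
                                 λ { (here refl) j → (λ { refl → Side.off side yy (s j) }) , λ _ → refl }))
      where
      joined : ∀ {m x} → At (l₀ ++ z ∷ z′ ∷ l₁) m x → length l₀ ≤ m → m ≤ length l₀ + 1 → y ~ x
      joined A lo hi with at-++⁻ l₀ A
      ... | inj₁ B = ⊥-elim (<-irrefl refl (≤-trans (at-< B) lo))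
      ... | inj₂ (_ , _ , here) = e
      ... | inj₂ (_ , _ , there here) = e′
      ... | inj₂ (_ , refl , there (there {k = k} B)) = ⊥-elim (big (+-cancelˡ-≤ (length l₀) _ _ hi))
        where
        big : ¬ suc (suc k) ≤ 1
        big (s≤s ())
      only : ∀ {m x} → At (l₀ ++ z ∷ z′ ∷ l₁) m x → y ~ x → length l₀ ≤ m × m ≤ length l₀ + 1
      only A f with at-++⁻ l₀ A
      ... | inj₁ B                           = ⊥-elim (n₀ (at-∈ B) f)
      ... | inj₂ (_ , refl , here)           = m≤m+n _ 0 , +-monoʳ-≤ (length l₀) z≤n
      ... | inj₂ (_ , refl , there here)     = m≤m+n _ 1 , ≤-refl
      ... | inj₂ (_ , _ , there (there B))   = ⊥-elim (n₁ (at-∈ B) f)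
    verdict {a} {b} {y} ya yb yy s ip (spread l₀ z x m z′ l₁ e e′ n₀ n₁) = inj₂ (inj₂ (length l₀ , suc (length l₀ + suc (length m)) , record
        { gap = s≤s (subst (suc (length l₀) ≤_) (sym (+-suc (length l₀) (length m))) (s≤s (m≤m+n _ _)))
        ; fits = subst (suc (length l₀ + suc (length m)) <_) (sym (trans (length-mid l₀) (cong (λ k → suc (length l₀ + suc k)) (length-mid m))))
                   (s≤s (subst (_≤ length l₀ + suc (suc (length m + length l₁))) (+-suc (length l₀) (suc (length m)))
                     (+-monoʳ-≤ (length l₀) (s≤s (s≤s (m≤m+n (length m) (length l₁)))))))
        ; at-lo = λ A → subst (y ~_) (at-fun (at-length l₀) A) e
        ; at-hi = λ A → subst (y ~_) (at-fun (subst (λ k → At (l₀ ++ z ∷ x ∷ m ++ z′ ∷ l₁) k z′) (+-suc (length l₀) (suc (length m)))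
                                               (at-++ʳ l₀ (there (there (at-length m))))) A) e′
        ; within = within } ,
        Attach.spread-outcome side (λ ()) (tt , tt) (λ { (here refl) → ya }) (λ { (here refl) → yb }) l₀ z x m z′ l₁ e e′ n₀ n₁ s ip
                                 λ { (here refl) j → (λ { refl → Side.off side yy (s j) }) , λ _ → refl }))
      where
      within : ∀ {i v} → At (l₀ ++ z ∷ x ∷ m ++ z′ ∷ l₁) i v → y ~ v → length l₀ ≤ i × i ≤ suc (length l₀ + suc (length m))
      within A f with at-mid l₀ A
      ... | inj₁ i                      = ⊥-elim (n₀ i f)
      ... | inj₂ (inj₁ (_ , refl))      = ≤-refl , ≤-trans (m≤m+n _ _) (n≤1+n _)
      ... | inj₂ (inj₂ (j , B , refl))  = ≤-trans (m≤m+n _ j) (n≤1+n _) , s≤s (+-monoʳ-≤ (length l₀) (bound B))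
        where
        bound : ∀ {j} → At (x ∷ m ++ z′ ∷ l₁) j _ → j ≤ suc (length m)
        bound here      = z≤n
        bound (there C) with at-++⁻ m C
        ... | inj₁ E                   = s≤s (≤-trans (n≤1+n _) (at-< E))
        ... | inj₂ (_ , refl , here)   = s≤s (subst (_≤ length m) (sym (+-identityʳ _)) ≤-refl)
        ... | inj₂ (_ , _ , there E)   = ⊥-elim (n₁ (at-∈ E) f)

  -- Branches from a root and their forks

  module Family {zs : List Vtx} {D : Vtx → Set} (side : Side (_∈ zs) D) (min : Minimal (_∈ zs) D) (Z⊂Y : ∀ {v} → v ∈ zs → Y v)
    (R : Tails.Root side min Z⊂Y) (xs : List Vtx) (xs⊂ : ∀ {y} → y ∈ xs → y ∈ zs × y ≢ Tails.Root.y₀ R) where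
    open Side side
    open Tails side min Z⊂Y
    open Root R

    record Branch (y : Vtx) (l : List Vtx) : Set where
      field
        rest : List Vtx
        eq   : l ≡ d₀ ∷ rest
        inD  : l ⊂ D
        ind  : Ind (y₀ ∷ l ++ [ y ])

    branch : ∀ y → y ∈ xs → ∃ (Branch y)
    branch y i with through side (Z⊂Y zy₀) (Z⊂Y (proj₁ (xs⊂ i))) zy₀ (proj₁ (xs⊂ i)) (λ e → proj₂ (xs⊂ i) (sym e))
    ... | []    , s , p@((e , _) , _) = ⊥-elim (stable _ _ (Z⊂Y zy₀) (Z⊂Y (proj₁ (xs⊂ i))) e)
    ... | x ∷ l , s , p@((e , _) , _) = x ∷ l , record { rest = l ; eq = cong (_∷ l) (only (s (here refl)) e) ; inD = s ; ind = p }

    abstract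
      chosen : Σ (Vtx → List Vtx) λ P → ∀ y → y ∈ xs → Branch y (P y)
      chosen = choose xs [] branch

    P : Vtx → List Vtx
    P = proj₁ chosen

    isP : ∀ {y} → y ∈ xs → Branch y (P y)
    isP {y} i = proj₂ chosen y i

    xs⊂Y : ∀ {y} → y ∈ xs → Y y
    xs⊂Y i = Z⊂Y (proj₁ (xs⊂ i))

    P⊂ : ∀ {y} → y ∈ xs → P y ⊂ D
    P⊂ i = Branch.inD (isP i)

    indP : ∀ {y} → y ∈ xs → Ind (P y)
    indP {y} i = ind-++ˡ (P y) (proj₂ (Branch.ind (isP i)))

    touch : Vtx → Vtx → Set
    touch y z = ∃ λ x → x ∈ P z × y ~ x

    touch? : ∀ y z → Dec (touch y z)
    touch? y z with first (y ~?_) (P z)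
    ... | inj₁ n = no λ { (x , i , e) → n i e }
    ... | inj₂ (cut {pre = l} eq e , _) = yes (_ , subst (_ ∈_) (sym eq) (∈-++⁺ʳ l (here refl)) , e)

    c : Vtx → Vtx → ℕ
    c y z = cpl (P y) (P z)

    forkP : ∀ {y z} → y ∈ xs → z ∈ xs → Fork (P y) (P z)
    forkP i j = subst₂ Fork (sym (Branch.eq (isP i))) (sym (Branch.eq (isP j))) (fork d₀ _ _)

    miss⟂ : ∀ {y z} → y ∈ xs → z ∈ xs → ¬ touch y z → y ⟂* P z
    miss⟂ i j n k = (λ e → D≢Y side (P⊂ j k) (xs⊂Y i) (sym e)) , λ e → n (_ , k , e)

    module Split {y z : Vtx} (i : y ∈ xs) (j : z ∈ xs) (ne : y ≢ z) (yz : ¬ touch y z) (zy : ¬ touch z y)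
                 (F : Fork (P y) (P z)) where
      open Fork F public

      private
        Iy : Ind (y₀ ∷ (pre ++ v ∷ s) ++ [ y ])
        Iy = subst (λ l → Ind (y₀ ∷ l ++ [ y ])) eqˡ (Branch.ind (isP i))
        Iz : Ind (y₀ ∷ (pre ++ v ∷ t) ++ [ z ])
        Iz = subst (λ l → Ind (y₀ ∷ l ++ [ z ])) eqʳ (Branch.ind (isP j))

      s∈ : ∀ {x} → x ∈ s → x ∈ P y
      s∈ k = subst (_ ∈_) (sym eqˡ) (∈-++⁺ʳ pre (there k))

      t∈ : ∀ {x} → x ∈ t → x ∈ P z
      t∈ k = subst (_ ∈_) (sym eqʳ) (∈-++⁺ʳ pre (there k))

      s⊂ : s ⊂ D
      s⊂ k = P⊂ i (s∈ k)

      t⊂ : t ⊂ D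
      t⊂ k = P⊂ j (t∈ k)

      dv : D v
      dv = P⊂ i (subst (v ∈_) (sym eqˡ) (∈-++⁺ʳ pre (here refl)))

      down-y : Ind (v ∷ s ++ [ y ])
      down-y = proj₁ (proj₂ (halves pre Iy))

      down-z : Ind (v ∷ t ++ [ z ])
      down-z = proj₁ (proj₂ (halves pre Iz))

      up : Ind (y₀ ∷ pre ++ [ v ])
      up = proj₁ (halves pre Iy)

      up-y : y₀ ∷ pre ⟂⟂ s ++ [ y ]
      up-y = proj₂ (proj₂ (halves pre Iy))

      up-z : y₀ ∷ pre ⟂⟂ t ++ [ z ]
      up-z = proj₂ (proj₂ (halves pre Iz))

      nonempty : ∃ λ u → ∃ λ r → s ≡ u ∷ r
      nonempty = go s refl
        where
        go : ∀ l → s ≡ l → ∃ λ u → ∃ λ r → s ≡ u ∷ r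
        go (u ∷ r) e = u , r , e
        -- If the branch of `y` stopped at the fork, then `y` would be adjacent to a vertex of the
        -- other branch.
        go []      e = ⊥-elim (yz (v , subst (v ∈_) (sym eqʳ) (∈-++⁺ʳ pre (here refl)) ,
                         ~-sym (proj₁ (proj₁ (subst (λ l → Ind (v ∷ l ++ [ y ])) e down-y)))))

      with-ends : ∀ {l m} → (l ⊂ λ x → x ∈ s) → (m ⊂ λ x → x ∈ t) → l ⟂⟂ m → l ++ [ y ] ⟂⟂ m ++ [ z ]
      with-ends {l} {m} ls mt a = ⟂⟂-++ˡ l
        (⟂⟂-++ʳ m a λ { k (here refl) → ⟂-sym (miss⟂ j i zy (s∈ (ls k))) })
        (⟂⟂-++ʳ m (λ { (here refl) k → miss⟂ i j yz (t∈ (mt k)) }) λ { (here refl) (here refl) → far (xs⊂Y i) (xs⊂Y j) ne })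

      comp-down : ∀ {w u r x} → Ind (w ∷ u ∷ r) → u ∷ r ⊂ D → x ∈ u ∷ r → Comp w u x
      comp-down {w} {u} {r} p q k = walk-map (λ m → q m , λ e → ind-≢ p m (sym e)) (ind-walk (u ∷ r) (proj₂ p) (here refl) k)

      apart-comps : ∀ {w u u′ l m} → (l ⊂ Comp w u) → (m ⊂ Comp w u′) → ¬ Comp w u u′ → l ⟂⟂ m
      apart-comps f g n a b = comp-closed (f a) (proj₁ (walk-tgt (g b))) (proj₂ (walk-tgt (g b))) λ C → n (walk-++ C (walk-sym (g b)))

      record Below : Set where
        field
          {u u′}  : Vtx
          {r r′}  : List Vtx
          eqs     : s ≡ u ∷ r
          eqt     : t ≡ u′ ∷ r′
          u≢u′    : u ≢ u′
          vu      : v ~ u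
          vu′     : v ~ u′
          iy      : Ind (v ∷ u ∷ r)
          iz      : Ind (v ∷ u′ ∷ r′)
          su      : u ∷ r ⊂ D
          tu      : u′ ∷ r′ ⊂ D

        s-apart : ¬ Comp v u u′ → s ⟂⟂ t
        s-apart n rewrite eqs | eqt = apart-comps (comp-down iy su) (comp-down iz tu) n

    split : ∀ {y z} (i : y ∈ xs) (j : z ∈ xs) (ne : y ≢ z) (yz : ¬ touch y z) (zy : ¬ touch z y) (F : Fork (P y) (P z)) →
            Split.Below i j ne yz zy F
    split {y} {z} i j ne yz zy F = build (S.nonempty) nonempty′ S.differ
      where
      module S = Split i j ne yz zy F
      nonempty′ : ∃ λ u → ∃ λ r → S.t ≡ u ∷ r
      nonempty′ = go S.t refl
        where
        go : ∀ l → S.t ≡ l → ∃ λ u → ∃ λ r → S.t ≡ u ∷ r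
        go (u ∷ r) e = u , r , e
        go []      e = ⊥-elim (zy (S.v , subst (S.v ∈_) (sym S.eqˡ) (∈-++⁺ʳ S.pre (here refl)) ,
                         ~-sym (proj₁ (proj₁ (subst (λ l → Ind (S.v ∷ l ++ [ z ])) e S.down-z)))))
      build : (∃ λ u → ∃ λ r → S.s ≡ u ∷ r) → (∃ λ u → ∃ λ r → S.t ≡ u ∷ r) → Differ S.s S.t → S.Below
      build (u , r , e) (u′ , r′ , e′) d = record
        { eqs = e ; eqt = e′ ; u≢u′ = subst₂ Differ e e′ d ; vu = proj₁ (proj₁ iy) ; vu′ = proj₁ (proj₁ iz) ; iy = iy ; iz = iz
        ; su = λ k → S.s⊂ (subst (_ ∈_) (sym e) k) ; tu = λ k → S.t⊂ (subst (_ ∈_) (sym e′) k) }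
        where
        iy : Ind (S.v ∷ u ∷ r)
        iy = subst (λ l → Ind (S.v ∷ l)) e (ind-++ˡ (S.v ∷ S.s) S.down-y)
        iz : Ind (S.v ∷ u′ ∷ r′)
        iz = subst (λ l → Ind (S.v ∷ l)) e′ (ind-++ˡ (S.v ∷ S.t) S.down-z)

    -- Beyond the fork, the head of the leg sees `wd` further vertices of the other branch: none in
    -- a tree, one in the line graph of a tree. Positions start at 0 whereas `c y z` counts the fork
    -- vertex, hence `pred`.
    hang : ∀ wd {y z} (i : y ∈ xs) (j : z ∈ xs) (ne : y ≢ z) (yz : ¬ touch y z) (zy : ¬ touch z y) (F : Fork (P y) (P z)) →
           let open Fork F in
           wd ≤ length t →
           (∀ {k x} → At t k x → k < wd → hd s y ~ x) →
           (∀ {k x u} → At t k x → u ∈ s ++ [ y ] → u ≢ x × (u ~ x → u ≡ hd s y × k < wd)) →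
           Hang wd D (P z) y (pred (c y z)) (drop (c y z) (P y))
    hang wd {y} {z} i j ne yz zy F wt below-joined below-only = subst₂ (λ p k → Hang wd D (P z) y p k) (cong pred (sym depth)) eqk (record
        { k⊂ = s⊂ ; indk = proj₂ down-y
        ; fits = subst (λ l → length pre + wd < length l) (sym eqʳ) (subst (length pre + wd <_) (sym (length-mid pre)) (s≤s (+-monoʳ-≤ (length pre) wt)))
        ; joined = λ A → joined (subst (λ l → At l _ _) eqʳ A)
        ; only = λ A k f → proj₂ (facts (at-mid pre (subst (λ l → At l _ _) eqʳ A)) k) f
        ; off = λ k m → off-Π k (∈-at m) })
      where
      open Split i j ne yz zy F
      eqk : s ≡ drop (c y z) (P y)
      eqk rewrite depth = sym (trans (cong (drop (suc (length pre))) eqˡ) (drop-length pre))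
      head-down : v ~ hd s y
      head-down with s | down-y
      ... | []    | (e , _) , _ = e
      ... | _ ∷ _ | (e , _) , _ = e
      tail-down : ∀ {u} → u ∈ s ++ [ y ] → v ~ u → u ≡ hd s y
      tail-down k e with s | down-y
      tail-down (here refl) e | []    | _           = refl
      tail-down (here refl) e | _ ∷ _ | _           = refl
      tail-down (there k)   e | _ ∷ _ | (_ , a) , _ = ⊥-elim (proj₂ (a k) e)
      joined : ∀ {m x} → At (pre ++ v ∷ t) m x → length pre ≤ m → m ≤ length pre + wd → hd s y ~ x
      joined A lo hi with at-++⁻ pre A
      ... | inj₁ B                       = ⊥-elim (<-irrefl refl (≤-trans (at-< B) lo))
      ... | inj₂ (_ , _ , here)          = ~-sym head-down
      ... | inj₂ (_ , refl , there B)    = below-joined B (+-cancelˡ-≤ (length pre) _ _ hi)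
      facts : ∀ {m x u} → x ∈ pre ⊎ (x ≡ v × m ≡ length pre) ⊎ (∃ λ k → At t k x × m ≡ suc (length pre + k)) →
              u ∈ s ++ [ y ] → u ≢ x × (u ~ x → u ≡ hd s y × length pre ≤ m × m ≤ length pre + wd)
      facts (inj₁ m) k = let d , f = up-y (there m) k in d ∘ sym , λ e → ⊥-elim (f (~-sym e))
      facts (inj₂ (inj₁ (refl , refl))) k = (λ e → ind-≢ down-y k (sym e)) , λ e → tail-down k (~-sym e) , ≤-refl , m≤m+n _ wd
      facts (inj₂ (inj₂ (q , B , refl))) k = let d , f = below-only B k in
        d , λ e → let g , h = f e in g , ≤-trans (m≤m+n _ q) (n≤1+n _) , subst (_≤ length pre + wd) (+-suc (length pre) q) (+-monoʳ-≤ (length pre) h)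
      off-Π : ∀ {u} → u ∈ s ++ [ y ] → ∃ (λ m → At (P z) m u) → ⊥
      off-Π k (m , A) = proj₁ (facts (at-mid pre (subst (λ l → At l m _) eqʳ A)) k) refl

    fork-drop : ∀ {y z} (F : Fork (P y) (P z)) → drop (c y z) (P y) ≡ Fork.s F
    fork-drop F rewrite Fork.depth F = trans (cong (drop (suc (length (Fork.pre F)))) (Fork.eqˡ F)) (drop-length (Fork.pre F))

    fork-dropʳ : ∀ {y z} (F : Fork (P y) (P z)) → drop (c y z) (P z) ≡ Fork.t F
    fork-dropʳ F rewrite Fork.depth F = trans (cong (drop (suc (length (Fork.pre F)))) (Fork.eqʳ F)) (drop-length (Fork.pre F))

    open Extraction touch touch? c (λ y z → cpl-sym (P y) (P z)) (λ {x} {y} {z} → cpl-ultra (P x) (P y) (P z)) public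

    module Between {K : ℕ} (C : Comb xs K) {y z : Vtx} (i : y ∈ Comb.w C ∷ Comb.ys C) (j : z ∈ Comb.w C ∷ Comb.ys C) (ne : y ≢ z) where
      xs∈ : ∀ {x} → x ∈ Comb.w C ∷ Comb.ys C → x ∈ xs
      xs∈ (here refl) = Comb.w∈ C
      xs∈ (there k)   = Comb.from C k

      yz : ¬ touch y z
      yz = Comb.misses C i j ne

      zy : ¬ touch z y
      zy = Comb.misses C j i (ne ∘ sym)

      F : Fork (P y) (P z)
      F = forkP (xs∈ i) (xs∈ j)

    module TreeSide (tree : ∀ {x u w} → D x → D u → D w → x ~ u → x ~ w → u ≢ w → ¬ Comp x u w) {K : ℕ} (C : Comb xs K) where
      open Comb C

      private
        module Fk {y z : Vtx} (i : y ∈ w ∷ ys) (j : z ∈ w ∷ ys) (ne : y ≢ z) where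
          open Between C i j ne public
          open Split (xs∈ i) (xs∈ j) ne yz zy F public
          module B = Below (split (xs∈ i) (xs∈ j) ne yz zy F)

          legs-apart : s ⟂⟂ t
          legs-apart = B.s-apart (tree dv (B.su (here refl)) (B.tu (here refl)) B.vu B.vu′ B.u≢u′)

      -- In a tree the fork vertex separates the two continuations, so a leg sees the branch of the
      -- pivot at the fork only.
      comb-spine : Spine 0 D ys
      comb-spine = record
        { Π = P w ; Π⊂ = P⊂ w∈ ; indΠ = indP w∈ ; k = λ y → drop (c y w) (P y) ; pos = λ y → pred (c y w)
        ; hang = hung ; apart = apart }
        where
        hung : ∀ {y} → y ∈ ys → Hang 0 D (P w) y (pred (c y w)) (drop (c y w) (P y))
        hung {y} i = hang 0 (Q.xs∈ (there i)) (Q.xs∈ (here refl)) (w≢ i) Q.yz Q.zy Q.F z≤n (λ _ ())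
          λ A k → ⟂⇒ (Q.with-ends (λ m → m) (λ m → m) Q.legs-apart k (∈-++⁺ˡ (at-∈ A)))
          where module Q = Fk (there i) (here refl) (w≢ i)
        apart : ∀ {y z} → y ∈ ys → z ∈ ys → y ≢ z → drop (c y w) (P y) ++ [ y ] ⟂⟂ drop (c z w) (P z) ++ [ z ]
        apart {y} {z} i j ne = Q.with-ends s-low t-low λ m n → Q.legs-apart (s-low m) (t-low n)
          where
          module Q = Fk (there i) (there j) ne
          s-low : drop (c y w) (P y) ⊂ (_∈ Q.s)
          s-low m = subst (_ ∈_) (fork-drop Q.F) (drop-⊂ (P y) (proj₁ (below i j ne)) m)
          t-low : drop (c z w) (P z) ⊂ (_∈ Q.t)
          t-low m = subst (_ ∈_) (fork-dropʳ Q.F) (drop-⊂ (P z) (proj₂ (below i j ne)) m)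

    pivot-path : ∀ {w} → w ∈ xs → Ind (y₀ ∷ P w ++ [ w ])
    pivot-path i = Branch.ind (isP i)

    met : ∀ {y w} → touch y w → Meet y (P w)
    met {y} {w} (x , i , e) = [ (λ n → ⊥-elim (n i e)) , (λ M → M) ]′ (classify y (P w))

    y₀≢ : ∀ {y} → y ∈ xs → y₀ ≢ y
    y₀≢ i e = proj₂ (xs⊂ i) (sym e)

    hit-verdict : ∀ {y w} → y ∈ xs → w ∈ xs → y ≢ w → touch y w →
                  (∃ λ m → Hang 0 D (P w) y m [] × Claw D y₀ w y) ⊎
                  (∃ λ m → Hang 1 D (P w) y m [] × Tri D y₀ w y) ⊎
                  (∃ λ lo → ∃ λ hi → Spread (P w) y lo hi × (Claw D y₀ w y ⊎ Mid D y y₀ w))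
    hit-verdict i j ne h = verdict side (far (xs⊂Y i) (Z⊂Y zy₀) (proj₂ (xs⊂ i))) (far (xs⊂Y i) (xs⊂Y j) ne) (xs⊂Y i) (P⊂ j) (pivot-path j) (met h)

    bare-apart : ∀ {y z} → y ∈ xs → z ∈ xs → y ≢ z → [ y ] ⟂⟂ [ z ]
    bare-apart i j ne (here refl) (here refl) = far (xs⊂Y i) (xs⊂Y j) ne

    direct-spine : ∀ {wd k} (C : Direct xs k) {ys} → (∀ {y} → y ∈ ys → y ∈ Direct.ys C) →
                   (∀ {y} → y ∈ ys → ∃ λ m → Hang wd D (P (Direct.w C)) y m []) → Spine wd D ys
    direct-spine C {ys} f h = record
      { Π = P w ; Π⊂ = P⊂ w∈ ; indΠ = indP w∈ ; k = λ _ → [] ; pos = proj₁ ch ; hang = proj₂ ch _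
      ; apart = λ i j → bare-apart (from (f i)) (from (f j)) }
      where
      open Direct C using (w; w∈; from)
      ch = choose ys 0 (λ y i → h i)

    module BlockSide (block′ : ∀ {x u w} → D x → D u → D w → x ~ u → x ~ w → u ≢ w → Comp x u w → u ~ w)
      (noClaw : ∀ {a b c} → a ∈ zs → b ∈ zs → c ∈ zs → a ≢ b → a ≢ c → b ≢ c → ¬ Claw D a b c)
      (noMid : ∀ {a b c} → a ∈ zs → b ∈ zs → c ∈ zs → a ≢ b → a ≢ c → b ≢ c → ¬ Mid D a b c) where

      -- A contact would put `v` and the successor `q` of `u` into one component of `D` minus `u`.
      -- Both are neighbours of `u`, so `block′` makes them adjacent, although they are at distance
      -- two on an induced path.
      under : ∀ {v u u′ r r′} → D v → Ind (v ∷ u ∷ r) → Ind (v ∷ u′ ∷ r′) → u ∷ r ⊂ D → u′ ∷ r′ ⊂ D → u ≢ u′ → r ⟂⟂ u′ ∷ r′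
      under {r = []}    dv iy iz su tu ne ()
      under {v} {u} {u′} {q ∷ r} {r′} dv iy iz su tu ne {a} {b} i j = comp-closed ca (tu j) (not-u j) λ cb →
          proj₂ (ind-tail-⟂ iy (here refl)) (block′ (su (here refl)) dv (su (there (here refl))) (~-sym vu) (proj₁ (proj₁ (proj₂ iy)))
            (λ { refl → proj₁ (ind-tail-⟂ iy (here refl)) refl }) (walk-++ (cv j) (walk-sym cb)))
        where
        vu : v ~ u
        vu = proj₁ (proj₁ iy)
        not-u : ∀ {x} → x ∈ u′ ∷ r′ → x ≢ u
        not-u (here refl) e    = ne (sym e)
        not-u (there k)   refl = proj₂ (ind-tail-⟂ iz k) vu
        ca : Comp u q a
        ca = walk-map (λ m → su (there m) , λ e → ind-≢ (proj₂ iy) m (sym e)) (ind-walk (q ∷ r) (proj₂ (proj₂ iy)) (here refl) i)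
        cv : ∀ {x} → x ∈ u′ ∷ r′ → Comp u v x
        cv k = step (dv , ~⇒≢ vu) (proj₁ (proj₁ iz)) (walk-map (λ m → tu m , not-u m) (ind-walk (u′ ∷ r′) (proj₂ iz) (here refl) k))

      module Pair {y z : Vtx} (i : y ∈ xs) (j : z ∈ xs) (ne : y ≢ z) (yz : ¬ touch y z) (zy : ¬ touch z y) (F : Fork (P y) (P z)) where
        open Split i j ne yz zy F public
        open Below (split i j ne yz zy F) public

        -- Nonadjacent heads would lie in different components of `D` minus `v`; then `v` is the
        -- centre of a claw with leaves `y₀`, `y` and `z`.
        uu′ : u ~ u′
        uu′ with u ~? u′
        ... | yes e = e
        ... | no n  = ⊥-elim (noClaw zy₀ (proj₁ (xs⊂ i)) (proj₁ (xs⊂ j)) (y₀≢ i) (y₀≢ j) ne (record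
            { inD = dv ; k₁ = pre ; k₂ = reverse s ; k₃ = reverse t
            ; s₁ = λ k → P⊂ i (subst (_ ∈_) (sym eqˡ) (∈-++⁺ˡ k)) ; s₂ = λ k → s⊂ (reverse⁻ k) ; s₃ = λ k → t⊂ (reverse⁻ k)
            ; i₁ = up ; i₂ = ind-flip s down-y ; i₃ = ind-flip t down-z
            ; p₁₂ = λ k m → up-y k (flip∈ s m) ; p₁₃ = λ k m → up-z k (flip∈ t m)
            ; p₂₃ = λ k m → with-ends (λ a → a) (λ a → a)
                (s-apart λ C → n (block′ dv (su (here refl)) (tu (here refl)) vu vu′ u≢u′ C)) (flip∈ s k) (flip∈ t m) }))
          where
          flip∈ : ∀ {b x} l → x ∈ b ∷ reverse l → x ∈ l ++ [ b ]
          flip∈ l (here refl) = ∈-++⁺ʳ l (here refl)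
          flip∈ l (there k)   = ∈-++⁺ˡ {xs = l} (reverse⁻ {xs = l} k)

        r-apart : r ++ [ y ] ⟂⟂ t ++ [ z ]
        r-apart = with-ends (λ k → subst (_ ∈_) (sym eqs) (there k)) (λ k → k)
          (subst (r ⟂⟂_) (sym eqt) (under dv iy iz su tu u≢u′))

        r′-apart : s ++ [ y ] ⟂⟂ r′ ++ [ z ]
        r′-apart = with-ends (λ k → k) (λ k → subst (_ ∈_) (sym eqt) (there k))
          (⟂⟂-sym (subst (r′ ⟂⟂_) (sym eqs) (under dv iz iy tu su (u≢u′ ∘ sym))))

        -- The head `u` of the leg sees the fork and the next vertex `u′` of the other branch; all
        -- further contact is excluded by `r-apart` and `r′-apart`.
        fork-hang : Hang 1 D (P z) y (pred (c y z)) (drop (c y z) (P y))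
        fork-hang = hang 1 i j ne yz zy F (subst (λ l → 1 ≤ length l) (sym eqt) (s≤s z≤n)) joined′ only′
          where
          joined′ : ∀ {k x} → At t k x → k < 1 → hd s y ~ x
          joined′ {k} {x} A l = go (subst (λ l → At l k x) eqt A) l
            where
            go : ∀ {k x} → At (u′ ∷ r′) k x → k < 1 → hd s y ~ x
            go here      _        = subst (λ l → hd l y ~ u′) (sym eqs) uu′
            go (there _) (s≤s ())
          only′ : ∀ {k x a} → At t k x → a ∈ s ++ [ y ] → a ≢ x × (a ~ x → a ≡ hd s y × k < 1)
          only′ {k} {x} {a} A m = go (subst (λ l → At l k x) eqt A) (subst (λ l → a ∈ l ++ [ y ]) eqs m)
            where
            head-s : u ≡ hd s y
            head-s = subst (λ l → u ≡ hd l y) (sym eqs) refl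
            go : ∀ {k x a} → At (u′ ∷ r′) k x → a ∈ u ∷ r ++ [ y ] → a ≢ x × (a ~ x → a ≡ hd s y × k < 1)
            go here      (here refl) = u≢u′ , λ _ → head-s , s≤s z≤n
            go here      (there m)   = ⟂⇒ (r-apart m (∈-++⁺ˡ (subst (u′ ∈_) (sym eqt) (here refl))))
            go (there B) m           = ⟂⇒ (r′-apart (subst (λ l → _ ∈ l ++ [ y ]) (sym eqs) m) (∈-++⁺ˡ (at-∈ B)))

      module _ {K : ℕ} (C : Comb xs K) where
        open Comb C

        private
          module Pr {y z : Vtx} (i : y ∈ w ∷ ys) (j : z ∈ w ∷ ys) (ne : y ≢ z) where
            open Between C i j ne public
            open Pair (xs∈ i) (xs∈ j) ne yz zy F public

        tooth : Vtx → Vtx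
        tooth y = hd (drop (c y w) (P y)) y

        -- Branches that leave the pivot at the same vertex also part from each other there, so
        -- their teeth are the two heads at their common fork.
        teeth-adjacent : ∀ {y z} → y ∈ ys → z ∈ ys → y ≢ z → c y w ≡ c z w → tooth y ~ tooth z
        teeth-adjacent {y} {z} i j ne e = subst₂ _~_ (eq₁ same) (eq₂ same) Q.uu′
          where
          module Q = Pr (there i) (there j) ne
          same : c y z ≡ c y w
          same = ≤-antisym (proj₁ (below i j ne)) (cpl-ultra (P y) (P w) (P z) ≤-refl (≤-reflexive (trans e (cpl-sym (P z) (P w)))))
          eq₁ : c y z ≡ c y w → Q.u ≡ tooth y
          eq₁ q = hd-≡ (trans (cong (λ d → drop d (P y)) (sym q)) (fork-drop Q.F)) Q.eqs
          eq₂ : c y z ≡ c y w → Q.u′ ≡ tooth z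
          eq₂ q = hd-≡ (trans (cong (λ d → drop d (P z)) (trans (sym e) (sym q))) (fork-dropʳ Q.F)) Q.eqt

        -- By the strict inequality the leg of `y` begins after the head `u` at the fork with `z`,
        -- and nothing after `u` has contact with the continuation towards `z`.
        teeth-apart : ∀ {y z} → y ∈ ys → z ∈ ys → y ≢ z → c y z < c y w → drop (c y w) (P y) ++ [ y ] ⟂⟂ drop (c z w) (P z) ++ [ z ]
        teeth-apart {y} {z} i j ne l a b = Q.r-apart
            ([ (λ k → ∈-++⁺ˡ (in-r k)) , (λ k → ∈-++⁺ʳ Q.r k) ]′ (∈-++⁻ (drop (c y w) (P y)) a))
            ([ (λ k → ∈-++⁺ˡ (subst (_ ∈_) (fork-dropʳ Q.F) (drop-⊂ (P z) (proj₂ (below i j ne)) k))) , (λ k → ∈-++⁺ʳ Q.t k) ]′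
              (∈-++⁻ (drop (c z w) (P z)) b))
          where
          module Q = Pr (there i) (there j) ne
          in-r : ∀ {x} → x ∈ drop (c y w) (P y) → x ∈ Q.r
          in-r {x} k = subst (x ∈_) (trans (drop-suc (c y z) (P y)) (cong (drop 1) (trans (fork-drop Q.F) Q.eqs))) (drop-⊂ (P y) l k)
            where
            drop-suc : ∀ n (l : List Vtx) → drop (suc n) l ≡ drop 1 (drop n l)
            drop-suc zero    l       = refl
            drop-suc (suc n) []      = refl
            drop-suc (suc n) (x ∷ l) = drop-suc n l

        comb-spine : ∀ {ys′} → (∀ {y} → y ∈ ys′ → y ∈ ys) → (∀ {y z} → y ∈ ys′ → z ∈ ys′ → y ≢ z → c y w ≢ c z w) →
                     Σ (Spine 1 D ys′) Apart
        comb-spine {ys′} f d = record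
          { Π = P w ; Π⊂ = P⊂ w∈ ; indΠ = indP w∈ ; k = λ y → drop (c y w) (P y) ; pos = λ y → pred (c y w)
          ; hang = λ i → Pr.fork-hang (there (f i)) (here refl) (w≢ (f i))
          ; apart = apart′ } , λ {y} {z} i j ne e → d i j ne (trans (sym (positive i)) (trans (cong suc e) (positive j)))
          where
          positive : ∀ {y} → y ∈ ys′ → suc (pred (c y w)) ≡ c y w
          positive {y} i rewrite Fork.depth (forkP (from (f i)) w∈) = refl
          apart′ : ∀ {y z} → y ∈ ys′ → z ∈ ys′ → y ≢ z → drop (c y w) (P y) ++ [ y ] ⟂⟂ drop (c z w) (P z) ++ [ z ]
          apart′ {y} {z} i j ne with m≤n⇒m<n∨m≡n (proj₁ (below (f i) (f j) ne)) | m≤n⇒m<n∨m≡n (proj₂ (below (f i) (f j) ne))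
          ... | inj₁ l | _      = teeth-apart (f i) (f j) ne l
          ... | inj₂ e | inj₂ g = ⊥-elim (d i j ne (trans (sym e) g))
          ... | inj₂ _ | inj₁ l = ⟂⟂-sym (teeth-apart (f j) (f i) (ne ∘ sym) (subst (_< c z w) (cpl-sym (P y) (P z)) l))

  -- Spines harvested from minimal sides

  hom-lookup₁ : ∀ {X : Set} {R : Rel X 1} (xs : List X) → Hom 1 R xs → ∀ i → R (lookup xs i)
  hom-lookup₁ (x ∷ xs) (r , h) fzero    = r
  hom-lookup₁ (x ∷ xs) (r , h) (fsuc i) = hom-lookup₁ xs h i

  hom-lookup : ∀ {X : Set} {R : Rel X 2} (xs : List X) → Hom 2 R xs → ∀ i j → toℕ i < toℕ j → R (lookup xs i) (lookup xs j)
  hom-lookup (x ∷ xs) (r , h) fzero    (fsuc j) _       = hom-lookup₁ xs r j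
  hom-lookup (x ∷ xs) (r , h) (fsuc i) (fsuc j) (s≤s l) = hom-lookup xs h i j l

  unique-lookup : ∀ {X : Set} (xs : List X) → Hom 2 _≢_ xs → ∀ i j → i ≢ j → lookup xs i ≢ lookup xs j
  unique-lookup xs u i j ne e with <-cmp (toℕ i) (toℕ j)
  ... | tri< l _ _ = hom-lookup xs u i j l e
  ... | tri≈ _ q _ = ne (toℕ-injective q)
  ... | tri> _ _ l = hom-lookup xs u j i l (sym e)

  clique : ∀ {t} (f : Vtx → Vtx) (ys : List Vtx) → Hom 2 _≢_ ys → t ≤ length ys →
           (∀ {y z} → y ∈ ys → z ∈ ys → y ≢ z → f y ~ f z) → HasClique G t
  clique {t} f ys u l adj = g , inj , edge
    where
    at : Fin t → Vtx
    at i = lookup ys (inject≤ i l)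
    g : Fin t → Vtx
    g = f ∘ at
    edge : ∀ i j → i ≢ j → g i ~ g j
    edge i j ne = adj (∈-lookup {xs = ys} (inject≤ i l)) (∈-lookup {xs = ys} (inject≤ j l))
      (unique-lookup ys u _ _ λ e → ne (inject≤-injective l l i j e))
    inj : ∀ i j → g i ≡ g j → i ≡ j
    inj i j e with i ≟ j
    ... | yes q = q
    ... | no ne = ⊥-elim (~⇒≢ (edge i j ne) e)

  -- The entries are distinct, so two of them cannot both equal `v`; this is the 2 in `ram 1 2`.
  avoid : ∀ {m} (v : Vtx) (xs : List Vtx) → Hom 2 _≢_ xs → ram 1 2 m ≤ length xs → Σ (Select xs m) λ s → Hom 1 (_≢ v) (Select.ys s)
  avoid {m} v xs u l with selectRam 1 (_≡ v) (λ x → x ≟ v) 2 m xs l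
  ... | inj₂ r = r
  ... | inj₁ (s@(select {[]} () _) , _)
  ... | inj₁ (s@(select {_ ∷ []} (s≤s ()) _) , _)
  ... | inj₁ (s@(select {x ∷ y ∷ _} _ _) , (e , f , _)) = ⊥-elim (proj₁ (proj₁ (Select.keep s 2 {_≢_} u)) (trans e (sym f)))

  at-split : ∀ (l : List Vtx) {k v} → At l k v → ∃ λ pre → ∃ λ post → l ≡ pre ++ v ∷ post × length pre ≡ k
  at-split (x ∷ l) here      = [] , l , refl , refl
  at-split (x ∷ l) (there a) = let pre , post , e , f = at-split l a in x ∷ pre , post , cong (x ∷_) e , cong suc f

  via : ∀ {y z a b} l → Ind l → y ≢ z → a ∈ l → y ~ a → b ∈ l → z ~ b → ∃ λ m → m ⊂ (_∈ l) × Ind (y ∷ m ++ [ z ])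
  via l i ne a∈ ya b∈ zb
    with path ne (step (inj₂ (inj₁ refl)) ya (walk-snoc (walk-map inj₁ (ind-walk l i a∈ b∈)) (~-sym zb) (inj₂ (inj₂ refl))))
  ... | m , p , s = m , s , p

  some : ∀ {X : Set} {xs : List X} {m} → suc m ≤ length xs → ∃ λ x → x ∈ xs
  some {xs = x ∷ _} _ = x , here refl

  hang-before : ∀ {wd D Π y p k pre post} → Hang wd D Π y p k → Π ≡ pre ++ post → length pre ≤ p →
                ∀ {u x} → u ∈ k ++ [ y ] → x ∈ pre → u ⟂ x
  hang-before H refl l i j =
    (λ { refl → Hang.off H i (∈-++⁺ˡ j) }) ,
    λ e → let m , A = ∈-at j in <-irrefl refl (≤-trans (≤-trans (at-< A) l) (proj₁ (proj₂ (Hang.only H (at-++ˡ A) i e))))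

  module _ {zs : List Vtx} {D : Vtx → Set} (side : Side (_∈ zs) D) (min : Minimal (_∈ zs) D) (Z⊂Y : ∀ {v} → v ∈ zs → Y v) where
    open Tails side min Z⊂Y

    -- Direct hits see an edge of the pivot's branch, since `verdict` would otherwise give a claw or
    -- a `Mid`. In a comb, `t` teeth at the same vertex would be a clique, so Ramsey's theorem
    -- selects teeth at distinct vertices.
    harvestB : ∀ t k → ¬ HasClique G t →
      (∀ {a b c} → a ∈ zs → b ∈ zs → c ∈ zs → a ≢ b → a ≢ c → b ≢ c → ¬ Claw D a b c) →
      (∀ {a b c} → a ∈ zs → b ∈ zs → c ∈ zs → a ≢ b → a ≢ c → b ≢ c → ¬ Mid D a b c) →
      Hom 2 _≢_ zs → sizeB t k ≤ length zs → ¬ ¬ Σ (Select zs k) λ s → Σ (Spine 1 D (Select.ys s)) Apart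
    harvestB t k noClique noClaw noMid u l = do
      R ← root (proj₂ (some l))
      return (go R (avoid (Root.y₀ R) zs u (≤-trans (n≤1+n _) l)))
      where
      go : (R : Root) → (Σ (Select zs (extractSize (k + ram 2 t k))) λ s → Hom 1 (_≢ Root.y₀ R) (Select.ys s)) →
           Σ (Select zs k) λ s → Σ (Spine 1 D (Select.ys s)) Apart
      go R (s , ne) = pick (extract (k + ram 2 t k) xs (keep 2 {_≢_} u) size)
        where
        open Select s renaming (ys to xs)
        open Family side min Z⊂Y R xs (λ i → from i , hom₁ ne i)
        open BlockSide (block noClaw) noClaw noMid
        pick : Direct xs (k + ram 2 t k) ⊎ Comb xs (k + ram 2 t k) → Σ (Select zs k) λ s → Σ (Spine 1 D (Select.ys s)) Apart
        pick (inj₁ C) = select-trans s (select (≤-trans (m≤m+n k _) C.size) C.sub) , direct-spine C (λ i → i) pairs , distinct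
          where
          module C = Direct C
          pairs : ∀ {y} → y ∈ C.ys → ∃ λ m → Hang 1 D (P C.w) y m []
          pairs i with hit-verdict (C.from i) C.w∈ (C.w≢ i) (C.hits i)
          ... | inj₁ (_ , _ , claw) = ⊥-elim (noClaw (Root.zy₀ R) (from C.w∈) (from (C.from i)) (y₀≢ C.w∈) (y₀≢ (C.from i)) (C.w≢ i ∘ sym) claw)
          ... | inj₂ (inj₁ (m , h , _)) = m , h
          ... | inj₂ (inj₂ (_ , _ , _ , inj₁ claw)) =
                ⊥-elim (noClaw (Root.zy₀ R) (from C.w∈) (from (C.from i)) (y₀≢ C.w∈) (y₀≢ (C.from i)) (C.w≢ i ∘ sym) claw)
          ... | inj₂ (inj₂ (_ , _ , _ , inj₂ mid)) =
                ⊥-elim (noMid (from (C.from i)) (Root.zy₀ R) (from C.w∈) (y₀≢ (C.from i) ∘ sym) (C.w≢ i) (y₀≢ C.w∈) mid)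
          S = direct-spine C {C.ys} (λ i → i) pairs
          -- Two vertices attached to the same edge of the path would be leaves of a claw.
          distinct : Apart S
          distinct {y} {z} i j ne e = clawed (at-exists (P C.w) (≤-trans (s≤s (m≤m+n _ 1)) (Hang.fits (Spine.hang S i))))
            where
            Hy = Spine.hang S i
            Hz = Spine.hang S j
            clawed : (∃ λ v → At (P C.w) (Spine.pos S y) v) → ⊥
            clawed (v , A) with at-split (P C.w) A
            ... | pre , post , eq , len = noClaw (Root.zy₀ R) (from (C.from i)) (from (C.from j)) (y₀≢ (C.from i)) (y₀≢ (C.from j)) ne (record
                  { inD = P⊂ C.w∈ (at-∈ A) ; k₁ = pre ; k₂ = [] ; k₃ = []
                  ; s₁ = λ m → P⊂ C.w∈ (subst (_ ∈_) (sym eq) (∈-++⁺ˡ m)) ; s₂ = λ () ; s₃ = λ ()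
                  ; i₁ = proj₁ (halves pre (subst (λ l → Ind (_ ∷ l ++ [ C.w ])) eq (pivot-path C.w∈)))
                  ; i₂ = (Hang.joined Hy A ≤-refl (m≤m+n _ 1) , λ ()) , tt , tt
                  ; i₃ = (Hang.joined Hz A (≤-reflexive (sym e)) (≤-trans (≤-reflexive e) (m≤m+n _ 1)) , λ ()) , tt , tt
                  ; p₁₂ = low i Hy (≤-reflexive len) ; p₁₃ = low j Hz (≤-reflexive (trans len e))
                  ; p₂₃ = bare-apart (C.from i) (C.from j) ne })
              where
              low : ∀ {y p} → y ∈ C.ys → Hang 1 D (P C.w) y p [] → length pre ≤ p → Root.y₀ R ∷ pre ⟂⟂ [ y ]
              low i H l (here refl) (here refl) = far (Z⊂Y (Root.zy₀ R)) (xs⊂Y (C.from i)) (y₀≢ (C.from i))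
              low i H l (there m)   (here refl) = ⟂-sym (hang-before H eq l (here refl) m)
        pick (inj₂ C) with selectRam 2 (λ y z → c y C.w ≡ c z C.w) (λ y z → c y C.w ≟ⁿ c z C.w) t k C.ys (≤-trans (m≤n+m _ k) C.size)
          where module C = Comb C
        ... | inj₁ (s′ , h) = ⊥-elim (noClique (clique (tooth C) (Select.ys s′)
                (Select.keep s′ 2 {_≢_} (Select.keep C.sel 2 {_≢_} (keep 2 {_≢_} u))) (Select.size s′)
                λ i j ne → teeth-adjacent C (Select.from s′ i) (Select.from s′ j) ne (hom₂ h sym i j ne)))
          where module C = Comb C
        ... | inj₂ (s′ , h) = select-trans s (select-trans C.sel s′) ,
                comb-spine C (Select.from s′) λ i j ne → hom₂ h (λ n e → n (sym e)) i j ne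
          where module C = Comb C

    -- If `hi` exceeded `suc lo′`, both `y` and `z` would have neighbours on `Π` up to `lo′` and
    -- also from `lo′ + 2` on. This gives two paths of a theta with ends `y` and `z`; the third runs
    -- through `E`.
    nearly-disjoint : ∀ {E} → Side (_∈ zs) E → (∀ {u v} → D u → E v → u ⟂ v) → ∀ {Π y z lo hi lo′ hi′} → Π ⊂ D → Ind Π →
              y ∈ zs → z ∈ zs → y ≢ z → Spread Π y lo hi → Spread Π z lo′ hi′ → lo ≤ lo′ → hi ≤ suc lo′
    nearly-disjoint {E} sideE DE {Π} {y} {z} {lo} {hi} {lo′} {hi′} s ip zy zz ne S T l with hi ≤? suc lo′
    ... | yes p = p
    ... | no p  = ⊥-elim (go (at-exists Π (≤-trans (s≤s (≤-trans (n≤1+n _) (≤-trans (n≤1+n _) (Spread.gap T)))) (Spread.fits T))))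
      where
      far-hi : suc (suc lo′) ≤ hi
      far-hi = ≰⇒> p
      go : (∃ λ v → At Π lo′ v) → ⊥
      go (v , A) with at-split Π A
      ... | L , [] , eq , len = <-irrefl (sym (trans (cong length eq) (trans (length-mid L) (cong suc (trans (+-identityʳ _) len)))))
              (≤-trans (Spread.gap T) (≤-trans (n≤1+n _) (Spread.fits T)))
      ... | L , x ∷ R , eq , len = noTheta (theta (stable _ _ (Z⊂Y zy) (Z⊂Y zz)) m₁ m₂ m₃ i₁ i₂ i₃
            (λ i j → LR (s₁ i) (s₂ j)) (λ i j → DE (L⊂ (s₁ i)) (s₃ j)) (λ i j → DE (R⊂ (s₂ i)) (s₃ j)))
        where
        L₁ : List Vtx
        L₁ = L ++ [ v ]
        eq₁ : Π ≡ L₁ ++ x ∷ R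
        eq₁ = trans eq (sym (++-assoc L [ v ] (x ∷ R)))
        len₁ : length L₁ ≡ suc lo′
        len₁ = trans (length-++ L) (trans (+-comm (length L) 1) (cong suc len))
        indΠ : Ind (L₁ ++ x ∷ R)
        indΠ = subst Ind eq₁ ip
        LR : L₁ ⟂⟂ R
        LR = ind-apart L₁ indΠ
        L⊂ : L₁ ⊂ D
        L⊂ i = s (subst (_ ∈_) (sym eq₁) (∈-++⁺ˡ i))
        R⊂ : R ⊂ D
        R⊂ i = s (subst (_ ∈_) (sym eq₁) (∈-++⁺ʳ L₁ (there i)))
        left : ∀ {w k} → k ≤ lo′ → k < length Π → (∀ {u} → At Π k u → w ~ u) → ∃ λ u → u ∈ L₁ × w ~ u
        left {w} {k} kl kf f with at-exists Π kf
        ... | u , B with at-mid L₁ (subst (λ l → At l k u) eq₁ B)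
        ...   | inj₁ i                     = u , i , f B
        ...   | inj₂ (inj₁ (_ , q))        = ⊥-elim (<-irrefl (trans q len₁) (s≤s kl))
        ...   | inj₂ (inj₂ (j , _ , q))    = ⊥-elim (<-irrefl q (s≤s (≤-trans (≤-trans kl (≤-trans (n≤1+n _) (≤-reflexive (sym len₁)))) (m≤m+n _ j))))
        right : ∀ {w k} → suc (suc lo′) ≤ k → k < length Π → (∀ {u} → At Π k u → w ~ u) → ∃ λ u → u ∈ R × w ~ u
        right {w} {k} kl kf f with at-exists Π kf
        ... | u , B with at-++⁻ L₁ (subst (λ l → At l k u) eq₁ B)
        ...   | inj₁ C                 = ⊥-elim (<-irrefl refl (≤-trans (≤-trans (at-< C) (≤-reflexive len₁)) (≤-trans (n≤1+n _) kl)))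
        ...   | inj₂ (_ , q , here)    = ⊥-elim (<-irrefl (sym (trans q (trans (+-identityʳ _) len₁))) kl)
        ...   | inj₂ (_ , _ , there C) = u , at-∈ C , f B
        a₁ = left l (≤-trans (s≤s (≤-trans l (≤-trans (n≤1+n _) (≤-trans (n≤1+n _) (Spread.gap T))))) (Spread.fits T)) (Spread.at-lo S)
        b₁ = left ≤-refl (≤-trans (s≤s (≤-trans (n≤1+n _) (≤-trans (n≤1+n _) (Spread.gap T)))) (Spread.fits T)) (Spread.at-lo T)
        a₂ = right far-hi (Spread.fits S) (Spread.at-hi S)
        b₂ = right (Spread.gap T) (Spread.fits T) (Spread.at-hi T)
        v₁ = via L₁ (ind-++ˡ L₁ indΠ) ne (proj₁ (proj₂ a₁)) (proj₂ (proj₂ a₁)) (proj₁ (proj₂ b₁)) (proj₂ (proj₂ b₁))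
        v₂ = via R (proj₂ (ind-++ʳ L₁ indΠ)) ne (proj₁ (proj₂ a₂)) (proj₂ (proj₂ a₂)) (proj₁ (proj₂ b₂)) (proj₂ (proj₂ b₂))
        v₃ = through sideE (Z⊂Y zy) (Z⊂Y zz) zy zz ne
        m₁ = proj₁ v₁
        m₂ = proj₁ v₂
        m₃ = proj₁ v₃
        s₁ : m₁ ⊂ (_∈ L₁)
        s₁ = proj₁ (proj₂ v₁)
        s₂ : m₂ ⊂ (_∈ R)
        s₂ = proj₁ (proj₂ v₂)
        s₃ : m₃ ⊂ E
        s₃ = proj₁ (proj₂ v₃)
        i₁ = proj₂ (proj₂ v₁)
        i₂ = proj₂ (proj₂ v₂)
        i₃ = proj₂ (proj₂ v₃)

    harvestA : ∀ k {E} → Side (_∈ zs) E → (∀ {u v} → D u → E v → u ⟂ v) →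
      (∀ {a b c} → a ∈ zs → b ∈ zs → c ∈ zs → a ≢ b → a ≢ c → b ≢ c → ¬ Tri D a b c) →
      Hom 2 _≢_ zs → sizeA k ≤ length zs → ¬ ¬ Σ (Select zs k) λ s → Spine 0 D (Select.ys s) ⊎ Interval D (Select.ys s)
    harvestA k {E} sideE DE noTri u l = do
      R ← root (proj₂ (some l))
      go R (avoid (Root.y₀ R) zs u (≤-trans (n≤1+n _) l))
      where
      Result : Set
      Result = Σ (Select zs k) λ s → Spine 0 D (Select.ys s) ⊎ Interval D (Select.ys s)
      go : (R : Root) → (Σ (Select zs (extractSize (k + ram 1 k k))) λ s → Hom 1 (_≢ Root.y₀ R) (Select.ys s)) → ¬ ¬ Result
      go R (s , ne) = pick (extract (k + ram 1 k k) xs (keep 2 {_≢_} u) size)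
        where
        open Select s renaming (ys to xs)
        open Family side min Z⊂Y R xs (λ i → from i , hom₁ ne i)
        pick : Direct xs (k + ram 1 k k) ⊎ Comb xs (k + ram 1 k k) → ¬ ¬ Result
        pick (inj₂ C) = return (select-trans s (select (≤-trans (m≤m+n k _) C.size) C.sub) , inj₁ (TreeSide.comb-spine (forest noTri sideE DE) C))
          where module C = Comb C
        pick (inj₁ C) = do
          -- Being single is an existential statement, so it is settled classically for all vertices
          -- before Ramsey's theorem needs it as a decidable colouring.
          d ← ¬¬-Fin (λ y → em (Single y))
          return (sort d)
          where
          module C = Direct C
          Single : Vtx → Set
          Single y = ∃ λ m → Hang 0 D (P C.w) y m []
          sort : (∀ y → Dec (Single y)) → Result
          sort d with selectRam 1 Single d k k C.ys (≤-trans (m≤n+m _ k) C.size)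
          ... | inj₁ (s′ , h) = select-trans s (select-trans C.sel s′) , inj₁ (direct-spine C (Select.from s′) (hom₁ h))
          ... | inj₂ (s′ , h) = select-trans s (select-trans C.sel s′) , inj₂ (record
                { Π = P C.w ; Π⊂ = P⊂ C.w∈ ; indΠ = indP C.w∈ ; lo = proj₁ ∘ proj₁ ch ; hi = proj₂ ∘ proj₁ ch
                ; spreads = λ i → proj₂ ch _ i
                ; order = λ i j ne → nearly-disjoint sideE DE (P⊂ C.w∈) (indP C.w∈) (up i) (up j) ne (proj₂ ch _ i) (proj₂ ch _ j) })
            where
            up : ∀ {y} → y ∈ Select.ys s′ → y ∈ zs
            up i = from (C.from (Select.from s′ i))
            wide : ∀ y → y ∈ Select.ys s′ → ∃ λ p → Spread (P C.w) y (proj₁ p) (proj₂ p)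
            wide y i with hit-verdict (C.from (Select.from s′ i)) C.w∈ (C.w≢ (Select.from s′ i)) (C.hits (Select.from s′ i))
            ... | inj₁ (m , H , _) = ⊥-elim (hom₁ h i (m , H))
            ... | inj₂ (inj₁ (_ , _ , tri)) =
                  ⊥-elim (noTri (Root.zy₀ R) (from C.w∈) (up i) (y₀≢ C.w∈) (y₀≢ (C.from (Select.from s′ i))) (C.w≢ (Select.from s′ i) ∘ sym) tri)
            ... | inj₂ (inj₂ (lo , hi , S , _)) = (lo , hi) , S
            ch : Σ (Vtx → ℕ × ℕ) λ f → ∀ y → y ∈ Select.ys s′ → Spread (P C.w) y (proj₁ (f y)) (proj₂ (f y))
            ch = choose (Select.ys s′) (0 , 0) wide

  -- Segments, reversals and detours of paths

  at-dropʳ : ∀ a (l : List Vtx) {j x} → At (drop a l) j x → At l (a + j) x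
  at-dropʳ zero    l       A = A
  at-dropʳ (suc a) (y ∷ l) A = there (at-dropʳ a l A)

  at-drop : ∀ a (l : List Vtx) {j x} → At l (a + j) x → At (drop a l) j x
  at-drop zero    l       A         = A
  at-drop (suc a) (y ∷ l) (there A) = at-drop a l A

  at-takeʳ : ∀ n (l : List Vtx) {j x} → At (take n l) j x → At l j x × j < n
  at-takeʳ (suc n) (y ∷ l) here      = here , s≤s z≤n
  at-takeʳ (suc n) (y ∷ l) (there A) = let B , q = at-takeʳ n l A in there B , s≤s q

  at-take : ∀ n (l : List Vtx) {j x} → At l j x → j < n → At (take n l) j x
  at-take (suc n) (y ∷ l) here      _       = here
  at-take (suc n) (y ∷ l) (there A) (s≤s q) = there (at-take n l A q)

  slice : ℕ → ℕ → List Vtx → List Vtx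
  slice a n l = take n (drop a l)

  at-slice : ∀ a n (l : List Vtx) {j x} → At l (a + j) x → j < n → At (slice a n l) j x
  at-slice a n l A q = at-take n (drop a l) (at-drop a l A) q

  at-sliceʳ : ∀ a n (l : List Vtx) {j x} → At (slice a n l) j x → At l (a + j) x × j < n
  at-sliceʳ a n l A = let B , q = at-takeʳ n (drop a l) A in at-dropʳ a l B , q

  ind-slice : ∀ a n l → Ind l → Ind (slice a n l)
  ind-slice a n l p = ind-++ˡ (take n (drop a l)) (subst Ind (sym (take++drop≡id n (drop a l)))
    (ind-++ʳ (take a l) (subst Ind (sym (take++drop≡id a l)) p)))

  slice⊂ : ∀ a n l {P} → l ⊂ P → slice a n l ⊂ P
  slice⊂ a n l s i = let j , A = ∈-at i in s (at-∈ (proj₁ (at-sliceʳ a n l A)))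

  ind-++ : ∀ x l {h m} → Ind (x ∷ l) → Ind (h ∷ m) →
           (∀ {u v} → u ∈ x ∷ l → v ∈ h ∷ m → u ≢ v × (u ~ v → u ≡ lastOf x l × v ≡ h)) → lastOf x l ~ h →
           Ind (x ∷ l ++ h ∷ m)
  ind-++ x []      {h} {m} p q f e = (e , λ j → let d , g = f (here refl) (there j) in d , λ z → ind-≢ q j (sym (proj₂ (g z)))) , q
  ind-++ x (y ∷ l) {h} {m} ((a , b) , p) q f e =
    (a , λ j → [ b , away ]′ (∈-++⁻ l j)) , ind-++ y l p q (λ i → f (there i)) e
    where
    away : ∀ {v} → v ∈ h ∷ m → x ⟂ v
    away j = let d , g = f (here refl) j in d , λ z → ind-≢ ((a , b) , p) (lastOf-∈ y l) (proj₁ (g z))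

  hd-∷ : ∀ k y → ∃ λ m → k ++ [ y ] ≡ hd k y ∷ m
  hd-∷ []      y = [] , refl
  hd-∷ (x ∷ k) y = k ++ [ y ] , refl

  lastOf-reverse : ∀ k y → lastOf y (reverse k) ≡ hd k y
  lastOf-reverse []      y = refl
  lastOf-reverse (x ∷ k) y = trans (cong (lastOf y) (unfold-reverse x k)) (lastOf-∷ʳ y (reverse k) x)

  leg-reverse : ∀ k y → Ind (k ++ [ y ]) → Ind (y ∷ reverse k)
  leg-reverse k y p = subst Ind (reverse-++ k [ y ]) (ind-reverse (k ++ [ y ]) p)

  ∈-leg : ∀ (k : List Vtx) {y u : Vtx} → u ∈ y ∷ reverse k → u ∈ k ++ [ y ]
  ∈-leg k (here refl) = ∈-++⁺ʳ k (here refl)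
  ∈-leg k (there i)   = ∈-++⁺ˡ {xs = k} (reverse⁻ {xs = k} i)

  wrap : ∀ {y₁ yₙ} k₁ kₙ f arc → Ind (k₁ ++ [ y₁ ]) → Ind (kₙ ++ [ yₙ ]) → Ind (f ∷ arc) →
         (∀ {u x} → u ∈ k₁ ++ [ y₁ ] → x ∈ f ∷ arc → u ≢ x × (u ~ x → u ≡ hd k₁ y₁ × x ≡ f)) → hd k₁ y₁ ~ f →
         (∀ {u x} → u ∈ kₙ ++ [ yₙ ] → x ∈ f ∷ arc → u ≢ x × (u ~ x → u ≡ hd kₙ yₙ × x ≡ lastOf f arc)) → hd kₙ yₙ ~ lastOf f arc →
         k₁ ++ [ y₁ ] ⟂⟂ kₙ ++ [ yₙ ] → Ind (y₁ ∷ (reverse k₁ ++ (f ∷ arc) ++ kₙ) ++ [ yₙ ])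
  wrap {y₁} {yₙ} k₁ kₙ f arc i₁ iₙ ia c₁ e₁ cₙ eₙ ap = subst (λ l → Ind (y₁ ∷ l)) eq
    (ind-++ y₁ (reverse k₁) (leg-reverse k₁ y₁ i₁) second
      (λ i j → cross₁ (∈-leg k₁ i) (∈-++⁻ (f ∷ arc) j)) (subst (_~ f) (sym (lastOf-reverse k₁ y₁)) e₁))
    where
    m = proj₁ (hd-∷ kₙ yₙ)
    hm : kₙ ++ [ yₙ ] ≡ hd kₙ yₙ ∷ m
    hm = proj₂ (hd-∷ kₙ yₙ)
    second : Ind (f ∷ arc ++ (kₙ ++ [ yₙ ]))
    second = subst (λ l → Ind (f ∷ arc ++ l)) (sym hm)
      (ind-++ f arc ia (subst Ind hm iₙ)
        (λ i j → let d , g = cₙ (subst (_ ∈_) (sym hm) j) i in d ∘ sym , λ e → let a , b = g (~-sym e) in b , a) (~-sym eₙ))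
    cross₁ : ∀ {u v} → u ∈ k₁ ++ [ y₁ ] → v ∈ f ∷ arc ⊎ v ∈ kₙ ++ [ yₙ ] → u ≢ v × (u ~ v → u ≡ lastOf y₁ (reverse k₁) × v ≡ f)
    cross₁ i (inj₁ j) = let d , g = c₁ i j in d , λ e → let a , b = g e in trans a (sym (lastOf-reverse k₁ y₁)) , b
    cross₁ i (inj₂ j) = let d , g = ap i j in d , λ e → ⊥-elim (g e)
    eq : reverse k₁ ++ f ∷ arc ++ (kₙ ++ [ yₙ ]) ≡ (reverse k₁ ++ (f ∷ arc) ++ kₙ) ++ [ yₙ ]
    eq = sym (trans (++-assoc (reverse k₁) (f ∷ arc ++ kₙ) [ yₙ ]) (cong (λ l → reverse k₁ ++ f ∷ l) (++-assoc arc kₙ [ yₙ ])))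

  -- If a segment of `Π` contains all feet of `y` and is prolonged by lists that the leg does not
  -- meet, then only the position of the foot changes.
  hang-slice : ∀ {wd D Π y p k} a n pre post → Hang wd D Π y p k → a ≤ p → p + wd < a + n →
               k ++ [ y ] ⟂⟂ pre → k ++ [ y ] ⟂⟂ post →
               Hang wd D (pre ++ slice a n Π ++ post) y (length pre + (p ∸ a)) k
  hang-slice {wd} {D} {Π} {y} {p} {k} a n pre post H ap pn before after = record
    { k⊂ = k⊂ ; indk = indk ; fits = fits′ ; joined = joined′ ; only = only′ ; off = λ i j → off′ i (∈-at j) }
    where
    open Hang H
    o : ℕ
    o = length pre + (p ∸ a)
    back : a + (p ∸ a) ≡ p
    back = m+[n∸m]≡n ap
    shift : p + wd ≡ a + (p ∸ a + wd)
    shift = trans (cong (_+ wd) (sym back)) (+-assoc a (p ∸ a) wd)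
    end-vertex : ∃ λ x → At Π (p + wd) x
    end-vertex = at-exists Π fits
    in-slice : At (slice a n Π) (p ∸ a + wd) (proj₁ end-vertex)
    in-slice = at-slice a n Π (subst (λ m → At Π m (proj₁ end-vertex)) shift (proj₂ end-vertex))
      (+-cancelˡ-< a _ _ (subst (_< a + n) shift pn))
    fits′ : o + wd < length (pre ++ slice a n Π ++ post)
    fits′ = subst (_< length (pre ++ slice a n Π ++ post)) (sym (+-assoc (length pre) (p ∸ a) wd))
      (at-< (at-++ʳ pre (at-++ˡ in-slice)))
    locate : ∀ {m x} → At (pre ++ slice a n Π ++ post) m x →
             x ∈ pre ⊎ (∃ λ j → m ≡ length pre + j × At Π (a + j) x) ⊎ (x ∈ post × length pre + length (slice a n Π) ≤ m)
    locate A with at-++⁻ pre A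
    ... | inj₁ B = inj₁ (at-∈ B)
    ... | inj₂ (j , e , B) with at-++⁻ (slice a n Π) B
    ...   | inj₁ C = inj₂ (inj₁ (j , e , proj₁ (at-sliceʳ a n Π C)))
    ...   | inj₂ (i , refl , C) = inj₂ (inj₂ (at-∈ C , ≤-trans (+-monoʳ-≤ (length pre) (m≤m+n _ i)) (≤-reflexive (sym e))))
    joined′ : ∀ {m x} → At (pre ++ slice a n Π ++ post) m x → o ≤ m → m ≤ o + wd → hd k y ~ x
    joined′ {m} {x} A lo hi with at-++⁻ pre A
    ... | inj₁ B = ⊥-elim (<-irrefl refl (≤-trans (at-< B) (≤-trans (m≤m+n _ _) lo)))
    ... | inj₂ (j , refl , B) with at-++⁻ (slice a n Π) B
    ...   | inj₁ C = joined (proj₁ (at-sliceʳ a n Π C)) (subst (_≤ a + j) back (+-monoʳ-≤ a lo′))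
                       (subst (a + j ≤_) (trans (sym (+-assoc a (p ∸ a) wd)) (cong (_+ wd) back)) (+-monoʳ-≤ a hi′))
      where
      lo′ : p ∸ a ≤ j
      lo′ = +-cancelˡ-≤ (length pre) _ _ lo
      hi′ : j ≤ p ∸ a + wd
      hi′ = +-cancelˡ-≤ (length pre) _ _ (≤-trans hi (≤-reflexive (+-assoc (length pre) (p ∸ a) wd)))
    ...   | inj₂ (i , refl , C) = ⊥-elim (<-irrefl refl (≤-trans (at-< in-slice) (≤-trans (m≤m+n _ i)
              (+-cancelˡ-≤ (length pre) _ _ (≤-trans hi (≤-reflexive (+-assoc (length pre) (p ∸ a) wd)))))))
    only′ : ∀ {m u x} → At (pre ++ slice a n Π ++ post) m x → u ∈ k ++ [ y ] → u ~ x → u ≡ hd k y × o ≤ m × m ≤ o + wd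
    only′ A i e with locate A
    ... | inj₁ j                         = ⊥-elim (proj₂ (before i j) e)
    ... | inj₂ (inj₂ (j , _))            = ⊥-elim (proj₂ (after i j) e)
    ... | inj₂ (inj₁ (j , refl , B)) with only B i e
    ...   | h , lo , hi = h , +-monoʳ-≤ (length pre) (+-cancelˡ-≤ a _ _ (subst (_≤ a + j) (sym back) lo)) ,
            ≤-trans (+-monoʳ-≤ (length pre) (+-cancelˡ-≤ a j (p ∸ a + wd) (≤-trans hi (≤-reflexive (trans (cong (_+ wd) (sym back)) (+-assoc a (p ∸ a) wd))))))
              (≤-reflexive (sym (+-assoc (length pre) (p ∸ a) wd)))
    off′ : ∀ {u} → u ∈ k ++ [ y ] → ∃ (λ m → At (pre ++ slice a n Π ++ post) m u) → ⊥
    off′ i (m , A) with locate A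
    ... | inj₁ j                     = proj₁ (before i j) refl
    ... | inj₂ (inj₂ (j , _))        = proj₁ (after i j) refl
    ... | inj₂ (inj₁ (_ , _ , B))    = off i (at-∈ B)

  at-reverse : ∀ (l : List Vtx) {m x} → At (reverse l) m x → ∃ λ m′ → suc (m + m′) ≡ length l × At l m′ x
  at-reverse [] ()
  at-reverse (y ∷ l) {m} {x} A with at-++⁻ (reverse l) (subst (λ l → At l m x) (unfold-reverse y l) A)
  ... | inj₁ B              = let m′ , e , C = at-reverse l B in suc m′ , cong suc (trans (+-suc m m′) e) , there C
  ... | inj₂ (_ , e , here) = 0 , cong suc (trans (+-identityʳ m) (trans e (trans (+-identityʳ _) (length-reverse l)))) , here

  -- A foot at positions `p` to `p + wd` is turned round as a whole, so the old position, the new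
  -- position and `wd` add up to the last index.
  reverse-spine : ∀ {wd D ys} (S : Spine wd D ys) → Σ (Spine wd D ys) λ S′ →
                  ∀ {y} → y ∈ ys → Spine.pos S′ y + suc (Spine.pos S y + wd) ≡ length (Spine.Π S)
  reverse-spine {wd} {D} {ys} S = record
    { Π = reverse Π ; Π⊂ = λ i → Π⊂ (reverse⁻ i) ; indΠ = ind-reverse Π indΠ ; k = k ; pos = pos′ ; apart = apart
    ; hang = λ i → record
      { k⊂ = Hang.k⊂ (hang i) ; indk = Hang.indk (hang i)
      ; fits = subst (pos′ _ + wd <_) (sym (length-reverse Π)) (subst (pos′ _ + wd <_) (sum i) (fit (pos′ _) (pos _)))
      ; joined = λ A lo hi → let m′ , e , B = at-reverse Π A in
          Hang.joined (hang i) B (low (pos′ _) (pos _) _ m′ (trans e (sym (sum i))) hi) (high (pos′ _) (pos _) _ m′ (trans e (sym (sum i))) lo)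
      ; only = λ A j f → let m′ , e , B = at-reverse Π A ; h , lo , hi = Hang.only (hang i) B j f in
          h , low′ (pos′ _) (pos _) _ m′ (trans e (sym (sum i))) hi , high′ (pos′ _) (pos _) _ m′ (trans e (sym (sum i))) lo
      ; off = λ j m → Hang.off (hang i) j (reverse⁻ m) } } , sum
    where
    open Spine S
    pos′ : Vtx → ℕ
    pos′ y = length Π ∸ suc (pos y + wd)
    sum : ∀ {y} → y ∈ ys → pos′ y + suc (pos y + wd) ≡ length Π
    sum i = m∸n+n≡m (Hang.fits (hang i))
    fit : ∀ a b → a + wd < a + suc (b + wd)
    fit a b = subst (_≤ a + suc (b + wd)) (+-suc a wd) (+-monoʳ-≤ a (s≤s (m≤n+m wd b)))
    -- In each case m + m′ + 1 = p′ + p + wd + 1.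
    low : ∀ p′ p m m′ → suc (m + m′) ≡ p′ + suc (p + wd) → m ≤ p′ + wd → p ≤ m′
    low p′ p m m′ e hi = +-cancelˡ-≤ (p′ + wd) p m′ (≤-trans (≤-reflexive eq) (+-monoˡ-≤ m′ hi))
      where
      eq : p′ + wd + p ≡ m + m′
      eq = trans (+-assoc p′ wd p) (trans (cong (p′ +_) (+-comm wd p)) (sym (suc-injective (trans e (+-suc p′ (p + wd))))))
    high : ∀ p′ p m m′ → suc (m + m′) ≡ p′ + suc (p + wd) → p′ ≤ m → m′ ≤ p + wd
    high p′ p m m′ e lo = +-cancelˡ-≤ m m′ (p + wd) (≤-trans (≤-reflexive (suc-injective (trans e (+-suc p′ (p + wd))))) (+-monoˡ-≤ (p + wd) lo))
    low′ : ∀ p′ p m m′ → suc (m + m′) ≡ p′ + suc (p + wd) → m′ ≤ p + wd → p′ ≤ m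
    low′ p′ p m m′ e hi = +-cancelʳ-≤ (p + wd) p′ m (≤-trans (≤-reflexive (sym (suc-injective (trans e (+-suc p′ (p + wd)))))) (+-monoʳ-≤ m hi))
    high′ : ∀ p′ p m m′ → suc (m + m′) ≡ p′ + suc (p + wd) → p ≤ m′ → m ≤ p′ + wd
    high′ p′ p m m′ e lo = +-cancelʳ-≤ p m (p′ + wd) (≤-trans (+-monoʳ-≤ m lo) (≤-reflexive (trans (suc-injective (trans e (+-suc p′ (p + wd))))
      (trans (cong (p′ +_) (+-comm p wd)) (sym (+-assoc p′ wd p))))))

  -- Both `a` and `e` are included, hence the `suc`.
  span : ℕ → ℕ → List Vtx → List Vtx
  span a e l = slice a (suc (e ∸ a)) l

  at-span : ∀ a e l {m x} → At l m x → a ≤ m → m ≤ e → At (span a e l) (m ∸ a) x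
  at-span a e l {m} A lo hi = at-slice a (suc (e ∸ a)) l (subst (λ k → At l k _) (sym (m+[n∸m]≡n lo)) A) (s≤s (∸-monoˡ-≤ a hi))

  span-∈ : ∀ a e l {x} → a ≤ e → x ∈ span a e l → ∃ λ m → At l m x × a ≤ m × m ≤ e
  span-∈ a e l ae i = let j , A = ∈-at i ; B , q = at-sliceʳ a (suc (e ∸ a)) l A in
    a + j , B , m≤m+n a j , ≤-trans (+-monoʳ-≤ a (≤-pred q)) (≤-reflexive (m+[n∸m]≡n ae))

  length-span : ∀ a e l → a ≤ e → e < length l → length (span a e l) ≡ suc (e ∸ a)
  length-span a e l ae el = trans (length-take (suc (e ∸ a)) (drop a l)) (m≤n⇒m⊓n≡m (subst (suc (e ∸ a) ≤_) (sym (length-drop a l))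
    (m+n≤o⇒m≤o∸n (suc (e ∸ a)) (subst (_≤ length l) (cong suc (sym (m∸n+n≡m ae))) el))))

  span-ends : ∀ a e l → a ≤ e → e < length l → ∃ λ f → ∃ λ r → span a e l ≡ f ∷ r × At l a f × At l e (lastOf f r)
  span-ends a e l ae el with span a e l | length-span a e l ae el | (λ {j x} → at-sliceʳ a (suc (e ∸ a)) l {j} {x})
  ... | f ∷ r | len | back = f , r , refl ,
    subst (λ k → At l k f) (+-identityʳ a) (proj₁ (back here)) ,
    subst (λ k → At l k (lastOf f r)) (trans (cong (a +_) (suc-injective len)) (m+[n∸m]≡n ae)) (proj₁ (back (lastOf-at f r)))

  at-same : ∀ {l : List Vtx} {m m′ x x′} → At l m x → At l m′ x′ → m ≡ m′ → x ≡ x′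
  at-same A B refl = at-fun A B

  module Detour {wd D l} (S : Spine wd D l) {y₁ yₙ : Vtx} (y₁∈ : y₁ ∈ l) (yₙ∈ : yₙ ∈ l) (ne : y₁ ≢ yₙ)
    (le : Spine.pos S y₁ + wd ≤ Spine.pos S yₙ) where
    open Spine S

    private
      a e : ℕ
      -- The detour enters `Π` at the last foot of `y₁` and leaves it at the first foot of `yₙ`, so
      -- that each of these legs meets the segment in one vertex.
      a = pos y₁ + wd
      e = pos yₙ
      H₁ = hang y₁∈
      Hₙ = hang yₙ∈
      e< : e < length Π
      e< = ≤-trans (s≤s (m≤m+n _ wd)) (Hang.fits Hₙ)
      ends = span-ends a e Π le e<
      f = proj₁ ends
      r = proj₁ (proj₂ ends)
      eq : span a e Π ≡ f ∷ r
      eq = proj₁ (proj₂ (proj₂ ends))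
      Af : At Π a f
      Af = proj₁ (proj₂ (proj₂ (proj₂ ends)))
      Ag : At Π e (lastOf f r)
      Ag = proj₂ (proj₂ (proj₂ (proj₂ ends)))
      where-is : ∀ {x} → x ∈ f ∷ r → ∃ λ m → At Π m x × a ≤ m × m ≤ e
      where-is i = span-∈ a e Π le (subst (_ ∈_) (sym eq) i)

    q : List Vtx
    q = reverse (k y₁) ++ span a e Π ++ k yₙ

    q⊂ : q ⊂ D
    q⊂ = ⊂-++ (reverse (k y₁)) (λ i → Hang.k⊂ H₁ (reverse⁻ i)) (⊂-++ (span a e Π) (slice⊂ a (suc (e ∸ a)) Π Π⊂) (Hang.k⊂ Hₙ))

    indq : Ind (y₁ ∷ q ++ [ yₙ ])
    indq = subst (λ s → Ind (y₁ ∷ (reverse (k y₁) ++ s ++ k yₙ) ++ [ yₙ ])) (sym eq)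
      (wrap (k y₁) (k yₙ) f r (Hang.indk H₁) (Hang.indk Hₙ) (subst Ind eq (ind-slice a (suc (e ∸ a)) Π indΠ))
        (λ i j → let m , A , lo , hi = where-is j in
          (λ { refl → Hang.off H₁ i (at-∈ A) }) ,
          λ z → let h , _ , up = Hang.only H₁ A i z in h , at-same A Af (≤-antisym up lo))
        (Hang.joined H₁ Af (m≤m+n _ wd) ≤-refl)
        (λ i j → let m , A , lo , hi = where-is j in
          (λ { refl → Hang.off Hₙ i (at-∈ A) }) ,
          λ z → let h , down , _ = Hang.only Hₙ A i z in h , at-same A Ag (≤-antisym hi down))
        (Hang.joined Hₙ Ag ≤-refl (m≤m+n _ wd))
        (apart y₁∈ yₙ∈ ne))

    base : ℕ
    base = length (reverse (k y₁))

    module _ {y : Vtx} (y∈ : y ∈ l) (n₁ : y ≢ y₁) (nₙ : y ≢ yₙ) (lo : a ≤ pos y) (hi : pos y + wd ≤ e) where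
      private
        inside : pos y + wd < a + suc (e ∸ a)
        inside = subst (pos y + wd <_) (sym (trans (+-suc a (e ∸ a)) (cong suc (m+[n∸m]≡n le)))) (s≤s hi)
        before : ∀ {u v} → u ∈ k y ++ [ y ] → v ∈ y₁ ∷ reverse (k y₁) → u ⟂ v
        before i j = apart y∈ y₁∈ n₁ i (∈-leg (k y₁) j)
        after : k y ++ [ y ] ⟂⟂ k yₙ ++ [ yₙ ]
        after = apart y∈ yₙ∈ nₙ

      hang-q : Hang wd D q y (base + (pos y ∸ a)) (k y)
      hang-q = hang-slice a (suc (e ∸ a)) (reverse (k y₁)) (k yₙ) (hang y∈) lo inside (λ i j → before i (there j)) (λ i j → after i (∈-++⁺ˡ j))

      -- The pyramid's path P contains its ends `y₁` and `yₙ` while Q does not, so positions are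
      -- needed in both lists.
      hang-full : Hang wd D (y₁ ∷ q ++ [ yₙ ]) y (suc base + (pos y ∸ a)) (k y)
      hang-full = subst (λ l → Hang wd D l y (suc base + (pos y ∸ a)) (k y))
        (cong (y₁ ∷_) (sym (trans (++-assoc (reverse (k y₁)) (span a e Π ++ k yₙ) [ yₙ ]) (cong (reverse (k y₁) ++_) (++-assoc (span a e Π) (k yₙ) [ yₙ ])))))
        (hang-slice a (suc (e ∸ a)) (y₁ ∷ reverse (k y₁)) (k yₙ ++ [ yₙ ]) (hang y∈) lo inside before after)

  ind-last-only : ∀ x k {y} → Ind (x ∷ k ++ [ y ]) → ∀ {u} → u ∈ x ∷ k → u ~ y → u ≡ lastOf x k
  ind-last-only x []      p             (here refl) e = refl
  ind-last-only x (z ∷ k) ((_ , a) , p) (here refl) e = ⊥-elim (proj₂ (a (∈-++⁺ʳ k (here refl))) e)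
  ind-last-only x (z ∷ k) (_ , p)       (there i)   e = ind-last-only z k p i e

  -- Each visited vertex g replaces the part of Π between its outermost neighbours lo g and hi g.
  module Chain {A : Vtx → Set} (offA : ∀ {y} → Y y → ¬ A y) {l : List Vtx} (I : Interval A l) (inY : l ⊂ Y) where
    open Interval I

    Sep : Vtx → Vtx → Set
    Sep y z = suc (hi y) < lo z

    hi≤lo : ∀ {y z} → Sep y z → hi y ≤ lo z
    hi≤lo p = ≤-trans (n≤1+n _) (≤-trans (n≤1+n _) p)

    lo≤hi : ∀ {y} → y ∈ l → lo y ≤ hi y
    lo≤hi i = ≤-trans (n≤1+n _) (≤-trans (n≤1+n _) (Spread.gap (spreads i)))

    lo<Π : ∀ {y} → y ∈ l → lo y < length Π
    lo<Π i = ≤-trans (s≤s (lo≤hi i)) (Spread.fits (spreads i))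

    ∉Π : ∀ {y x} → y ∈ l → x ∈ Π → y ≢ x
    ∉Π i j refl = offA (inY i) (Π⊂ j)

    -- The segment starts at the last neighbour of `y` and stops at the first one of `z`, so neither
    -- sees more of it than one end.
    link : ∀ {y z} → y ∈ l → z ∈ l → y ≢ z → hi y ≤ lo z → Ind (y ∷ span (hi y) (lo z) Π ++ [ z ])
    link {y} {z} i j ne le with span-ends (hi y) (lo z) Π le (lo<Π j)
    ... | f , r , eq , Af , Ag = subst (λ s → Ind (y ∷ s ++ [ z ])) (sym eq)
        (ind-∷ʳ y (f ∷ r) yfr (~-sym (Spread.at-lo (spreads j) Ag)) top)
      where
      where-is : ∀ {x} → x ∈ f ∷ r → ∃ λ m → At Π m x × hi y ≤ m × m ≤ lo z
      where-is k = span-∈ (hi y) (lo z) Π le (subst (_ ∈_) (sym eq) k)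
      yfr : Ind (y ∷ f ∷ r)
      yfr = ind-++ y [] (tt , tt) (subst Ind eq (ind-slice (hi y) (suc (lo z ∸ hi y)) Π indΠ))
        (λ { (here refl) k → let m , B , a , b = where-is k in ∉Π i (at-∈ B) ,
             λ e → refl , at-same B Af (≤-antisym (proj₂ (Spread.within (spreads i) B e)) a) })
        (Spread.at-hi (spreads i) Af)
      top : ∀ {u} → u ∈ y ∷ f ∷ r → u ≢ z × (u ~ z → u ≡ lastOf f r)
      top (here refl) = ne , λ e → ⊥-elim (stable _ _ (inY i) (inY j) e)
      top (there k)   = let m , B , a , b = where-is k in
        (λ e → ∉Π j (at-∈ B) (sym e)) , λ e → at-same B Ag (≤-antisym b (proj₁ (Spread.within (spreads j) B (~-sym e))))

    chain : ℕ → List Vtx → List Vtx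
    chain a []       = []
    chain a (g ∷ ms) = span a (lo g) Π ++ g ∷ chain (hi g) ms

    chain-∈ : ∀ a ms → ms ⊂ (_∈ l) → Hom 1 (λ z → a ≤ lo z) ms → Hom 2 Sep ms → ∀ {v} → v ∈ chain a ms →
              (∃ λ m → At Π m v × a ≤ m) ⊎ v ∈ ms
    chain-∈ a (g ∷ ms) s (ag , h) (d , H) i with ∈-++⁻ (span a (lo g) Π) i
    ... | inj₁ j           = let m , B , p , _ = span-∈ a (lo g) Π ag j in inj₁ (m , B , p)
    ... | inj₂ (here e)    = inj₂ (here e)
    ... | inj₂ (there j) with chain-∈ (hi g) ms (s ∘ there) (hom-map₁ (λ _ → hi≤lo) ms d) H j
    ...   | inj₁ (m , B , p) = inj₁ (m , B , ≤-trans ag (≤-trans (lo≤hi (s (here refl))) p))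
    ...   | inj₂ k           = inj₂ (there k)

    ind-chain : ∀ g ms → g ∷ ms ⊂ (_∈ l) → Hom 2 _≢_ (g ∷ ms) → Hom 2 Sep (g ∷ ms) → Ind (g ∷ chain (hi g) ms)
    ind-chain g []       s u H = tt , tt
    ind-chain g (z ∷ ms) s ((gz , gd) , u) ((sz , sd) , zd , H) =
      glue (g ∷ span (hi g) (lo z) Π) (link (s (here refl)) (s (there (here refl))) gz (hi≤lo sz)) (ind-chain z ms (s ∘ there) u (zd , H)) apart
      where
      later : ∀ {v} → v ∈ chain (hi z) ms → (∃ λ m → At Π m v × hi z ≤ m) ⊎ v ∈ ms
      later = chain-∈ (hi z) ms (λ k → s (there (there k))) (hom-map₁ (λ _ → hi≤lo) ms zd) H
      z∈ : z ∈ l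
      z∈ = s (there (here refl))
      -- The outermost neighbours of `z` are at distance at least two; this keeps the segments
      -- before and after `z` apart.
      hi< : ∀ {m} → m ≤ lo z → ∀ {m′} → hi z ≤ m′ → suc m < m′
      hi< p q = ≤-trans (s≤s (s≤s p)) (≤-trans (Spread.gap (spreads z∈)) q)
      go : ∀ {u v} → u ∈ g ∷ span (hi g) (lo z) Π → (∃ λ m → At Π m v × hi z ≤ m) ⊎ v ∈ ms → u ⟂ v
      go (here refl) (inj₁ (m , B , p)) = ∉Π (s (here refl)) (at-∈ B) ,
        λ e → <-irrefl refl (≤-trans (hi< (hi≤lo sz) p) (≤-trans (proj₂ (Spread.within (spreads (s (here refl))) B e)) (n≤1+n _)))
      go (here refl) (inj₂ k) = far (inY (s (here refl))) (inY (s (there (there k)))) (hom₁ gd k)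
      go (there j)   k with span-∈ (hi g) (lo z) Π (hi≤lo sz) j
      go (there j) (inj₁ (m′ , B′ , p)) | m , B , _ , q =
        let d , f = ind-at indΠ B B′ (≤-trans (n≤1+n _) (hi< q p)) in d , λ e → <-irrefl (f e) (hi< q p)
      go (there j) (inj₂ k) | m , B , _ , q = (λ e → ∉Π (s (there (there k))) (at-∈ B) (sym e)) ,
        λ e → <-irrefl refl (≤-trans (≤-trans (hi< q ≤-refl) (≤-trans (n≤1+n _) (≤-trans (n≤1+n _) (hom₁ zd k))))
                              (≤-trans (proj₁ (Spread.within (spreads (s (there (there k)))) B (~-sym e))) (n≤1+n _)))
      apart : g ∷ span (hi g) (lo z) Π ⟂⟂ chain (hi z) ms
      apart i j = go i (later j)

    -- This is `chain` without the final `z`, which as an end of P must not belong to Q.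
    build : ℕ → List Vtx → Vtx → List Vtx
    build a []       z = span a (lo z) Π
    build a (g ∷ ms) z = span a (lo g) Π ++ g ∷ build (hi g) ms z

    chain-build : ∀ a ms z → chain a (ms ++ [ z ]) ≡ build a ms z ++ [ z ]
    chain-build a []       z = refl
    chain-build a (g ∷ ms) z = trans (cong (λ s → span a (lo g) Π ++ g ∷ s) (chain-build (hi g) ms z))
      (sym (++-assoc (span a (lo g) Π) (g ∷ build (hi g) ms z) [ z ]))

    place : ℕ → (ms : List Vtx) → Fin (length ms) → ℕ
    place a (g ∷ ms) fzero    = length (span a (lo g) Π)
    place a (g ∷ ms) (fsuc i) = length (span a (lo g) Π) + suc (place (hi g) ms i)

    at-place : ∀ a ms z i → At (build a ms z) (place a ms i) (lookup ms i)
    at-place a (g ∷ ms) z fzero    = at-length (span a (lo g) Π)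
    at-place a (g ∷ ms) z (fsuc i) = at-++ʳ (span a (lo g) Π) (there (at-place (hi g) ms z i))

    place-mono : ∀ a ms i j → toℕ i < toℕ j → place a ms i ≤ place a ms j
    place-mono a (g ∷ ms) fzero    (fsuc j) _       = m≤m+n _ _
    place-mono a (g ∷ ms) (fsuc i) (fsuc j) (s≤s p) = +-monoʳ-≤ (length (span a (lo g) Π)) (s≤s (place-mono (hi g) ms i j p))

  -- Assembly of the generalized pyramid

  module Pyramid {A B : Vtx → Set} (sep : ∀ {u v} → A u → B v → u ⟂ v) (offA : ∀ {y} → Y y → ¬ A y) (offB : ∀ {y} → Y y → ¬ B y)
    {y₁ yₙ : Vtx} {ms : List Vtx} (S : Spine 1 B (y₁ ∷ ms ++ [ yₙ ])) (inY : (y₁ ∷ ms ++ [ yₙ ]) ⊂ Y)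
    (uniq : Hom 2 _≢_ (y₁ ∷ ms ++ [ yₙ ])) (rising : Hom 2 (λ y z → suc (Spine.pos S y) < Spine.pos S z) (y₁ ∷ ms ++ [ yₙ ])) where
    open Spine S using (hang) renaming (k to kB; pos to posB; apart to apartB)

    l : List Vtx
    l = y₁ ∷ ms ++ [ yₙ ]

    t : ℕ
    t = length ms

    g : Fin t → Vtx
    g = lookup ms

    y₁∈ : y₁ ∈ l
    y₁∈ = here refl

    yₙ∈ : yₙ ∈ l
    yₙ∈ = there (∈-++⁺ʳ ms (here refl))

    g∈ : ∀ i → g i ∈ l
    g∈ i = there (∈-++⁺ˡ (∈-lookup {xs = ms} i))

    module _ {R : Rel Vtx 2} (H : Hom 2 R l) where
      pair-first : ∀ i → R y₁ (g i)
      pair-first i = hom₁ (proj₁ H) (∈-++⁺ˡ (∈-lookup {xs = ms} i))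
      pair-last : ∀ i → R (g i) yₙ
      pair-last i = hom₁ (hom-last₂ ms (proj₂ H)) (∈-lookup {xs = ms} i)
      pair-ends : R y₁ yₙ
      pair-ends = hom₁ (proj₁ H) (∈-++⁺ʳ ms (here refl))
      pair-mid : ∀ i j → toℕ i < toℕ j → R (g i) (g j)
      pair-mid = hom-lookup ms (hom-prefix 2 {R = R} ms (proj₂ H))

    g-≢ : ∀ i j → i ≢ j → g i ≢ g j
    g-≢ i j ne e with <-cmp (toℕ i) (toℕ j)
    ... | tri< q _ _ = pair-mid uniq i j q e
    ... | tri≈ _ q _ = ne (toℕ-injective q)
    ... | tri> _ _ q = pair-mid uniq j i q (sym e)

    far-ends : ¬ y₁ ~ yₙ
    far-ends = stable _ _ (inY y₁∈) (inY yₙ∈)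

    private
      module P = Detour S y₁∈ yₙ∈ (pair-ends uniq) (≤-trans (≤-reflexive (+-comm _ 1)) (<⇒≤ (pair-ends rising)))

    b : List Vtx
    b = P.q

    -- The leading `suc` accounts for `y₁`, the first vertex of P.
    px : Fin t → ℕ
    px i = suc P.base + (posB (g i) ∸ (posB y₁ + 1))

    module _ (i : Fin t) where
      private
        lo : posB y₁ + 1 ≤ posB (g i)
        lo = ≤-trans (≤-reflexive (+-comm _ 1)) (<⇒≤ (pair-first rising i))
        hi : posB (g i) + 1 ≤ posB yₙ
        hi = ≤-trans (≤-reflexive (+-comm _ 1)) (<⇒≤ (pair-last rising i))

      lowB : posB y₁ + 1 ≤ posB (g i)
      lowB = lo

      HP : Hang 1 B (y₁ ∷ b ++ [ yₙ ]) (g i) (px i) (kB (g i))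
      HP = P.hang-full (g∈ i) (pair-first uniq i ∘ sym) (pair-last uniq i) lo hi

      px-hi : px i < length b
      px-hi = subst (_< length b) (+-comm _ 1) (Hang.fits (P.hang-q (g∈ i) (pair-first uniq i ∘ sym) (pair-last uniq i) lo hi))

    -- The gap of two in `rising` is preserved by the detour; it yields the condition that y_i and
    -- x_(i+1) differ.
    px-mono : ∀ i j → toℕ i < toℕ j → suc (px i) < px j
    px-mono i j q = s≤s (subst (_≤ P.base + (posB (g j) ∸ a)) (trans (+-suc P.base _) (cong suc (+-suc P.base _)))
      (+-monoʳ-≤ P.base (+-cancelˡ-≤ a _ _ (≤-trans (≤-reflexive eq) (≤-trans (pair-mid rising i j q) (≤-reflexive (sym (m+[n∸m]≡n (lowB j)))))))))
      where
      a = posB y₁ + 1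
      eq : a + suc (suc (posB (g i) ∸ a)) ≡ suc (suc (posB (g i)))
      eq = trans (+-suc a _) (cong suc (trans (+-suc a _) (cong suc (m+[n∸m]≡n (lowB i)))))

    -- The interface between P with the legs in B and the two possible forms of Q. `W i` is what
    -- `R i` has beyond its leg in B, and `top i` is its last vertex, the one attached to Q.
    record APart : Set where
      field
        q       : List Vtx
        indQ    : Ind (y₁ ∷ q ++ [ yₙ ])
        q-apart : q ⟂⟂ b
        W       : Fin t → List Vtx
        top     : Fin t → Vtx
        T       : Fin t → List Vtx
        shape   : ∀ i → kB (g i) ++ W i ≡ hd (kB (g i)) (g i) ∷ T i
        last≡   : ∀ i → lastOf (hd (kB (g i)) (g i)) (T i) ≡ top i
        indR    : ∀ i → Ind (kB (g i) ++ W i)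
        W-P     : ∀ i {u} → u ∈ W i → u ≡ g i ⊎ u ⟂* y₁ ∷ b ++ [ yₙ ]
        W-W     : ∀ i j → i ≢ j → W i ⟂⟂ W j
        kB-W    : ∀ i j → i ≢ j → kB (g i) ⟂⟂ W j
        pz      : Fin t → ℕ
        pz-hi   : ∀ i → pz i < length q
        pz-adj  : ∀ i {v} → At q (pz i) v → top i ~ v
        pz-only : ∀ i {m v} → At q m v → top i ~ v → m ≡ pz i
        Q-apart : ∀ i {u v} → u ∈ kB (g i) ++ W i → v ∈ q → u ≢ v × (u ~ v → u ≡ top i)
        pz-mono : ∀ i j → toℕ i < toℕ j → pz i ≤ pz j

    pyramid : APart → HasGenPyramid G t
    pyramid D = genPyramid record
      { far = far-ends ; q = q ; b = b ; indQ = indQ ; indP = P.indq ; apart = q-apart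
      ; h = λ i → hd (kB (g i)) (g i) ; T = T ; indR = λ i → subst Ind (shape i) (indR i)
      ; px = px ; pz = pz ; px-lo = λ i → s≤s z≤n ; px-hi = px-hi
      ; px-adj = λ i A → λ { (inj₁ refl) → Hang.joined (HP i) A ≤-refl (m≤m+n _ 1)
                           ; (inj₂ refl) → Hang.joined (HP i) A (n≤1+n _) (≤-reflexive (+-comm 1 (px i))) }
      ; px-only = λ i A e → let _ , lo , hi = Hang.only (HP i) A (hd-∈ (kB (g i))) e in two lo (≤-trans hi (≤-reflexive (+-comm (px i) 1)))
      ; P-apart = λ i u∈ v∈ → P-apart i (∈-++⁻ (kB (g i)) (subst (_ ∈_) (sym (shape i)) u∈)) v∈
      ; pz-hi = pz-hi ; pz-adj = λ i A → subst (_~ _) (sym (last≡ i)) (pz-adj i A)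
      ; pz-only = λ i A e → pz-only i A (subst (_~ _) (last≡ i) e)
      ; Q-apart = λ i u∈ v∈ → let d , f = Q-apart i (subst (_ ∈_) (sym (shape i)) u∈) v∈ in d , λ e → trans (f e) (sym (last≡ i))
      ; R-apart = λ i j ne u∈ v∈ → R-apart i j ne (∈-++⁻ (kB (g i)) (subst (_ ∈_) (sym (shape i)) u∈)) (∈-++⁻ (kB (g j)) (subst (_ ∈_) (sym (shape j)) v∈))
      ; px-mono = px-mono ; pz-mono = pz-mono }
      where
      open APart D
      two : ∀ {p m} → p ≤ m → m ≤ suc p → m ≡ p ⊎ m ≡ suc p
      two lo hi with m≤n⇒m<n∨m≡n hi
      ... | inj₁ (s≤s q) = inj₁ (≤-antisym q lo)
      ... | inj₂ q       = inj₂ q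
      on-leg : ∀ i {u v} → u ∈ kB (g i) ++ [ g i ] → v ∈ y₁ ∷ b ++ [ yₙ ] → u ≢ v × (u ~ v → u ≡ hd (kB (g i)) (g i))
      on-leg i u∈ v∈ = (λ { refl → Hang.off (HP i) u∈ v∈ }) , λ e → proj₁ (Hang.only (HP i) (proj₂ (∈-at v∈)) u∈ e)
      P-apart : ∀ i {u v} → u ∈ kB (g i) ⊎ u ∈ W i → v ∈ y₁ ∷ b ++ [ yₙ ] → u ≢ v × (u ~ v → u ≡ hd (kB (g i)) (g i))
      P-apart i (inj₁ u∈) v∈ = on-leg i (∈-++⁺ˡ u∈) v∈
      P-apart i (inj₂ u∈) v∈ with W-P i u∈
      ... | inj₁ refl = on-leg i (∈-++⁺ʳ (kB (g i)) (here refl)) v∈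
      ... | inj₂ f    = proj₁ (f v∈) , λ e → ⊥-elim (proj₂ (f v∈) e)
      R-apart : ∀ i j → i ≢ j → ∀ {u v} → u ∈ kB (g i) ⊎ u ∈ W i → v ∈ kB (g j) ⊎ v ∈ W j → u ⟂ v
      R-apart i j ne (inj₁ u∈) (inj₁ v∈) = apartB (g∈ i) (g∈ j) (g-≢ i j ne) (∈-++⁺ˡ u∈) (∈-++⁺ˡ v∈)
      R-apart i j ne (inj₁ u∈) (inj₂ v∈) = kB-W i j ne u∈ v∈
      R-apart i j ne (inj₂ u∈) (inj₁ v∈) = ⟂-sym (kB-W j i (ne ∘ sym) v∈ u∈)
      R-apart i j ne (inj₂ u∈) (inj₂ v∈) = W-W i j ne u∈ v∈

    module Standard (SA : Spine 0 A l) (sorted : Hom 2 (λ y z → Spine.pos SA y ≤ Spine.pos SA z) l) where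
      open Spine SA using () renaming (k to kA; pos to posA; apart to apartA; hang to hangA)
      private
        +0 : ∀ {m n} → m ≤ n → m + 0 ≤ n
        +0 {m} {n} = subst (_≤ n) (sym (+-identityʳ m))
        module Q = Detour SA y₁∈ yₙ∈ (pair-ends uniq) (+0 (pair-ends sorted))
        HQ : ∀ i → Hang 0 A Q.q (g i) (Q.base + (posA (g i) ∸ (posA y₁ + 0))) (kA (g i))
        HQ i = Q.hang-q (g∈ i) (pair-first uniq i ∘ sym) (pair-last uniq i) (+0 (pair-first sorted i)) (+0 (pair-last sorted i))
        b⊂B = P.q⊂
        kA⊂ : ∀ i → reverse (kA (g i)) ⊂ A
        kA⊂ i m = Hang.k⊂ (hangA (g∈ i)) (reverse⁻ {xs = kA (g i)} m)
        kB⊂ : ∀ i → kB (g i) ⊂ B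
        kB⊂ i = Hang.k⊂ (hang (g∈ i))

      -- Each `R i` follows the leg of `g i` in B, passes through `g i` and continues along its leg
      -- in A, whose foot is the vertex z_i.
      standard : APart
      standard = record
        { q = Q.q ; indQ = Q.indq ; q-apart = λ i j → sep (Q.q⊂ i) (b⊂B j)
        ; W = W ; top = λ i → hd (kA (g i)) (g i) ; T = λ i → proj₁ (shape′ (kB (g i)) (reverse (kA (g i))))
        ; shape = λ i → proj₁ (proj₂ (shape′ (kB (g i)) (reverse (kA (g i)))))
        ; last≡ = λ i → trans (proj₂ (proj₂ (shape′ (kB (g i)) (reverse (kA (g i)))))) (lastOf-reverse (kA (g i)) (g i))
        ; indR = λ i → glue (kB (g i)) (Hang.indk (hang (g∈ i))) (leg-reverse (kA (g i)) (g i) (Hang.indk (hangA (g∈ i))))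
                         (λ u v → ⟂-sym (sep (kA⊂ i v) (kB⊂ i u)))
        ; W-P = W-P
        ; W-W = λ i j ne u v → apartA (g∈ i) (g∈ j) (g-≢ i j ne) (∈-leg (kA (g i)) u) (∈-leg (kA (g j)) v)
        ; kB-W = kB-W
        ; pz = pz ; pz-hi = λ i → subst (_< length Q.q) (+-identityʳ (pz i)) (Hang.fits (HQ i))
        ; pz-adj = λ i A → Hang.joined (HQ i) A ≤-refl (m≤m+n _ 0)
        ; pz-only = λ i A e → let _ , lo , hi = Hang.only (HQ i) A (hd-∈ (kA (g i))) e in ≤-antisym (≤-trans hi (≤-reflexive (+-identityʳ (pz i)))) lo
        ; Q-apart = λ i u v → Q-apart i (∈-++⁻ (kB (g i)) u) v
        ; pz-mono = λ i j q → +-monoʳ-≤ Q.base (∸-monoˡ-≤ (posA y₁ + 0) (pair-mid sorted i j q)) }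
        where
        pz : Fin t → ℕ
        pz i = Q.base + (posA (g i) ∸ (posA y₁ + 0))
        W : Fin t → List Vtx
        W i = g i ∷ reverse (kA (g i))
        shape′ : ∀ k {y} r → ∃ λ T → k ++ y ∷ r ≡ hd k y ∷ T × lastOf (hd k y) T ≡ lastOf y r
        shape′ []      r = r , refl , refl
        shape′ (x ∷ k) {y} r = k ++ y ∷ r , refl , go x k
          where
          go : ∀ x k → lastOf x (k ++ y ∷ r) ≡ lastOf y r
          go x []      = refl
          go x (z ∷ k) = go z k
        W-P : ∀ i {u} → u ∈ W i → u ≡ g i ⊎ u ⟂* y₁ ∷ b ++ [ yₙ ]
        W-P i (here e)   = inj₁ e
        W-P i (there u∈) = inj₂ (⟂*-∷ (apartA (g∈ i) y₁∈ (pair-first uniq i ∘ sym) leg (∈-++⁺ʳ (kA y₁) (here refl)))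
            (⟂*-++ b (λ v → sep (kA⊂ i u∈) (b⊂B v)) λ { (here refl) → apartA (g∈ i) yₙ∈ (pair-last uniq i) leg (∈-++⁺ʳ (kA yₙ) (here refl)) }))
          where leg = ∈-++⁺ˡ (reverse⁻ {xs = kA (g i)} u∈)
        kB-W : ∀ i j → i ≢ j → kB (g i) ⟂⟂ W j
        kB-W i j ne u (here refl) = apartB (g∈ i) (g∈ j) (g-≢ i j ne) (∈-++⁺ˡ u) (∈-++⁺ʳ (kB (g j)) (here refl))
        kB-W i j ne u (there v)   = ⟂-sym (sep (kA⊂ j v) (kB⊂ i u))
        Q-apart : ∀ i {u v} → u ∈ kB (g i) ⊎ u ∈ W i → v ∈ Q.q → u ≢ v × (u ~ v → u ≡ hd (kA (g i)) (g i))
        Q-apart i (inj₁ u) v = let d , f = sep (Q.q⊂ v) (kB⊂ i u) in d ∘ sym , λ e → ⊥-elim (f (~-sym e))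
        Q-apart i (inj₂ u) v = (λ { refl → Hang.off (HQ i) (∈-leg (kA (g i)) u) v }) ,
          λ e → proj₁ (Hang.only (HQ i) (proj₂ (∈-at v)) (∈-leg (kA (g i)) u) e)

    module Winding (I : Interval A l) (sorted : Hom 2 (λ y z → suc (Interval.hi I y) < Interval.lo I z) l) where
      open Interval I using (Π; Π⊂; indΠ; lo; hi; spreads)
      open Chain offA I inY
      private
        q : List Vtx
        q = build (hi y₁) ms yₙ

        indQ : Ind (y₁ ∷ q ++ [ yₙ ])
        indQ = subst (λ s → Ind (y₁ ∷ s)) (chain-build (hi y₁) ms yₙ) (ind-chain y₁ (ms ++ [ yₙ ]) (λ i → i) uniq sorted)

        q-∈ : ∀ {v} → v ∈ q → A v ⊎ ∃ λ i → v ≡ g i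
        q-∈ {v} i with chain-∈ (hi y₁) (ms ++ [ yₙ ]) there (hom-map₁ (λ _ → hi≤lo) (ms ++ [ yₙ ]) (proj₁ sorted)) (proj₂ sorted)
                     (subst (v ∈_) (sym (chain-build (hi y₁) ms yₙ)) (∈-++⁺ˡ i))
        ... | inj₁ (m , B , _) = inj₁ (Π⊂ (at-∈ B))
        ... | inj₂ j with ∈-++⁻ ms j
        ...   | inj₁ k           = inj₂ (index k , lookup-index k)
        ...   | inj₂ (here refl) = ⊥-elim (ind-≢ʳ q (proj₂ indQ) i refl)

        leg-≢ : ∀ i {u} → u ∈ kB (g i) → u ≢ g i
        leg-≢ i = ind-≢ʳ (kB (g i)) (Hang.indk (hang (g∈ i)))

        kB⊂ : ∀ i → kB (g i) ⊂ B
        kB⊂ i = Hang.k⊂ (hang (g∈ i))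

        g⟂y₁ : ∀ i → ¬ g i ~ y₁
        g⟂y₁ i = stable _ _ (inY (g∈ i)) (inY y₁∈)

        g⟂yₙ : ∀ i → ¬ g i ~ yₙ
        g⟂yₙ i = stable _ _ (inY (g∈ i)) (inY yₙ∈)

        -- Otherwise g i has two nonadjacent neighbours on the path Π and one on the path b.
        no-empty : ∀ i → kB (g i) ≢ []
        no-empty i eq = noHub (g i) (inY (g∈ i)) (hub h off (to (inj₂ u∈)) (to (inj₂ v∈)) (to (inj₁ (there (∈-++⁺ˡ w∈))))
            (Spread.at-lo S′ Au) (Spread.at-hi S′ Av) gw uv (sep (q′⊂ u∈) (P.q⊂ w∈)) (sep (q′⊂ v∈) (P.q⊂ w∈)))
          where
          S′ = spreads (g∈ i)
          q′ : List Vtx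
          q′ = span (hi y₁) (lo yₙ) Π
          q′⊂ : q′ ⊂ A
          q′⊂ = slice⊂ (hi y₁) (suc (lo yₙ ∸ hi y₁)) Π Π⊂
          iq′ : Ind (y₁ ∷ q′ ++ [ yₙ ])
          iq′ = link y₁∈ yₙ∈ (pair-ends uniq) (hi≤lo (pair-ends sorted))
          ap : q′ ⟂⟂ b
          ap m n = sep (q′⊂ m) (P.q⊂ n)
          h = hole far-ends q′ b iq′ P.indq ap
          to = toHole far-ends q′ b iq′ P.indq ap
          u-at = at-exists Π (lo<Π (g∈ i))
          v-at = at-exists Π (Spread.fits S′)
          Au = proj₂ u-at
          Av = proj₂ v-at
          u∈ : proj₁ u-at ∈ q′
          u∈ = at-∈ (at-span (hi y₁) (lo yₙ) Π Au (hi≤lo (pair-first sorted i)) (≤-trans (lo≤hi (g∈ i)) (hi≤lo (pair-last sorted i))))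
          v∈ : proj₁ v-at ∈ q′
          v∈ = at-∈ (at-span (hi y₁) (lo yₙ) Π Av (≤-trans (hi≤lo (pair-first sorted i)) (lo≤hi (g∈ i))) (hi≤lo (pair-last sorted i)))
          uv : proj₁ u-at ⟂ proj₁ v-at
          uv = let d , f = ind-at indΠ Au Av (≤-trans (n≤1+n _) (Spread.gap S′)) in d , λ e → <-irrefl (f e) (Spread.gap S′)
          w-at = at-exists (y₁ ∷ b ++ [ yₙ ]) (≤-trans (s≤s (m≤m+n (px i) 1)) (Hang.fits (HP i)))
          gw : g i ~ proj₁ w-at
          gw = subst (λ k → hd k (g i) ~ proj₁ w-at) eq (Hang.joined (HP i) (proj₂ w-at) ≤-refl (m≤m+n _ 1))
          w∈ : proj₁ w-at ∈ b
          w∈ = go (at-∈ (proj₂ w-at)) gw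
            where
            go : ∀ {w} → w ∈ y₁ ∷ b ++ [ yₙ ] → g i ~ w → w ∈ b
            go (here refl) e = ⊥-elim (g⟂y₁ i e)
            go (there m)   e with ∈-++⁻ b m
            ... | inj₁ n           = n
            ... | inj₂ (here refl) = ⊥-elim (g⟂yₙ i e)
          off : ¬ OnH G h (g i)
          off o with onHole far-ends q′ b iq′ P.indq ap o
          ... | inj₂ m           = offA (inY (g∈ i)) (q′⊂ m)
          ... | inj₁ (here e)    = pair-first uniq i (sym e)
          ... | inj₁ (there m) with ∈-++⁻ b m
          ...   | inj₁ n         = offB (inY (g∈ i)) (P.q⊂ n)
          ...   | inj₂ (here e)  = pair-last uniq i e

        nonempty : ∀ i → ∃ λ x → ∃ λ k → kB (g i) ≡ x ∷ k
        nonempty i = go (kB (g i)) refl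
          where
          go : ∀ k → kB (g i) ≡ k → ∃ λ x → ∃ λ k → kB (g i) ≡ x ∷ k
          go []      e = ⊥-elim (no-empty i e)
          go (x ∷ k) e = x , k , e

        T : Fin t → List Vtx
        T i = proj₁ (proj₂ (nonempty i))

        head≡ : ∀ i → proj₁ (nonempty i) ≡ hd (kB (g i)) (g i)
        head≡ i = hd-≡ refl (proj₂ (proj₂ (nonempty i)))

        kB≡ : ∀ i → kB (g i) ≡ hd (kB (g i)) (g i) ∷ T i
        kB≡ i = trans (proj₂ (proj₂ (nonempty i))) (cong (_∷ T i) (head≡ i))

        top : Fin t → Vtx
        top i = lastOf (hd (kB (g i)) (g i)) (T i)

        top∈ : ∀ i → top i ∈ kB (g i)
        top∈ i = subst (top i ∈_) (sym (kB≡ i)) (lastOf-∈ _ (T i))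

        ind-leg : ∀ i → Ind (hd (kB (g i)) (g i) ∷ T i ++ [ g i ])
        ind-leg i = subst (λ k → Ind (k ++ [ g i ])) (kB≡ i) (Hang.indk (hang (g∈ i)))

        leg-other : ∀ i j → i ≢ j → ∀ {u} → u ∈ kB (g i) → u ⟂ g j
        leg-other i j ne u = apartB (g∈ i) (g∈ j) (g-≢ i j ne) (∈-++⁺ˡ u) (∈-++⁺ʳ (kB (g j)) (here refl))

        q-apart : q ⟂⟂ b
        q-apart u v with q-∈ u
        ... | inj₁ a          = sep a (P.q⊂ v)
        ... | inj₂ (i , refl) = (λ { refl → offB (inY (g∈ i)) (P.q⊂ v) }) , λ e →
              leg-≢ i (subst (hd (kB (g i)) (g i) ∈_) (sym (kB≡ i)) (here refl))
                (sym (proj₁ (Hang.only (HP i) (proj₂ (∈-at (there (∈-++⁺ˡ v)))) (∈-++⁺ʳ (kB (g i)) (here refl)) e)))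

        leg-q : ∀ i {u v} → u ∈ kB (g i) → v ∈ q → u ≢ v × (u ~ v → u ≡ top i × v ≡ g i)
        leg-q i {u} {v} u∈ v∈ with q-∈ v∈
        ... | inj₁ a = let d , f = sep a (kB⊂ i u∈) in d ∘ sym , λ e → ⊥-elim (f (~-sym e))
        ... | inj₂ (j , refl) with i ≟ j
        ...   | yes refl = leg-≢ i u∈ , λ e → ind-last-only _ (T i) (ind-leg i) (subst (u ∈_) (kB≡ i) u∈) e , refl
        ...   | no ne    = proj₁ (leg-other i j ne u∈) , λ e → ⊥-elim (proj₂ (leg-other i j ne u∈) e)

      -- Here Q runs through every `g i`, which itself is the vertex z_i. So `R i` is the leg in B
      -- alone, and its last vertex sees nothing of Q but `g i`.
      winding : APart
      winding = record
        { q = q ; indQ = indQ ; q-apart = q-apart ; W = λ _ → [] ; top = top ; T = T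
        ; shape = λ i → trans (++-identityʳ (kB (g i))) (kB≡ i) ; last≡ = λ _ → refl
        ; indR = λ i → subst Ind (sym (++-identityʳ (kB (g i)))) (ind-++ˡ (kB (g i)) (Hang.indk (hang (g∈ i))))
        ; W-P = λ _ () ; W-W = λ _ _ _ () ; kB-W = λ _ _ _ _ ()
        ; pz = place (hi y₁) ms ; pz-hi = λ i → at-< (at-place (hi y₁) ms yₙ i)
        ; pz-adj = λ i A → subst (top i ~_) (at-fun (at-place (hi y₁) ms yₙ i) A) (ind-penult _ (T i) (ind-leg i))
        ; pz-only = λ i A e → at-inj (ind-++ˡ q (proj₂ indQ)) A (at-place (hi y₁) ms yₙ i) (proj₂ (proj₂ (leg-q i (top∈ i) (at-∈ A)) e))
        ; Q-apart = λ i u v → let d , f = leg-q i (subst (_ ∈_) (++-identityʳ (kB (g i))) u) v in d , proj₁ ∘ f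
        ; pz-mono = place-mono (hi y₁) ms }

  -- A common order for both sides

  open import Data.List.Relation.Binary.Sublist.Propositional using (_⊆_; _∷_; minimum)
  open import Data.List.Relation.Binary.Sublist.Propositional.Properties using (Any-resp-⊆)

  spine-⊂ : ∀ {wd D l l′} → (l′ ⊂ (_∈ l)) → Spine wd D l → Spine wd D l′
  spine-⊂ f S = record { Spine S ; hang = λ i → Spine.hang S (f i) ; apart = λ i j → Spine.apart S (f i) (f j) }

  interval-⊂ : ∀ {D l l′} → (l′ ⊂ (_∈ l)) → Interval D l → Interval D l′
  interval-⊂ f I = record { Interval I ; spreads = λ i → Interval.spreads I (f i) ; order = λ i j → Interval.order I (f i) (f j) }

  record Ends (t : ℕ) (xs : List Vtx) : Set where
    field
      {y₁ yₙ} : Vtx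
      {ms}    : List Vtx
      size    : length ms ≡ t
      sub     : y₁ ∷ ms ++ [ yₙ ] ⊆ xs

  ends-of : ∀ t xs → suc (suc t) ≤ length xs → Ends t xs
  ends-of t (x ∷ xs) (s≤s l) = let ms , yₙ , e , p = go t xs l in record { size = e ; sub = refl ∷ p }
    where
    go : ∀ t xs → suc t ≤ length xs → ∃ λ ms → ∃ λ yₙ → length ms ≡ t × ms ++ [ yₙ ] ⊆ xs
    go zero    (x ∷ xs) _       = [] , x , refl , refl ∷ minimum xs
    go (suc t) (x ∷ xs) (s≤s l) = let ms , yₙ , e , p = go t xs l in x ∷ ms , yₙ , cong suc e , refl ∷ p

  no-three : ∀ {a b c} → a ≢ b → a ≢ c → b ≢ c → a ≤ suc b → b ≤ suc a → a ≤ suc c → c ≤ suc a → b ≤ suc c → c ≤ suc b → ⊥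
  no-three {a} {b} {c} ab ac bc p p′ q q′ r r′ with <-cmp a b | <-cmp a c | <-cmp b c
  ... | tri≈ _ e _ | _ | _ = ab e
  ... | tri< x _ _ | tri≈ _ e _ | _ = ac e
  ... | tri< x _ _ | tri< y _ _ | _ = bc (trans (≤-antisym p′ x) (sym (≤-antisym q′ y)))
  ... | tri< x _ _ | tri> _ _ y | _ = <-irrefl refl (≤-trans (≤-trans (s≤s y) x) r)
  ... | tri> _ _ x | _ | tri≈ _ e _ = bc e
  ... | tri> _ _ x | _ | tri< y _ _ = ac (trans (≤-antisym p x) (sym (≤-antisym r′ y)))
  ... | tri> _ _ x | _ | tri> _ _ y = <-irrefl refl (≤-trans (≤-trans (s≤s y) x) q)

  module Sorting {A B : Vtx → Set} (sep : ∀ {u v} → A u → B v → u ⟂ v) (offA : ∀ {y} → Y y → ¬ A y) (offB : ∀ {y} → Y y → ¬ B y)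
    (t : ℕ) (noPyramid : ¬ HasGenPyramid G t) {xs : List Vtx} (inY : xs ⊂ Y) (SB : Spine 1 B xs) (apartB : Apart SB) where
    open Spine SB using (pos)

    record Sorted (Q : Rel Vtx 2) : Set where
      field
        {y₁ yₙ} : Vtx
        {ms}    : List Vtx
      l : List Vtx
      l = y₁ ∷ ms ++ [ yₙ ]
      field
        size    : length ms ≡ t
        from    : l ⊂ (_∈ xs)
        S       : Spine 1 B l
        distinct : Hom 2 _≢_ l
        ordered : Hom 2 Q l
        rising  : Hom 2 (λ y z → suc (Spine.pos S y) < Spine.pos S z) l

    private
      Before : Rel Vtx 2
      Before y z = suc (pos y) < pos z

      flipped : ∀ {a b a′ b′ L} → a′ + suc (a + 1) ≡ L → b′ + suc (b + 1) ≡ L → suc b < a → suc a′ < b′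
      flipped {a} {b} {a′} {b′} e f q = +-cancelʳ-≤ (suc (b + 1)) (suc (suc a′)) b′ (≤-trans (≤-reflexive shift)
        (≤-trans (+-monoʳ-≤ a′ (s≤s (+-monoˡ-≤ 1 q))) (≤-reflexive (trans e (sym f)))))
        where
        shift : suc (suc a′) + suc (b + 1) ≡ a′ + suc (suc (suc b) + 1)
        shift = sym (trans (+-suc a′ _) (cong suc (trans (+-suc a′ _) (cong suc refl))))

    -- The order of the list is already fixed by `Q` on the side A. If the positions in B decrease
    -- along it, the path in B is reversed and not the list. If they are neither spaced upwards nor
    -- downwards, three distinct numbers would be pairwise within distance one.
    sort : ∀ {Q : Rel Vtx 2} l → l ⊂ (_∈ xs) → Hom 2 _≢_ l → Hom 2 Q l → sortSize t ≤ length l → Sorted Q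
    sort {Q} l f u h n with selectRam 2 Before (λ y z → suc (pos y) <? pos z) (suc (suc t)) (ram 2 (suc (suc t)) 3) l n
    ... | inj₁ (s , rise) = record
          { size = size ; from = sub′ ; S = spine-⊂ sub′ SB ; distinct = keep 2 {_≢_} u ; ordered = keep 2 {Q} h
          ; rising = hom-⊆ 2 Before sub rise }
          where
          open Ends (ends-of t (Select.ys s) (Select.size s))
          open Select (select-trans s (select {k = 0} z≤n sub)) using (keep; from)
          sub′ : y₁ ∷ ms ++ [ yₙ ] ⊂ (_∈ xs)
          sub′ i = f (from i)
    ... | inj₂ (s , n₁) with selectRam 2 (λ y z → Before z y) (λ y z → suc (pos z) <? pos y) (suc (suc t)) 3 (Select.ys s) (Select.size s)
    ...   | inj₁ (s′ , fall) = record
          { size = size ; from = sub′ ; S = spine-⊂ sub′ (proj₁ rev) ; distinct = keep 2 {_≢_} u ; ordered = keep 2 {Q} h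
          ; rising = flip-all (y₁ ∷ ms ++ [ yₙ ]) sub′ (hom-⊆ 2 (λ y z → Before z y) sub fall) }
          where
          open Ends (ends-of t (Select.ys s′) (Select.size s′))
          open Select (select-trans s (select-trans s′ (select {k = 0} z≤n sub))) using (keep; from)
          rev = reverse-spine SB
          pos′ = Spine.pos (proj₁ rev)
          sub′ : y₁ ∷ ms ++ [ yₙ ] ⊂ (_∈ xs)
          sub′ i = f (from i)
          flip-one : ∀ {y} → y ∈ xs → ∀ ys → ys ⊂ (_∈ xs) → Hom 1 (λ z → Before z y) ys → Hom 1 (λ z → suc (pos′ y) < pos′ z) ys
          flip-one i []       g _       = tt
          flip-one i (z ∷ ys) g (b , k) = flipped (proj₂ rev i) (proj₂ rev (g (here refl))) b , flip-one i ys (g ∘ there) k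
          flip-all : ∀ ys → ys ⊂ (_∈ xs) → Hom 2 (λ y z → Before z y) ys → Hom 2 (λ y z → suc (pos′ y) < pos′ z) ys
          flip-all []       g _       = tt
          flip-all (y ∷ ys) g (b , k) = flip-one (g (here refl)) ys (g ∘ there) b , flip-all ys (g ∘ there) k
    ...   | inj₂ (s′ , n₂) = ⊥-elim (close (Select.ys s′) (Select.size s′) (f ∘ Select.from s ∘ Select.from s′)
            (Select.keep s′ 2 {_≢_} (Select.keep s 2 {_≢_} u)) (hom-zip₂ (Select.ys s′) (Select.keep s′ 2 {Not 2 Before} n₁) n₂))
          where
          near : ∀ {a b} → ¬ suc a < b → b ≤ suc a
          near = ≮⇒≥
          close : ∀ ys → 3 ≤ length ys → ys ⊂ (_∈ xs) → Hom 2 _≢_ ys → Hom 2 (λ y z → ¬ Before y z × ¬ Before z y) ys → ⊥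
          close (a ∷ b ∷ c ∷ _) _ g ((ab , ac , _) , (bc , _) , _) (((p , p′) , (q , q′) , _) , ((r , r′) , _) , _) = no-three
            (apartB (g (here refl)) (g (there (here refl))) ab) (apartB (g (here refl)) (g (there (there (here refl)))) ac)
            (apartB (g (there (here refl))) (g (there (there (here refl)))) bc)
            (near p′) (near p) (near q′) (near q) (near r′) (near r)
          close (_ ∷ []) (s≤s ())
          close (_ ∷ _ ∷ []) (s≤s (s≤s ()))

    standard-case : (SA : Spine 0 A xs) → ∀ l → l ⊂ (_∈ xs) → Hom 2 _≢_ l → Hom 2 (λ y z → Spine.pos SA y ≤ Spine.pos SA z) l →
                    sortSize t ≤ length l → ⊥
    standard-case SA l f u h n = noPyramid (subst (HasGenPyramid G) size (pyramid (Standard.standard (spine-⊂ from SA) ordered)))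
      where
      open Sorted (sort l f u h n)
      open Pyramid sep offA offB S (inY ∘ from) distinct rising

    interval-case : (I : Interval A xs) → ∀ l → l ⊂ (_∈ xs) → Hom 2 _≢_ l → Hom 2 (λ y z → Interval.lo I y ≤ Interval.lo I z) l →
                    monoSize t ≤ length l → ⊥
    interval-case I l f u h n
      with selectRam 2 (λ y z → suc (Interval.hi I y) < Interval.lo I z) (λ y z → suc (Interval.hi I y) <? Interval.lo I z) (sortSize t) 5 l
             (≤-trans (m≤n+m _ (sortSize t)) n)
    ... | inj₁ (s , separated) = noPyramid (subst (HasGenPyramid G) size (pyramid (Winding.winding (interval-⊂ from I) ordered)))
      where
      open Sorted (sort (Select.ys s) (f ∘ Select.from s) (Select.keep s 2 {_≢_} u) separated (Select.size s))
      open Pyramid sep offA offB S (inY ∘ from) distinct rising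
    ... | inj₂ (s , n₁) = five (Select.ys s) (Select.size s) (f ∘ Select.from s) (Select.keep s 2 {_≢_} u)
            (Select.keep s 2 {λ y z → Interval.lo I y ≤ Interval.lo I z} h) n₁
      where
      open Interval I
      -- By `gap` and `order` each `lo` exceeds the previous one. So `lo e` is at least `lo b + 3`,
      -- while `hi a` is at most `lo b + 1`; hence `a` and `e` are separated.
      five : ∀ ys → 5 ≤ length ys → ys ⊂ (_∈ xs) → Hom 2 _≢_ ys → Hom 2 (λ y z → lo y ≤ lo z) ys → Hom 2 (λ y z → ¬ suc (hi y) < lo z) ys → ⊥
      five (a ∷ b ∷ c ∷ d ∷ e ∷ _) _ g ((ab , _) , (bc , _) , (cd , _) , (de , _) , _)
           ((pa , _) , (pb , _) , (pc , _) , (pd , _) , _) ((_ , _ , _ , n , _) , _) =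
          n (≤-trans (s≤s (s≤s (order a∈ b∈ ab pa))) (≤-trans (s≤s (s≤s (next b∈ c∈ bc pb))) (≤-trans (s≤s (next c∈ d∈ cd pc)) (next d∈ e∈ de pd))))
        where
        a∈ = g (here refl)
        b∈ = g (there (here refl))
        c∈ = g (there (there (here refl)))
        d∈ = g (there (there (there (here refl))))
        e∈ = g (there (there (there (there (here refl)))))
        next : ∀ {y z} → y ∈ xs → z ∈ xs → y ≢ z → lo y ≤ lo z → suc (lo y) ≤ lo z
        next i j ne p = ≤-pred (≤-trans (Spread.gap (spreads i)) (order i j ne p))
      five (_ ∷ []) (s≤s ())
      five (_ ∷ _ ∷ []) (s≤s (s≤s ()))
      five (_ ∷ _ ∷ _ ∷ []) (s≤s (s≤s (s≤s ())))
      five (_ ∷ _ ∷ _ ∷ _ ∷ []) (s≤s (s≤s (s≤s (s≤s ()))))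

    -- A decreasing selection is simply read backwards. This is harmless because positions in B are
    -- compared only afterwards.
    monotone : ∀ {m} (key : Vtx → ℕ) → Hom 2 _≢_ xs → ram 2 m m ≤ length xs →
               ∃ λ l → l ⊂ (_∈ xs) × Hom 2 _≢_ l × Hom 2 (λ y z → key y ≤ key z) l × m ≤ length l
    monotone {m} key u n with selectRam 2 (λ y z → key y ≤ key z) (λ y z → key y ≤? key z) m m xs n
    ... | inj₁ (s , h) = Select.ys s , Select.from s , Select.keep s 2 {_≢_} u , h , Select.size s
    ... | inj₂ (s , h) = reverse (Select.ys s) , (λ i → Select.from s (reverse⁻ i)) ,
            hom-map₂ {R = λ y z → z ≢ y} (λ _ _ ne e → ne (sym e)) (reverse (Select.ys s)) (hom-reverse (Select.ys s) (Select.keep s 2 {_≢_} u)) ,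
            hom-map₂ {R = λ y z → ¬ key z ≤ key y} (λ _ _ n → <⇒≤ (≰⇒> n)) (reverse (Select.ys s)) (hom-reverse (Select.ys s) h) ,
            subst (m ≤_) (sym (length-reverse (Select.ys s))) (Select.size s)

    spines-clash : Spine 0 A xs ⊎ Interval A xs → Hom 2 _≢_ xs → ram 2 (monoSize t) (monoSize t) ≤ length xs → ⊥
    spines-clash (inj₁ SA) u n = let l , f , v , h , m = monotone (Spine.pos SA) u n in
      standard-case SA l f v h (≤-trans (m≤m+n (sortSize t) _) m)
    spines-clash (inj₂ I)  u n = let l , f , v , h , m = monotone (Interval.lo I) u n in
      interval-case I l f v h m

  -- Combination of the two sides

  side-⊂ : ∀ {Z Z′ D : Vtx → Set} → (∀ {v} → Z′ v → Z v) → Side Z D → Side Z′ D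
  side-⊂ f S = record { conn = Side.conn S ; att = λ z → Side.att S (f z) ; off = Side.off S }

  tri-⊂ : ∀ {D D′ a b c} → (∀ v → D′ v → D v) → Tri D′ a b c → Tri D a b c
  tri-⊂ f T = record { Tri T ; s₁ = λ i → f _ (Tri.s₁ T i) ; s₂ = λ i → f _ (Tri.s₂ T i) ; s₃ = λ i → f _ (Tri.s₃ T i) }

  module Core (t : ℕ) (noPyramid : ¬ HasGenPyramid G t) (noClique : ¬ HasClique G t) where

    core : ∀ {zs A B} → Hom 2 _≢_ zs → zs ⊂ Y → Side (_∈ zs) A → Side (_∈ zs) B → (∀ {u v} → A u → B v → u ⟂ v) →
           (∀ {a b c} → a ∈ zs → b ∈ zs → c ∈ zs → a ≢ b → a ≢ c → b ≢ c → ¬ Tri A a b c) → coreSize t ≤ length zs → ⊥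
    core {zs} {A} {B} u zs⊂Y sideA sideB sep noTri n = (do
        B′ , B⊂ , sideB′ , minB ← minimise sideB
        let noStar : ∀ {a b c} → a ∈ zs → b ∈ zs → c ∈ zs → a ≢ b → a ≢ c → b ≢ c → ¬ Star B′ a b c
            noStar i j k ab ac bc S = [ noTri i j k ab ac bc ,
              (λ S′ → star-star (λ p q → sep p (B⊂ _ q)) (Side.off sideA) (Side.off sideB′) (zs⊂Y i) (zs⊂Y j) (zs⊂Y k) ab ac bc S′ S) ]′
              (connect3 sideA (zs⊂Y i) (zs⊂Y j) (zs⊂Y k) i j k ab ac bc)
        s , SB , apB ← harvestB sideB′ minB zs⊂Y t (sizeA (ram 2 (monoSize t) (monoSize t))) noClique
          (λ i j k ab ac bc C → noStar i j k ab ac bc (inj₁ C)) (λ i j k ab ac bc M → noStar i j k ab ac bc (inj₂ (inj₁ M))) u n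
        let ys = Select.ys s
            up : ys ⊂ (_∈ zs)
            up = Select.from s
            uy : Hom 2 _≢_ ys
            uy = Select.keep s 2 {_≢_} u
        -- Minimality refers to the attached vertices, so A is minimised for those that survived in
        -- B. The spine of B just restricts to the final selection.
        A′ , A⊂ , sideA′ , minA ← minimise (side-⊂ up sideA)
        s′ , SA ← harvestA sideA′ minA (zs⊂Y ∘ up) (ram 2 (monoSize t) (monoSize t)) (side-⊂ up sideB′) (λ p q → sep (A⊂ _ p) (B⊂ _ q))
          (λ i j k ab ac bc T → noTri (up i) (up j) (up k) ab ac bc (tri-⊂ A⊂ T)) uy (Select.size s)
        return (Sorting.spines-clash (λ p q → sep (A⊂ _ p) (B⊂ _ q)) (Side.off sideA′) (Side.off sideB′) t noPyramid (zs⊂Y ∘ up ∘ Select.from s′)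
          (spine-⊂ (Select.from s′) SB) (λ i j → apB (Select.from s′ i) (Select.from s′ j)) SA (Select.keep s′ 2 {_≢_} uy) (Select.size s′))) λ b → b

    bounded : ∀ {zs A B} → Hom 2 _≢_ zs → zs ⊂ Y → Side (_∈ zs) A → Side (_∈ zs) B → (∀ {u v} → A u → B v → u ⟂ v) →
              threshold t ≤ length zs → ⊥
    bounded {zs} {A} {B} u zs⊂Y sideA sideB sep n = (do
        tri? ← ¬¬-Fin λ a → ¬¬-Fin λ b → ¬¬-Fin λ c → em (Tri A a b c)
        return (split (selectRam 3 (Tri A) tri? (coreSize t) (coreSize t) zs n))) λ b → b
      where
      split : (Σ (Select zs (coreSize t)) λ s → Hom 3 (Tri A) (Select.ys s)) ⊎
              (Σ (Select zs (coreSize t)) λ s → Hom 3 (Not 3 (Tri A)) (Select.ys s)) → ⊥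
      -- Triangles in A for all triples exclude triangles in B, so the two sides exchange roles.
      split (inj₁ (s , h)) =
        core (keep 2 {_≢_} u) (zs⊂Y ∘ from) (side-⊂ from sideB) (side-⊂ from sideA) (λ p q → ⟂-sym (sep q p))
          (λ i j k ab ac bc → Clash.tri-tri sep (Side.off sideA) (Side.off sideB) (zs⊂Y (from i)) (zs⊂Y (from j)) (zs⊂Y (from k))
            ab ac bc (hom₃ h tri₁₂ tri₂₃ i j k ab ac bc)) size
        where open Select s
      split (inj₂ (s , h)) =
        core (keep 2 {_≢_} u) (zs⊂Y ∘ from) (side-⊂ from sideA) (side-⊂ from sideB) sep
          (hom₃ h (λ n T → n (tri₁₂ T)) (λ n T → n (tri₂₃ T))) size
        where open Select s

open import Data.Fin.Subset using (Subset; _∈_; _∉_; _⊆_; ∣_∣; _-_)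
open import Data.Fin.Subset.Properties using (x∈p∧x≢y⇒x∈p-y; x∈p⇒p-x⊂p)
open import Data.List.Membership.Propositional using () renaming (_∈_ to _∈ₗ_)
open import Data.Vec using ([]; _∷_; here; there)
open Combinatorics using (Hom; threshold)
open import Data.Fin.Properties using () renaming (suc-injective to fsuc-injective)

-- The two full components of a minimal separator

module Separator (G : Graph) where
  open Graph G using (n)
  open InducedPaths G

  reach-∉ : ∀ {X u v} → Reach G X u v → v ∉ X
  reach-∉ (here p)     = p
  reach-∉ (step _ _ p) = p

  reach-++ : ∀ {X u v w} → Reach G X u v → Reach G X v w → Reach G X u w
  reach-++ r (here _)     = r
  reach-++ r (step s e p) = step (reach-++ r s) e p

  reach-sym : ∀ {X u v} → Reach G X u v → Reach G X v u
  reach-sym (here p)     = here p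
  reach-sym (step r e p) = reach-++ (step (here p) (~-sym e) (reach-∉ r)) (reach-sym r)

  reach-walk : ∀ {X u v} → Reach G X u v → Walk (Reach G X u) u v
  reach-walk (here p)         = here (here p)
  reach-walk r@(step s e p)   = walk-snoc (reach-walk s) e r

  connected : ∀ {X u v w} → Reach G X u v → Reach G X u w → Walk (Reach G X u) v w
  connected r s = walk-++ (walk-sym (reach-walk r)) (reach-walk s)

  module _ {X : Subset n} {s : Fin n} where

    -- A walk in the graph without `X - s` can leave the component of `u` only through `s`; the
    -- vertex before its first visit to `s` is the required neighbour.
    attached : ∀ {u v} → u ∉ X → Reach G (X - s) u v → ¬ Reach G X u v → ∃ λ a → Reach G X u a × s ~ a
    attached u∉ r sep = [ (λ q → ⊥-elim (sep q)) , (λ a → a) ]′ (go r)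
      where
      go : ∀ {w} → Reach G (X - s) _ w → Reach G X _ w ⊎ ∃ λ a → Reach G X _ a × s ~ a
      go (here _) = inj₁ (here u∉)
      go (step {w = w} r e p) with go r | w ≟ s
      ... | inj₂ a | _        = inj₂ a
      ... | inj₁ q | yes refl = inj₂ (_ , q , ~-sym e)
      ... | inj₁ q | no ne    = inj₁ (step q e λ w∈ → p (x∈p∧x≢y⇒x∈p-y w∈ ne))

members : ∀ {n} → Subset n → List (Fin n)
members []          = []
members (true ∷ p)  = fzero ∷ map fsuc (members p)
members (false ∷ p) = map fsuc (members p)

length-members : ∀ {n} (p : Subset n) → length (members p) ≡ ∣ p ∣
length-members []          = refl
length-members (true ∷ p)  = cong suc (trans (length-map fsuc (members p)) (length-members p))
length-members (false ∷ p) = trans (length-map fsuc (members p)) (length-members p)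

members-∈ : ∀ {n} (p : Subset n) {v} → v ∈ₗ members p → v ∈ p
members-∈ (true ∷ p)  (here refl) = here
members-∈ (true ∷ p)  (there i) with ∈-map⁻ fsuc i
... | w , j , refl = there (members-∈ p j)
members-∈ (false ∷ p) i with ∈-map⁻ fsuc i
... | w , j , refl = there (members-∈ p j)

map-unique : ∀ {n} (l : List (Fin n)) → Hom 2 _≢_ l → Hom 2 _≢_ (map fsuc l)
map-unique []      h       = tt
map-unique (x ∷ l) (d , h) = fresh l d , map-unique l h
  where
  fresh : ∀ l → Hom 1 (x ≢_) l → Hom 1 (fsuc x ≢_) (map fsuc l)
  fresh []      _       = tt
  fresh (y ∷ l) (n , d) = (λ e → n (fsuc-injective e)) , fresh l d

members-unique : ∀ {n} (p : Subset n) → Hom 2 _≢_ (members p)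
members-unique []          = tt
members-unique (true ∷ p)  = fresh (members p) , map-unique (members p) (members-unique p)
  where
  fresh : ∀ {n} (l : List (Fin n)) → Hom 1 (fzero ≢_) (map fsuc l)
  fresh []      = tt
  fresh (x ∷ l) = (λ ()) , fresh l
members-unique (false ∷ p) = map-unique (members p) (members-unique p)

theorem6p2 : (t : ℕ) → Σ ℕ λ τ →
    (G : Graph) → InCtt G t →
    (S : Subset (Graph.n G)) → IsMinimalSeparator G S →
    (Y : Subset (Graph.n G)) → Y ⊆ S → IsStable G Y →
    (∀ y → y ∈ Y → ¬ InHub G y) →
    ∣ Y ∣ ≤ τ
theorem6p2 t = threshold t , proof
  where
  proof : (G : Graph) → InCtt G t → (S : Subset (Graph.n G)) → IsMinimalSeparator G S →
          (Y : Subset (Graph.n G)) → Y ⊆ S → IsStable G Y → (∀ y → y ∈ Y → ¬ InHub G y) → ∣ Y ∣ ≤ threshold t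
  proof G (_ , noTheta , noPrism , _ , noClique , noPyramid) S (u , v , u∉ , v∉ , cutoff , min) Y Y⊆S stable noHub =
    ≮⇒≥ λ large → Core.bounded t noPyramid noClique (members-unique Y) (members-∈ Y)
      (side u∉ cutoff λ s∈ → min _ (x∈p⇒p-x⊂p s∈))
      (side v∉ (cutoff ∘ reach-sym) λ s∈ → reach-sym (min _ (x∈p⇒p-x⊂p s∈)))
      (λ p q → (λ { refl → cutoff (reach-++ p (reach-sym q)) }) , λ e → cutoff (reach-++ (step p e (reach-∉ q)) (reach-sym q)))
      (≤-trans (<⇒≤ large) (≤-reflexive (sym (length-members Y))))
    where
    open Separator G
    open Separated G noTheta noPrism (_∈ Y) stable noHub using (Side; module Core)
    side : ∀ {u v} → u ∉ S → ¬ Reach G S u v → (∀ {s} → s ∈ S → Reach G (S - s) u v) → Side (_∈ₗ members Y) (Reach G S u)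
    side u∉ cutoff minimal = record
      { conn = connected
      ; att  = λ y∈ → attached u∉ (minimal (Y⊆S (members-∈ Y y∈))) cutoff
      ; off  = λ y∈ r → reach-∉ r (Y⊆S y∈) }
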